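{- Let $D=\mathbb{Z}[\omega]$ with $\omega=\frac{ -1+i\sqrt{3}}{2}$. Let $\pi_1,\pi_2\in D$ be primary primes with $N\pi_1\neq 3$, $N\pi_2\neq 3$ and $N\pi_1\neq N\pi_2$. Then $$\chi_{\pi_1}(\pi_2)=\chi_{\pi_2}(\pi_1).$$
   Context: For $\alpha=a+b\omega\in D$ with $a,b\in\mathbb{Z}$, the norm is $N\alpha=\alpha\overline{\alpha}=a^2-ab+b^2$. A prime $\pi\in D$ is called primary if $\pi\equiv 2\pmod 3$ in $D$ (i.e. $\pi=a+b\omega$ with $a\equiv 2$, $b\equiv 0\pmod 3$). For a prime $\pi\in D$ with $N\pi\ne 3$, the cubic residue character $\chi_\pi$ on $D$ is defined by: $\chi_\pi(\alpha)=0$ if $\pi\mid\alpha$; otherwise $\chi_\pi(\alpha)$ is the unique element of $\{1,\omega,\omega^2\}$ with $\alpha^{(N\pi-1)/3}\equiv\chi_\pi(\alpha)\pmod{\pi}$. -}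

module Defs where

open import Algebra.Bundles using (CommutativeRing; Semiring)
import Algebra.Definitions.RawSemiring as RawSemiringDefs
import Algebra.Definitions.RawMagma as Divides using (_,_)
import Data.Integer.Base
open import Data.Bool.Base using (if_then_else_)
open import Data.Integer.Base as ℤ using (ℤ; +_; 0ℤ; 1ℤ; ∣_∣)
import Data.Integer.Properties as ℤ
import Data.Integer.Divisibility.Signed as ℤ
open import Data.Integer.Tactic.RingSolver using (solve-∀)
open import Data.Nat.Base as ℕ using (ℕ)
import Data.Nat.DivMod as ℕ
import Data.Nat.Properties as ℕ
open import Data.Product.Base using (_,_; _×_)
open import Data.Sum.Base using (reduce)
open import Level using (0ℓ)
open import Relation.Binary.PropositionalEquality
open import Relation.Binary.Definitions using (Decidable; DecidableEquality)
open import Relation.Nullary.Decidable using (Dec; yes; no; does; map′; _×-dec_)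

-- a +ω b stands for a + b ω, where ω = (-1 + i√3)/2 is a root of ω² + ω + 1.
-- Since 1 and ω are linearly independent over ℤ, equality in D is equality of
-- coordinates.  The fields re and im are coordinates in the basis 1, ω, not the
-- real and imaginary parts.
infix 5 _+ω_
record D : Set where
  constructor _+ω_
  field
    re : ℤ
    im : ℤ

open D public

infixl 6 _⊕_ _⊖_
infixl 7 _⊛_
infix  8 ⊝_

_⊕_ : D → D → D
(a +ω b) ⊕ (c +ω d) = (a ℤ.+ c) +ω (b ℤ.+ d)

⊝_ : D → D
⊝ (a +ω b) = (ℤ.- a) +ω (ℤ.- b)

_⊖_ : D → D → D
α ⊖ β = α ⊕ (⊝ β)

-- Uses ω² = -1 - ω.
_⊛_ : D → D → D
(a +ω b) ⊛ (c +ω d) =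
  (a ℤ.* c ℤ.- b ℤ.* d) +ω (a ℤ.* d ℤ.+ b ℤ.* c ℤ.- b ℤ.* d)

fromℤ : ℤ → D
fromℤ a = a +ω 0ℤ

0D 1D ω : D
0D = fromℤ 0ℤ
1D = fromℤ 1ℤ
ω  = 0ℤ +ω 1ℤ

D-commutativeRing : CommutativeRing 0ℓ 0ℓ
D-commutativeRing = record
  { Carrier = D ; _≈_ = _≡_
  ; _+_ = _⊕_ ; _*_ = _⊛_ ; -_ = ⊝_ ; 0# = 0D ; 1# = 1D
  ; isCommutativeRing = record
    { isRing = record
      { +-isAbelianGroup = record
        { isGroup = record
          { isMonoid = record
            { isSemigroup = record
              { isMagma = record
                { isEquivalence = isEquivalence ; ∙-cong = cong₂ _⊕_ }
              ; assoc = λ (a +ω b) (c +ω d) (e +ω f) →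
                  cong₂ _+ω_ (ℤ.+-assoc a c e) (ℤ.+-assoc b d f) }
            ; identity =
                (λ (a +ω b) → cong₂ _+ω_ (ℤ.+-identityˡ a) (ℤ.+-identityˡ b))
              , (λ (a +ω b) → cong₂ _+ω_ (ℤ.+-identityʳ a) (ℤ.+-identityʳ b)) }
          ; inverse =
              (λ (a +ω b) → cong₂ _+ω_ (ℤ.+-inverseˡ a) (ℤ.+-inverseˡ b))
            , (λ (a +ω b) → cong₂ _+ω_ (ℤ.+-inverseʳ a) (ℤ.+-inverseʳ b))
          ; ⁻¹-cong = cong ⊝_ }
        ; comm = λ (a +ω b) (c +ω d) →
            cong₂ _+ω_ (ℤ.+-comm a c) (ℤ.+-comm b d) }
      ; *-cong = cong₂ _⊛_
      ; *-assoc = λ (a +ω b) (c +ω d) (e +ω f) →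
          cong₂ _+ω_ (assoc₁ a b c d e f) (assoc₂ a b c d e f)
      ; *-identity =
          (λ (a +ω b) → cong₂ _+ω_ (idˡ₁ a b) (idˡ₂ a b))
        , (λ (a +ω b) → cong₂ _+ω_ (idʳ₁ a b) (idʳ₂ a b))
      ; distrib =
          (λ (a +ω b) (c +ω d) (e +ω f) →
            cong₂ _+ω_ (distˡ₁ a b c d e f) (distˡ₂ a b c d e f))
        , (λ (a +ω b) (c +ω d) (e +ω f) →
            cong₂ _+ω_ (distʳ₁ a b c d e f) (distʳ₂ a b c d e f)) }
    ; *-comm = λ (a +ω b) (c +ω d) →
        cong₂ _+ω_ (comm₁ a b c d) (comm₂ a b c d) } }
  where
  open Data.Integer.Base using (_+_; _*_; _-_)

  assoc₁ : ∀ a b c d e f →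
    (a * c - b * d) * e - (a * d + b * c - b * d) * f
      ≡ a * (c * e - d * f) - b * (c * f + d * e - d * f)
  assoc₁ = solve-∀

  assoc₂ : ∀ a b c d e f →
    (a * c - b * d) * f + (a * d + b * c - b * d) * e
        - (a * d + b * c - b * d) * f
      ≡ a * (c * f + d * e - d * f) + b * (c * e - d * f)
        - b * (c * f + d * e - d * f)
  assoc₂ = solve-∀

  idˡ₁ : ∀ a b → 1ℤ * a - 0ℤ * b ≡ a
  idˡ₁ = solve-∀

  idˡ₂ : ∀ a b → 1ℤ * b + 0ℤ * a - 0ℤ * b ≡ b
  idˡ₂ = solve-∀

  idʳ₁ : ∀ a b → a * 1ℤ - b * 0ℤ ≡ a
  idʳ₁ = solve-∀

  idʳ₂ : ∀ a b → a * 0ℤ + b * 1ℤ - b * 0ℤ ≡ b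
  idʳ₂ = solve-∀

  distˡ₁ : ∀ a b c d e f →
    a * (c + e) - b * (d + f) ≡ (a * c - b * d) + (a * e - b * f)
  distˡ₁ = solve-∀

  distˡ₂ : ∀ a b c d e f →
    a * (d + f) + b * (c + e) - b * (d + f)
      ≡ (a * d + b * c - b * d) + (a * f + b * e - b * f)
  distˡ₂ = solve-∀

  distʳ₁ : ∀ a b c d e f →
    (c + e) * a - (d + f) * b ≡ (c * a - d * b) + (e * a - f * b)
  distʳ₁ = solve-∀

  distʳ₂ : ∀ a b c d e f →
    (c + e) * b + (d + f) * a - (d + f) * b
      ≡ (c * b + d * a - d * b) + (e * b + f * a - f * b)
  distʳ₂ = solve-∀

  comm₁ : ∀ a b c d → a * c - b * d ≡ c * a - d * b
  comm₁ = solve-∀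

  comm₂ : ∀ a b c d →
    a * d + b * c - b * d ≡ c * b + d * a - d * b
  comm₂ = solve-∀

open RawSemiringDefs
  (Semiring.rawSemiring (CommutativeRing.semiring D-commutativeRing)) public
  using (_∣_; _∤_; _^_; Prime)

-- ω̄ = ω² = -1 - ω.
conj : D → D
conj (a +ω b) = (a ℤ.- b) +ω (ℤ.- b)

norm : D → ℤ
norm (a +ω b) = a ℤ.* a ℤ.- a ℤ.* b ℤ.+ b ℤ.* b

⊛-conj : ∀ α → α ⊛ conj α ≡ fromℤ (norm α)
⊛-conj (a +ω b) = cong₂ _+ω_ (lem₁ a b) (lem₂ a b)
  where
  open Data.Integer.Base using (_+_; _*_; _-_; -_)

  lem₁ : ∀ a b → a * (a - b) - b * (- b) ≡ a * a - a * b + b * b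
  lem₁ = solve-∀

  lem₂ : ∀ a b → a * (- b) + b * (a - b) - b * (- b) ≡ 0ℤ
  lem₂ = solve-∀

infix 4 _≡_[mod_]
_≡_[mod_] : D → D → D → Set
α ≡ β [mod γ ] = γ ∣ (α ⊖ β)

Primary : D → Set
Primary π = π ≡ fromℤ (+ 2) [mod fromℤ (+ 3) ]

norm≡0⇒≡0 : ∀ α → norm α ≡ 0ℤ → α ≡ 0D
norm≡0⇒≡0 (a +ω b) N≡0 = cong₂ _+ω_ a≡0 b≡0
  where
  open Data.Integer.Base using (_+_; _*_; _-_)

  m n : ℕ
  m = ∣ + 2 * a - b ∣
  n = ∣ b ∣

  square : ∀ i → + (∣ i ∣ ℕ.* ∣ i ∣) ≡ i * i
  square (+ k)      = ℤ.pos-* k k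
  square ℤ.-[1+ k ] = refl

  four-norm : ∀ a b →
    (+ 2 * a - b) * (+ 2 * a - b) + + 3 * (b * b)
      ≡ + 4 * (a * a - a * b + b * b)
  four-norm = solve-∀

  sum≡0 : m ℕ.* m ℕ.+ 3 ℕ.* (n ℕ.* n) ≡ 0
  sum≡0 = ℤ.+-injective (begin
    + (m ℕ.* m) + + (3 ℕ.* (n ℕ.* n))
      ≡⟨ cong₂ _+_ (square (+ 2 * a - b))
           (trans (ℤ.pos-* 3 (n ℕ.* n)) (cong (+ 3 *_) (square b))) ⟩
    (+ 2 * a - b) * (+ 2 * a - b) + + 3 * (b * b)
      ≡⟨ four-norm a b ⟩
    + 4 * (a * a - a * b + b * b)
      ≡⟨ cong (+ 4 *_) N≡0 ⟩
    0ℤ ∎)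
    where open ≡-Reasoning

  b≡0 : b ≡ 0ℤ
  b≡0 = ℤ.∣i∣≡0⇒i≡0 (reduce (ℕ.m*n≡0⇒m≡0∨n≡0 n
          (ℕ.m+n≡0⇒m≡0 (n ℕ.* n) (ℕ.m+n≡0⇒n≡0 (m ℕ.* m) sum≡0))))

  b=0-norm : ∀ a → a * a - a * 0ℤ + 0ℤ * 0ℤ ≡ a * a
  b=0-norm = solve-∀

  a≡0 : a ≡ 0ℤ
  a≡0 = reduce (ℤ.i*j≡0⇒i≡0∨j≡0 a
          (trans (sym (b=0-norm a))
            (subst (λ x → a * a - a * x + x * x ≡ 0ℤ) b≡0 N≡0)))

⊛-fromℤ : ∀ α n → α ⊛ fromℤ n ≡ (re α ℤ.* n) +ω (im α ℤ.* n)
⊛-fromℤ (a +ω b) n = cong₂ _+ω_ (lem₁ a b n) (lem₂ a b n)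
  where
  open Data.Integer.Base using (_+_; _*_; _-_)

  lem₁ : ∀ a b n → a * n - b * 0ℤ ≡ a * n
  lem₁ = solve-∀

  lem₂ : ∀ a b n → a * 0ℤ + b * n - b * 0ℤ ≡ b * n
  lem₂ = solve-∀

⊛-fromℤ-cancel : ∀ α β n → n ≢ 0ℤ → α ⊛ fromℤ n ≡ β ⊛ fromℤ n → α ≡ β
⊛-fromℤ-cancel α β n n≢0 eq =
  cong₂ _+ω_ (ℤ.*-cancelʳ-≡ (re α) (re β) n (cong re eq′))
             (ℤ.*-cancelʳ-≡ (im α) (im β) n (cong im eq′))
  where
  instance _ = ℤ.≢-nonZero n≢0
  eq′ = trans (sym (⊛-fromℤ α n)) (trans eq (⊛-fromℤ β n))

infix 4 _≟_
_≟_ : DecidableEquality D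
(a +ω b) ≟ (c +ω d) =
  map′ (λ (p , q) → cong₂ _+ω_ p q) (λ eq → cong re eq , cong im eq)
       (a ℤ.≟ c ×-dec b ℤ.≟ d)

-- For π ≠ 0, π divides α iff the integer N π divides both coordinates of α π̄.
infix 4 _∣?_
_∣?_ : Decidable _∣_
π ∣? α with norm π ℤ.≟ 0ℤ
... | yes N≡0 = map′ to from (0D ≟ α)
  where
  open CommutativeRing D-commutativeRing using (zeroʳ)

  π≡0 : π ≡ 0D
  π≡0 = norm≡0⇒≡0 π N≡0

  *π≡0 : ∀ κ → κ ⊛ π ≡ 0D
  *π≡0 κ = trans (cong (κ ⊛_) π≡0) (zeroʳ κ)

  to : 0D ≡ α → π ∣ α
  to eq = 0D Divides., trans (*π≡0 0D) eq

  from : π ∣ α → 0D ≡ α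
  from (κ Divides., eq) = trans (sym (*π≡0 κ)) eq
... | no N≢0 = map′ to from (N ℤ.∣? re απ̄ ×-dec N ℤ.∣? im απ̄)
  where
  open CommutativeRing D-commutativeRing using (*-assoc; *-comm)
  open ≡-Reasoning

  N : ℤ
  N = norm π

  απ̄ : D
  απ̄ = α ⊛ conj π

  conj-⊛ : conj π ⊛ π ≡ fromℤ N
  conj-⊛ = trans (*-comm (conj π) π) (⊛-conj π)

  to : (N ℤ.∣ re απ̄) × (N ℤ.∣ im απ̄) → π ∣ α
  to (ℤ.divides k x≡kN , ℤ.divides l y≡lN) =
    κ Divides., ⊛-fromℤ-cancel (κ ⊛ π) α N N≢0 (begin
      (κ ⊛ π) ⊛ fromℤ N  ≡⟨ *-assoc κ π (fromℤ N) ⟩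
      κ ⊛ (π ⊛ fromℤ N)  ≡⟨ cong (κ ⊛_) (*-comm π (fromℤ N)) ⟩
      κ ⊛ (fromℤ N ⊛ π)  ≡⟨ *-assoc κ (fromℤ N) π ⟨
      (κ ⊛ fromℤ N) ⊛ π  ≡⟨ cong (_⊛ π) (⊛-fromℤ κ N) ⟩
      ((k ℤ.* N) +ω (l ℤ.* N)) ⊛ π
                         ≡⟨ cong (_⊛ π) (cong₂ _+ω_ x≡kN y≡lN) ⟨
      (α ⊛ conj π) ⊛ π   ≡⟨ *-assoc α (conj π) π ⟩
      α ⊛ (conj π ⊛ π)   ≡⟨ cong (α ⊛_) conj-⊛ ⟩
      α ⊛ fromℤ N        ∎)
    where
    κ : D
    κ = k +ω l

  from : π ∣ α → (N ℤ.∣ re απ̄) × (N ℤ.∣ im απ̄)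
  from (κ Divides., κπ≡α) =
    ℤ.divides (re κ) (cong re eq) , ℤ.divides (im κ) (cong im eq)
    where
    eq : απ̄ ≡ (re κ ℤ.* N) +ω (im κ ℤ.* N)
    eq = begin
      α ⊛ conj π         ≡⟨ cong (_⊛ conj π) κπ≡α ⟨
      (κ ⊛ π) ⊛ conj π   ≡⟨ *-assoc κ π (conj π) ⟩
      κ ⊛ (π ⊛ conj π)   ≡⟨ cong (κ ⊛_) (⊛-conj π) ⟩
      κ ⊛ fromℤ N        ≡⟨ ⊛-fromℤ κ N ⟩
      (re κ ℤ.* N) +ω (im κ ℤ.* N) ∎

_≡_[mod_]? : ∀ α β γ → Dec (α ≡ β [mod γ ])
α ≡ β [mod γ ]? = γ ∣? (α ⊖ β)

-- The cubic residue character χ_π.  For π prime with N π ≠ 3 and π ∤ α, exactly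
-- one of 1, ω, ω² is congruent to α^((N π - 1)/3) mod π, so the order of the
-- tests is immaterial and the final case never arises; it only
-- makes χ total.  The norm is non-negative, so ∣ norm π ∣ is N π as a natural.
χ : D → D → D
χ π α = if does (π ∣? α) then 0D
   else if does (αᵉ ≡ 1D    [mod π ]?) then 1D
   else if does (αᵉ ≡ ω     [mod π ]?) then ω
   else if does (αᵉ ≡ ω ^ 2 [mod π ]?) then ω ^ 2
   else 0D
  where
  αᵉ : D
  αᵉ = α ^ ((∣ norm π ∣ ℕ.∸ 1) ℕ./ 3)

{-# OPTIONS --safe #-}

-- Let p = N π be a rational prime and let G = ∑ χ_π(t) [t] in the group ring of ℤ/p.
-- With G₂ = ∑ χ_π(t)² [t] and the Jacobi sum J = ∑ χ_π(u) χ_π(1 - u) one has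
-- G² = J G₂ and G G₂ = p [0] - ∑ [t], hence G⁴ = J p G.  Computing G² G₂ in two
-- ways gives N J = p; cubing G modulo 3 gives J ≡ -1 (mod 3); and π divides J,
-- because modulo π it is the sum of the values of a polynomial of degree less than
-- p - 1.  As π is primary, J = π.
--
-- Now let N = 1 + 3 m be the norm of another primary prime π′, lying above the
-- rational prime ℓ.  Since N is a power of ℓ, raising to the N-th power is additive
-- modulo ℓ, and the coefficient of [N] in G^N = (π p)^m G shows that
-- (π p)^m χ_π(N) ≡ 1 (mod ℓ), that is, χ_π′(π) χ_π′(p) χ_π(N) = 1.
-- If N is a rational prime, compare this with the same equation for π and π′
-- exchanged.  If π′ = q is rational, then N = q² and χ_q(p) = 1, so that
-- χ_q(π) = χ_π(q)⁻² = χ_π(q).  Between two rational primes both characters are 1.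

module Submission where

open import Algebra.Bundles using (CommutativeRing; Semiring)
import Algebra.Definitions.RawMagma as Divides using (_,_; module _∣ʳ_)
import Algebra.Definitions.RawSemiring as RawSemiringDefs
import Algebra.Properties.AbelianGroup as AbelianGroupProperties
import Algebra.Properties.CommutativeSemiring.Binomial as BinomialTheorem
import Algebra.Properties.CommutativeSemigroup as CommutativeSemigroupProperties
import Algebra.Properties.CommutativeSemiring.Exp as Exponentiation
import Algebra.Properties.Ring as RingProperties
import Algebra.Properties.Semiring.Mult as Multiples
import Algebra.Properties.Semiring.Sum as Sums
open import Data.Bool.Base using (if_then_else_)
open import Data.Empty using (⊥-elim)
open import Data.Fin.Base as Fin using (Fin; zero; suc; toℕ; fromℕ; inject₁; fromℕ<)
import Data.Fin.Properties as Fin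
open import Data.Fin.Permutation using (Permutation; permutation)
open import Data.Integer.Base as ℤ using (ℤ; +_; 0ℤ; 1ℤ; ∣_∣)
import Data.Integer.Base
import Data.Integer.DivMod as ℤ
import Data.Integer.Divisibility.Signed as ℤ
import Data.Integer.Properties as ℤ
import Data.Integer.Tactic.RingSolver as ℤ
open import Data.List.Base using ([]; _∷_)
open import Data.List.Relation.Unary.All using (All; []; _∷_)
open import Data.Nat.Base as ℕ using (ℕ; zero; suc; s≤s; z≤n; _!)
import Data.Nat.Combinatorics as ℕ
import Data.Nat.Coprimality as ℕ
import Data.Nat.Divisibility as ℕ
import Data.Nat.DivMod as ℕ
open import Data.Nat.GCD using (module Bézout)
open import Data.Nat.ListAction using (product)
import Data.Nat.Primality as ℕ
open import Data.Nat.Primality.Factorisation using (PrimeFactorisation; factorise)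
import Data.Nat.Properties as ℕ
import Data.Nat.Tactic.RingSolver as ℕ
open import Data.Product.Base using (_,_; _×_; Σ; proj₁; proj₂)
open import Data.Sum.Base using (_⊎_; inj₁; inj₂; [_,_]′; reduce)
open import Data.Vec.Functional using (replicate)
open import Function.Base using (_∘_; _$_; id; case_of_)
open import Level using (0ℓ; _⊔_)
open import Relation.Binary.PropositionalEquality as ≡
  using (_≡_; _≢_; cong; cong₂; subst; subst₂; module ≡-Reasoning)
import Relation.Binary.Reasoning.Setoid as SetoidReasoning
open import Relation.Nullary.Decidable
  using (Dec; yes; no; does; dec⇒maybe; dec-true; dec-false; map′; toWitness)
open import Relation.Nullary.Negation using (¬_; contradiction)
open import Tactic.RingSolver using (solve-∀)
open import Tactic.RingSolver.Core.AlmostCommutativeRing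
  using (AlmostCommutativeRing; fromCommutativeRing)

-- The group ring stands in for the p-th roots of unity: no cyclotomic ring has to be built, the
-- coefficients can be taken in `D`, `D/3` or `D/ℓ` at will, and linear independence becomes
-- comparison of coefficients. The price is that the sum of all group elements is not 0. Since G
-- kills it, G is not invertible, and G³ is not a scalar; this is why only the exponents 1 + 3 m,
-- with one spare factor G, have a clean formula. The rings `D/3` and `D/ℓ` may have zero divisors,
-- so that the vanishing of character sums is proved over `D` and then carried over. Residue fields
-- are never counted. Fermat's congruence in `D` comes from the action of the p-th power on ω, and
-- the existence of a cubic nonresidue comes from power sums. The same nonresidue excludes the
-- primary candidate -p with p ≡ 1 (mod 3), so that every primary prime either has prime norm p ≡ 1
-- or is a rational prime q ≡ 2. Finally, J and π have the same norm, which makes J / π a unit, and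
-- the congruence modulo 3 singles out one of the six units.

-- Quotients of a commutative ring by a principal ideal

module Quotient {c ℓ} (R : CommutativeRing c ℓ) (γ : CommutativeRing.Carrier R) where
  open CommutativeRing R hiding (zero)
  open RawSemiringDefs (Semiring.rawSemiring semiring) using (_∣_)
  open AbelianGroupProperties +-abelianGroup using (⁻¹-anti-homo‿-; ⁻¹-∙-comm)
  open RingProperties ring using (x[y-z]≈xy-xz; -‿distribˡ-*)
  open SetoidReasoning setoid

  infix 4 _≋_
  -- A record and not a synonym for divisibility, because `x` and `y` cannot be inferred from their
  -- difference once subtraction computes.
  record _≋_ (x y : Carrier) : Set (c ⊔ ℓ) where
    constructor divides-difference
    field difference : γ ∣ (x - y)

  open _≋_ public

  private
    ∣-≈ : ∀ {x y} → x ≈ y → γ ∣ x → γ ∣ y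
    ∣-≈ x≈y (q Divides., e) = q Divides., trans e x≈y

    ∣-+ : ∀ {x y} → γ ∣ x → γ ∣ y → γ ∣ x + y
    ∣-+ (q Divides., e) (r Divides., f) =
      (q + r) Divides., trans (distribʳ γ q r) (+-cong e f)

    ∣-neg : ∀ {x} → γ ∣ x → γ ∣ - x
    ∣-neg (q Divides., e) =
      (- q) Divides., trans (sym (-‿distribˡ-* q γ)) (-‿cong e)

    ∣-*ˡ : ∀ x {y} → γ ∣ y → γ ∣ x * y
    ∣-*ˡ x (q Divides., e) = (x * q) Divides., trans (*-assoc x q γ) (*-congˡ e)

    telescope : ∀ x y z → (x - y) + (y - z) ≈ x - z
    telescope x y z = begin
      (x - y) + (y - z)    ≈⟨ +-assoc x (- y) (y - z) ⟩
      x + (- y + (y - z))  ≈⟨ +-congˡ (+-assoc (- y) y (- z)) ⟨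
      x + (- y + y - z)    ≈⟨ +-congˡ (+-congʳ (-‿inverseˡ y)) ⟩
      x + (0# - z)         ≈⟨ +-congˡ (+-identityˡ (- z)) ⟩
      x - z                ∎

    interchange : ∀ x y u v → (x - u) + (y - v) ≈ (x + y) - (u + v)
    interchange x y u v = begin
      (x - u) + (y - v)      ≈⟨ +-assoc x (- u) (y - v) ⟩
      x + (- u + (y - v))    ≈⟨ +-congˡ (+-assoc (- u) y (- v)) ⟨
      x + (- u + y - v)      ≈⟨ +-congˡ (+-congʳ (+-comm (- u) y)) ⟩
      x + (y - u - v)        ≈⟨ +-congˡ (+-assoc y (- u) (- v)) ⟩
      x + (y + (- u - v))    ≈⟨ +-assoc x y (- u - v) ⟨
      (x + y) + (- u - v)    ≈⟨ +-congˡ (⁻¹-∙-comm u v) ⟩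
      (x + y) - (u + v)      ∎

  ≈⇒≋ : ∀ {x y} → x ≈ y → x ≋ y
  ≈⇒≋ {x} {y} x≈y = divides-difference $
    0# Divides., trans (zeroˡ γ) (sym (trans (+-congʳ x≈y) (-‿inverseʳ y)))

  ≋-sym : ∀ {x y} → x ≋ y → y ≋ x
  ≋-sym {x} {y} (divides-difference d) =
    divides-difference (∣-≈ (⁻¹-anti-homo‿- x y) (∣-neg d))

  ≋-trans : ∀ {x y z} → x ≋ y → y ≋ z → x ≋ z
  ≋-trans {x} {y} {z} (divides-difference d) (divides-difference e) =
    divides-difference (∣-≈ (telescope x y z) (∣-+ d e))

  ≋-+-cong : ∀ {x y u v} → x ≋ u → y ≋ v → (x + y) ≋ (u + v)
  ≋-+-cong {x} {y} {u} {v} (divides-difference d) (divides-difference e) =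
    divides-difference (∣-≈ (interchange x y u v) (∣-+ d e))

  ≋-*-cong : ∀ {x y u v} → x ≋ u → y ≋ v → (x * y) ≋ (u * v)
  ≋-*-cong {x} {y} {u} {v} (divides-difference d) (divides-difference e) = divides-difference $ ∣-≈
    (begin
      y * (x - u) + u * (y - v)          ≈⟨ +-cong (x[y-z]≈xy-xz y x u) (x[y-z]≈xy-xz u y v) ⟩
      (y * x - y * u) + (u * y - u * v)  ≈⟨ +-congʳ (+-cong (*-comm y x) (-‿cong (*-comm y u))) ⟩
      (x * y - u * y) + (u * y - u * v)  ≈⟨ telescope (x * y) (u * y) (u * v) ⟩
      x * y - u * v                      ∎)
    (∣-+ (∣-*ˡ y d) (∣-*ˡ u e))

  ≋-neg-cong : ∀ {x y} → x ≋ y → (- x) ≋ (- y)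
  ≋-neg-cong {x} {y} (divides-difference d) =
    divides-difference (∣-≈ (sym (⁻¹-∙-comm x (- y))) (∣-neg d))

  γ≋0 : γ ≋ 0#
  γ≋0 = divides-difference $ 1# Divides., trans (*-identityˡ γ) (sym (trans (+-congˡ (⁻¹-zero)) (+-identityʳ γ)))
    where
    ⁻¹-zero : - 0# ≈ 0#
    ⁻¹-zero = trans (sym (+-identityˡ (- 0#))) (-‿inverseʳ 0#)

  quotient : CommutativeRing c _
  quotient = record
    { Carrier = Carrier ; _≈_ = _≋_
    ; _+_ = _+_ ; _*_ = _*_ ; -_ = -_ ; 0# = 0# ; 1# = 1#
    ; isCommutativeRing = record
      { isRing = record
        { +-isAbelianGroup = record
          { isGroup = record
            { isMonoid = record
              { isSemigroup = record
                { isMagma = record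
                  { isEquivalence = record
                    { refl = ≈⇒≋ refl ; sym = ≋-sym ; trans = ≋-trans }
                  ; ∙-cong = ≋-+-cong }
                ; assoc = λ x y z → ≈⇒≋ (+-assoc x y z) }
              ; identity = (λ x → ≈⇒≋ (+-identityˡ x)) , (λ x → ≈⇒≋ (+-identityʳ x)) }
            ; inverse = (λ x → ≈⇒≋ (-‿inverseˡ x)) , (λ x → ≈⇒≋ (-‿inverseʳ x))
            ; ⁻¹-cong = ≋-neg-cong }
          ; comm = λ x y → ≈⇒≋ (+-comm x y) }
        ; *-cong = ≋-*-cong
        ; *-assoc = λ x y z → ≈⇒≋ (*-assoc x y z)
        ; *-identity = (λ x → ≈⇒≋ (*-identityˡ x)) , (λ x → ≈⇒≋ (*-identityʳ x))
        ; distrib = (λ x y z → ≈⇒≋ (distribˡ x y z)) , (λ x y z → ≈⇒≋ (distribʳ x y z)) }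
      ; *-comm = λ x y → ≈⇒≋ (*-comm x y) } }

-- Additivity of power maps in prime characteristic

module _ {p : ℕ} (prime-p : ℕ.Prime p) where

  p∤k! : ∀ k → k ℕ.< p → ¬ p ℕ.∣ k !
  p∤k! zero    k<p p∣ = ℕ.¬prime[1] (subst ℕ.Prime (ℕ.∣1⇒≡1 p∣) prime-p)
  p∤k! (suc k) k<p p∣ with ℕ.euclidsLemma (suc k) (k !) prime-p p∣
  ... | inj₁ p∣1+k = ℕ.<⇒≱ k<p (ℕ.∣⇒≤ p∣1+k)
  ... | inj₂ p∣k!  = p∤k! k (ℕ.<-trans (ℕ.n<1+n k) k<p) p∣k!

  -- The prime divides `p !`, which is the binomial coefficient times `k ! * (p - k) !`, and the
  -- latter has only factors below `p`.
  p∣pCk : ∀ k → 0 ℕ.< k → k ℕ.< p → p ℕ.∣ p ℕ.C k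
  p∣pCk k 0<k k<p with ℕ.euclidsLemma (p ℕ.C k) (k ! ℕ.* (p ℕ.∸ k) !) prime-p p∣C*d
    where
    instance _ = k ℕ.!* (p ℕ.∸ k) !≢0

    p∣p! : ∀ q → 0 ℕ.< q → q ℕ.∣ q !
    p∣p! (suc q) _ = ℕ.m∣m*n (q !)

    p∣C*d : p ℕ.∣ (p ℕ.C k) ℕ.* (k ! ℕ.* (p ℕ.∸ k) !)
    p∣C*d = subst (p ℕ.∣_)
      (≡.trans (≡.sym (ℕ.m/n*n≡m (ℕ.k![n∸k]!∣n! (ℕ.<⇒≤ k<p))))
             (cong (ℕ._* (k ! ℕ.* (p ℕ.∸ k) !)) (≡.sym (ℕ.nCk≡n!/k![n-k]! (ℕ.<⇒≤ k<p)))))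
      (p∣p! p (ℕ.<-trans 0<k k<p))
  ... | inj₁ p∣C = p∣C
  ... | inj₂ p∣d with ℕ.euclidsLemma (k !) ((p ℕ.∸ k) !) prime-p p∣d
  ...   | inj₁ p∣k! = contradiction p∣k! (p∤k! k k<p)
  ...   | inj₂ p∣j! = contradiction p∣j!
            (p∤k! (p ℕ.∸ k) (ℕ.∸-monoʳ-< 0<k (ℕ.<⇒≤ k<p)))

module Frobenius {c ℓ} (R : CommutativeRing c ℓ) where
  open CommutativeRing R hiding (zero)
  open Multiples semiring renaming (_×_ to _·_)
  open Exponentiation commutativeSemiring
  open Sums semiring
  open SetoidReasoning setoid

  -- A property of the exponent that is stable under products, so that it covers a prime and the
  -- square of a prime alike.
  record Additive (n : ℕ) : Set (c ⊔ ℓ) where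
    constructor additive
    field ^-distrib-+ : ∀ x y → (x + y) ^ n ≈ x ^ n + y ^ n

  open Additive public

  freshman's-dream : ∀ {p} → ℕ.Prime p → p · 1# ≈ 0# → ∀ x y → (x + y) ^ p ≈ x ^ p + y ^ p
  freshman's-dream {zero}      prime-p _ _ _ = ⊥-elim (ℕ.¬prime[0] prime-p)
  freshman's-dream {p@(suc m)} prime-p p≈0 x y = begin
    (x + y) ^ p                      ≈⟨ theorem p x y ⟩
    t zero + sum {p} (λ j → t (suc j))
      ≈⟨ +-congˡ (sum-init-last {m} (λ j → t (suc j))) ⟩
    t zero + (sum {m} (λ j → t (suc (inject₁ j))) + t (suc (fromℕ m)))
      ≈⟨ +-cong first (+-cong (trans (sum-cong-≋ {m} middle) (sum-replicate-zero m)) final) ⟩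
    y ^ p + (0# + x ^ p)             ≈⟨ +-congˡ (+-identityˡ _) ⟩
    y ^ p + x ^ p                    ≈⟨ +-comm _ _ ⟩
    x ^ p + y ^ p                    ∎
    where
    p·≈0 : ∀ z → p · z ≈ 0#
    p·≈0 z = begin
      p · z          ≈⟨ ×-congʳ p (*-identityˡ z) ⟨
      p · (1# * z)   ≈⟨ ×-assoc-* p 1# z ⟨
      (p · 1#) * z   ≈⟨ *-congʳ p≈0 ⟩
      0# * z         ≈⟨ zeroˡ z ⟩
      0#             ∎

    open BinomialTheorem commutativeSemiring using (theorem; binomialTerm)

    t : Fin (suc p) → Carrier
    t = binomialTerm x y p

    first : t zero ≈ y ^ p
    first = trans (+-identityʳ _) (*-identityˡ _)

    middle : ∀ j → t (suc (inject₁ j)) ≈ 0#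
    middle j with p∣pCk prime-p (suc (toℕ (inject₁ j))) (s≤s z≤n)
                    (s≤s (subst (ℕ._< m) (≡.sym (Fin.toℕ-inject₁ j)) (Fin.toℕ<n j)))
    ... | ℕ.divides q eq = begin
      (p ℕ.C suc (toℕ (inject₁ j))) · z  ≡⟨ cong (_· z) (≡.trans eq (ℕ.*-comm q p)) ⟩
      (p ℕ.* q) · z                      ≈⟨ ×-assocˡ z p q ⟨
      p · (q · z)                        ≈⟨ p·≈0 (q · z) ⟩
      0#                                 ∎
      where
      z : Carrier
      z = BinomialTheorem.binomial commutativeSemiring x y p (suc (inject₁ j))

    final : t (suc (fromℕ m)) ≈ x ^ p
    final = begin
      (p ℕ.C suc (toℕ (fromℕ m))) · (x ^ suc (toℕ (fromℕ m)) * y ^ (m ℕ.∸ toℕ (fromℕ m)))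
        ≡⟨ cong (λ i → (p ℕ.C suc i) · (x ^ suc i * y ^ (m ℕ.∸ i))) (Fin.toℕ-fromℕ m) ⟩
      (p ℕ.C p) · (x ^ p * y ^ (m ℕ.∸ m))
        ≡⟨ cong₂ (λ i j → i · (x ^ p * y ^ j)) (ℕ.nCn≡1 p) (ℕ.n∸n≡0 m) ⟩
      x ^ p * 1# + 0#  ≈⟨ +-identityʳ _ ⟩
      x ^ p * 1#       ≈⟨ *-identityʳ _ ⟩
      x ^ p            ∎

  prime-additive : ∀ {p} → ℕ.Prime p → p · 1# ≈ 0# → Additive p
  prime-additive prime-p p≈0 = additive (freshman's-dream prime-p p≈0)

  additive-* : ∀ {m n} → Additive m → Additive n → Additive (m ℕ.* n)
  additive-* {m} {n} add-m add-n = additive λ x y → begin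
    (x + y) ^ (m ℕ.* n)            ≈⟨ ^-assocʳ (x + y) m n ⟨
    ((x + y) ^ m) ^ n              ≈⟨ ^-congˡ n (^-distrib-+ add-m x y) ⟩
    (x ^ m + y ^ m) ^ n            ≈⟨ ^-distrib-+ add-n (x ^ m) (y ^ m) ⟩
    (x ^ m) ^ n + (y ^ m) ^ n      ≈⟨ +-cong (^-assocʳ x m n) (^-assocʳ y m n) ⟩
    x ^ (m ℕ.* n) + y ^ (m ℕ.* n)  ∎

  -- Positivity of `n` takes care of the empty sum, as `0# ^ 0` is `1#`.
  additive-sum : ∀ {n} → 0 ℕ.< n → Additive n →
    ∀ {k} (f : Fin k → Carrier) → sum f ^ n ≈ sum (λ i → f i ^ n)
  additive-sum {suc n} _ add {zero}  f = zeroˡ _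
  additive-sum {suc n} l add {suc k} f =
    trans (^-distrib-+ add (f zero) _) (+-congˡ (additive-sum l add (f ∘ suc)))

-- Power sums over the prime field

module PowerSums {c ℓ} (A : CommutativeRing c ℓ) where
  open CommutativeRing A hiding (zero)
  open Multiples semiring renaming (_×_ to _·_)
  open Exponentiation commutativeSemiring
  open Sums semiring
  open AbelianGroupProperties +-abelianGroup using (identityʳ-unique)
  open RingProperties ring using (-‿distribˡ-*)
  open CommutativeSemigroupProperties +-commutativeSemigroup using (interchange)
  module * = CommutativeSemigroupProperties *-commutativeSemigroup
  open SetoidReasoning setoid

  -- A polynomial function whose coefficients are peeled off from the top, so that its sum over the
  -- residues can be evaluated by recursion on the bound. The coefficient `c` may vanish.
  Deg< : ℕ → (Carrier → Carrier) → Set _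
  Deg< zero    f = ∀ x → f x ≈ 0#
  Deg< (suc d) f = Σ Carrier λ c → Σ (Carrier → Carrier) λ g →
    Deg< d g × (∀ x → f x ≈ c * x ^ d + g x)

  Deg<-+ : ∀ d {f g} → Deg< d f → Deg< d g → Deg< d (λ x → f x + g x)
  Deg<-+ zero    f≈0 g≈0 x = trans (+-cong (f≈0 x) (g≈0 x)) (+-identityˡ 0#)
  Deg<-+ (suc d) {f} {g} (a , f′ , df′ , ef) (b , g′ , dg′ , eg) =
    a + b , (λ x → f′ x + g′ x) , Deg<-+ d df′ dg′ , λ x → begin
      f x + g x                                  ≈⟨ +-cong (ef x) (eg x) ⟩
      (a * x ^ d + f′ x) + (b * x ^ d + g′ x)    ≈⟨ interchange _ _ _ _ ⟩
      (a * x ^ d + b * x ^ d) + (f′ x + g′ x)    ≈⟨ +-congʳ (distribʳ (x ^ d) a b) ⟨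
      (a + b) * x ^ d + (f′ x + g′ x)            ∎

  Deg<-scale : ∀ d {f} a → Deg< d f → Deg< d (λ x → a * f x)
  Deg<-scale zero    a f≈0 x = trans (*-congˡ (f≈0 x)) (zeroʳ a)
  Deg<-scale (suc d) {f} a (b , f′ , df′ , ef) =
    a * b , (λ x → a * f′ x) , Deg<-scale d a df′ , λ x → begin
      a * f x                      ≈⟨ *-congˡ (ef x) ⟩
      a * (b * x ^ d + f′ x)       ≈⟨ distribˡ _ _ _ ⟩
      a * (b * x ^ d) + a * f′ x   ≈⟨ +-congʳ (*-assoc a b _) ⟨
      a * b * x ^ d + a * f′ x     ∎

  Deg<-suc : ∀ d {f} → Deg< d f → Deg< (suc d) f
  Deg<-suc d {f} df = 0# , f , df , λ x →
    sym (trans (+-congʳ (zeroˡ (x ^ d))) (+-identityˡ (f x)))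

  Deg<-x* : ∀ d {f} → Deg< d f → Deg< (suc d) (λ x → x * f x)
  Deg<-x* zero    f≈0 =
    0# , (λ _ → 0#) , (λ _ → refl) , λ x →
      trans (trans (*-congˡ (f≈0 x)) (zeroʳ x)) (sym (trans (+-identityʳ _) (zeroˡ _)))
  Deg<-x* (suc d) {f} (a , f′ , df′ , ef) =
    a , (λ x → x * f′ x) , Deg<-x* d df′ , λ x → begin
      x * f x                        ≈⟨ *-congˡ (ef x) ⟩
      x * (a * x ^ d + f′ x)         ≈⟨ distribˡ _ _ _ ⟩
      x * (a * x ^ d) + x * f′ x     ≈⟨ +-congʳ (*.x∙yz≈y∙xz x a (x ^ d)) ⟩
      a * x ^ suc d + x * f′ x       ∎

  Deg<-resp : ∀ d {f g} → (∀ x → f x ≈ g x) → Deg< d f → Deg< d g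
  Deg<-resp zero    e f≈0 x = trans (sym (e x)) (f≈0 x)
  Deg<-resp (suc d) e (a , f′ , df′ , ef) = a , f′ , df′ , λ x → trans (sym (e x)) (ef x)

  Deg<-[1-x]* : ∀ d {f} → Deg< d f → Deg< (suc d) (λ x → (1# - x) * f x)
  Deg<-[1-x]* d {f} df = Deg<-resp (suc d)
    (λ x → begin
      1# * f x + (- 1#) * (x * f x)  ≈⟨ +-congˡ (-‿distribˡ-* 1# (x * f x)) ⟨
      1# * f x - 1# * (x * f x)      ≈⟨ +-congˡ (-‿cong (*-identityˡ _)) ⟩
      1# * f x - x * f x             ≈⟨ +-congˡ (-‿distribˡ-* x (f x)) ⟩
      1# * f x + (- x) * f x         ≈⟨ distribʳ (f x) 1# (- x) ⟨
      (1# - x) * f x                 ∎)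
    (Deg<-+ (suc d) (Deg<-suc d (Deg<-scale d 1# df)) (Deg<-scale (suc d) (- 1#) (Deg<-x* d df)))

  Deg<-x^ : ∀ d → Deg< (suc d) (_^ d)
  Deg<-x^ d = 1# , (λ _ → 0#) , Deg<-0 d , λ x → sym (trans (+-identityʳ _) (*-identityˡ _))
    where
    Deg<-0 : ∀ d → Deg< d (λ _ → 0#)
    Deg<-0 zero    _ = refl
    Deg<-0 (suc d) = Deg<-suc d (Deg<-0 d)

  Deg<-[1-x]^*x^ : ∀ j k → Deg< (j ℕ.+ suc k) (λ x → (1# - x) ^ j * x ^ k)
  Deg<-[1-x]^*x^ zero    k = Deg<-resp (suc k) (λ x → sym (*-identityˡ _)) (Deg<-x^ k)
  Deg<-[1-x]^*x^ (suc j) k = Deg<-resp (suc (j ℕ.+ suc k)) (λ x → sym (*-assoc _ _ _))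
    (Deg<-[1-x]* (j ℕ.+ suc k) (Deg<-[1-x]^*x^ j k))

  -- The two leading terms of the binomial expansion: the first telescopes away in a sum over all
  -- residues, and the second carries the power sum to be computed, with a coefficient that is
  -- invertible modulo `p`.
  [1+x]^suc : ∀ d → Σ (Carrier → Carrier) λ r → Deg< d r ×
    (∀ x → (1# + x) ^ suc d ≈ x ^ suc d + ((suc d · 1#) * x ^ d + r x))
  [1+x]^suc zero = (λ _ → 0#) , (λ _ → refl) , λ x → begin
    (1# + x) * 1#                     ≈⟨ *-identityʳ _ ⟩
    1# + x                            ≈⟨ +-comm 1# x ⟩
    x + 1#                            ≈⟨ +-cong (*-identityʳ x) (trans (+-identityʳ _) (trans (*-identityʳ _) (+-identityʳ 1#))) ⟨
    x * 1# + ((1# + 0#) * 1# + 0#)    ∎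
  [1+x]^suc (suc d) with [1+x]^suc d
  ... | r , dr , er = (λ x → (n * x ^ d + r x) + x * r x) ,
    Deg<-+ (suc d) (Deg<-+ (suc d) (Deg<-scale (suc d) n (Deg<-x^ d)) (Deg<-suc d dr)) (Deg<-x* d dr) ,
    λ x → begin
      (1# + x) * (1# + x) ^ suc d          ≈⟨ *-congˡ (er x) ⟩
      (1# + x) * (x ^ suc d + (n * x ^ d + r x))
        ≈⟨ distribʳ _ 1# x ⟩
      1# * (x ^ suc d + (n * x ^ d + r x)) + x * (x ^ suc d + (n * x ^ d + r x))
        ≈⟨ +-cong (*-identityˡ _) (trans (distribˡ _ _ _) (+-congˡ (distribˡ _ _ _))) ⟩
      (x ^ suc d + (n * x ^ d + r x)) + (x ^ suc (suc d) + (x * (n * x ^ d) + x * r x))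
        ≈⟨ +-congˡ (+-congˡ (+-congʳ (*.x∙yz≈y∙xz x n (x ^ d)))) ⟩
      (x ^ suc d + (n * x ^ d + r x)) + (x ^ suc (suc d) + (n * x ^ suc d + x * r x))
        ≈⟨ +.x∙yz≈y∙xz _ _ _ ⟩
      x ^ suc (suc d) + ((x ^ suc d + (n * x ^ d + r x)) + (n * x ^ suc d + x * r x))
        ≈⟨ +-congˡ (interchange _ _ _ _) ⟩
      x ^ suc (suc d) + ((x ^ suc d + n * x ^ suc d) + ((n * x ^ d + r x) + x * r x))
        ≈⟨ +-congˡ (+-congʳ (trans (distribʳ _ _ _) (+-congʳ (*-identityˡ _)))) ⟨
      x ^ suc (suc d) + ((1# + n) * x ^ suc d + ((n * x ^ d + r x) + x * r x)) ∎
    where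
    n : Carrier
    n = suc d · 1#
    module + = CommutativeSemigroupProperties +-commutativeSemigroup

  sum-shift : ∀ n (h : ℕ → Carrier) →
    h 0 + sum {n} (λ i → h (suc (toℕ i))) ≈ sum {n} (λ i → h (toℕ i)) + h n
  sum-shift n h = begin
    h 0 + sum {n} (λ i → h (suc (toℕ i)))
      ≈⟨ sum-init-last {n} (λ i → h (toℕ i)) ⟩
    sum {n} (λ i → h (toℕ (inject₁ i))) + h (toℕ (fromℕ n))
      ≈⟨ +-cong (reflexive (sum-cong-≗ {n} (λ i → cong h (Fin.toℕ-inject₁ i))))
                (reflexive (cong h (Fin.toℕ-fromℕ n))) ⟩
    sum {n} (λ i → h (toℕ i)) + h n ∎

  module _ {p : ℕ} (prime-p : ℕ.Prime p) (p≈0 : p · 1# ≈ 0#) where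

    private
      ·-absorb : ∀ m n x → n · x ≈ 0# → (m ℕ.* n) · x ≈ 0#
      ·-absorb m n x e = begin
        (m ℕ.* n) · x   ≈⟨ ×-assocˡ x m n ⟨
        m · (n · x)     ≈⟨ ×-congʳ m e ⟩
        m · 0#          ≈⟨ ×-homo-0ʳ m ⟩
        0#              ∎
        where
        ×-homo-0ʳ : ∀ m → m · 0# ≈ 0#
        ×-homo-0ʳ zero    = refl
        ×-homo-0ʳ (suc m) = trans (+-identityˡ _) (×-homo-0ʳ m)

      p·≈0 : ∀ x → p · x ≈ 0#
      p·≈0 x = begin
        p · x          ≈⟨ ×-congʳ p (*-identityˡ x) ⟨
        p · (1# * x)   ≈⟨ ×-assoc-* p 1# x ⟨
        (p · 1#) * x   ≈⟨ *-congʳ p≈0 ⟩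
        0# * x         ≈⟨ zeroˡ x ⟩
        0#             ∎

    -- Both `n` and `p` annihilate `x`, hence so does their greatest common divisor 1, by Bézout.
    ·-torsion-free : ∀ n x → .{{ℕ.NonZero n}} → n ℕ.< p → n · x ≈ 0# → x ≈ 0#
    ·-torsion-free n x n<p nx≈0 with ℕ.coprime-Bézout (ℕ.prime⇒coprime prime-p n<p)
    ... | Bézout.+- u v eq = begin
      x                          ≈⟨ +-identityʳ x ⟨
      x + 0#                     ≈⟨ +-congˡ (·-absorb v n x nx≈0) ⟨
      (1 ℕ.+ v ℕ.* n) · x        ≡⟨ cong (_· x) eq ⟩
      (u ℕ.* p) · x              ≈⟨ ·-absorb u p x (p·≈0 x) ⟩
      0#                         ∎
    ... | Bézout.-+ u v eq = begin
      x                          ≈⟨ +-identityʳ x ⟨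
      x + 0#                     ≈⟨ +-congˡ (·-absorb u p x (p·≈0 x)) ⟨
      (1 ℕ.+ u ℕ.* p) · x        ≡⟨ cong (_· x) eq ⟩
      (v ℕ.* n) · x              ≈⟨ ·-absorb v n x nx≈0 ⟩
      0#                         ∎

    -- A mutual recursion on the degree: a polynomial sum reduces to the power sum of its top
    -- degree, and that power sum reduces to the sum of a remainder of smaller degree. The bound
    -- keeps `suc d`, by which the second step divides, below `p`.
    sum-polynomial : ∀ d f → d ℕ.< p → Deg< d f → sum {p} (λ i → f (toℕ i · 1#)) ≈ 0#
    sum-power      : ∀ d → suc d ℕ.< p → sum {p} (λ i → (toℕ i · 1#) ^ d) ≈ 0#

    sum-polynomial zero    f _   f≈0 =
      trans (sum-cong-≋ {p} (λ i → f≈0 (toℕ i · 1#))) (sum-replicate-zero p)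
    sum-polynomial (suc d) f d<p (a , g , dg , eg) = begin
      sum {p} (λ i → f (toℕ i · 1#))
        ≈⟨ sum-cong-≋ {p} (λ i → eg (toℕ i · 1#)) ⟩
      sum {p} (λ i → a * (toℕ i · 1#) ^ d + g (toℕ i · 1#))
        ≈⟨ ∑-distrib-+ {p} _ _ ⟩
      sum {p} (λ i → a * (toℕ i · 1#) ^ d) + sum {p} (λ i → g (toℕ i · 1#))
        ≈⟨ +-cong (sym (*-distribˡ-sum {p} a _)) (sum-polynomial d g (ℕ.<-trans (ℕ.n<1+n d) d<p) dg) ⟩
      a * sum {p} (λ i → (toℕ i · 1#) ^ d) + 0#
        ≈⟨ +-identityʳ _ ⟩
      a * sum {p} (λ i → (toℕ i · 1#) ^ d)
        ≈⟨ *-congˡ (sum-power d d<p) ⟩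
      a * 0#
        ≈⟨ zeroʳ a ⟩
      0# ∎

    -- The sum over x of (1 + x)^(d+1) - x^(d+1) telescopes to p^(d+1) - 0^(d+1) ≈ 0.
    sum-power d d<p with [1+x]^suc d
    ... | r , dr , er = ·-torsion-free (suc d) S d<p (begin
      suc d · S                     ≈⟨ ×-congʳ (suc d) (*-identityˡ S) ⟨
      suc d · (1# * S)              ≈⟨ ×-assoc-* (suc d) 1# S ⟨
      n * S                         ≈⟨ +-identityʳ _ ⟨
      n * S + 0#                    ≈⟨ +-cong (*-distribˡ-sum {p} n _) (sym (sum-polynomial d r (ℕ.<-trans (ℕ.n<1+n d) d<p) dr)) ⟩
      sum {p} (λ i → n * e i ^ d) + sum {p} (λ i → r (e i))
                                    ≈⟨ ∑-distrib-+ {p} _ _ ⟨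
      sum {p} (λ i → n * e i ^ d + r (e i))
                                    ≈⟨ identityʳ-unique S′ _ (trans (sym (∑-distrib-+ {p} _ _)) telescope) ⟩
      0#                            ∎)
      where
      e : Fin p → Carrier
      e i = toℕ i · 1#

      n S S′ : Carrier
      n  = suc d · 1#
      S  = sum {p} (λ i → e i ^ d)
      S′ = sum {p} (λ i → e i ^ suc d)

      h : ℕ → Carrier
      h k = (k · 1#) ^ suc d

      telescope : sum {p} (λ i → e i ^ suc d + (n * e i ^ d + r (e i))) ≈ S′
      telescope = begin
        sum {p} (λ i → e i ^ suc d + (n * e i ^ d + r (e i)))
          ≈⟨ sum-cong-≋ {p} (λ i → er (e i)) ⟨
        sum {p} (λ i → h (suc (toℕ i)))
          ≈⟨ +-identityˡ _ ⟨
        0# + sum {p} (λ i → h (suc (toℕ i)))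
          ≈⟨ +-congʳ (zeroˡ _) ⟨
        h 0 + sum {p} (λ i → h (suc (toℕ i)))
          ≈⟨ sum-shift p h ⟩
        S′ + h p
          ≈⟨ +-congˡ (trans (*-congʳ p≈0) (zeroˡ _)) ⟩
        S′ + 0#
          ≈⟨ +-identityʳ _ ⟩
        S′ ∎

    -- The power sum vanishes, yet it would consist of `p - 1` terms 1 and, since `d` is not 0, one
    -- term 0. The conclusion is the collapse of the ring, whose nontriviality is left to the user.
    power-nonconstant : ∀ d → .{{ℕ.NonZero d}} → suc d ℕ.< p →
      (∀ n → .{{ℕ.NonZero n}} → n ℕ.< p → (n · 1#) ^ d ≈ 1#) → 1# ≈ 0#
    power-nonconstant d d<p x^d≈1 = go p ≡.refl
      where
      0^ : ∀ d → .{{ℕ.NonZero d}} → 0# ^ d ≈ 0#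
      0^ (suc d) = zeroˡ _

      go : ∀ q → q ≡ p → 1# ≈ 0#
      go zero    ≡.refl = ⊥-elim (ℕ.¬prime[0] prime-p)
      go (suc m) ≡.refl = begin
        1#                                                  ≈⟨ +-identityʳ 1# ⟨
        1# + 0#                                             ≈⟨ +-congˡ (sum-power d d<p) ⟨
        1# + (0# ^ d + sum {m} (λ i → (suc (toℕ i) · 1#) ^ d))
          ≈⟨ +-congˡ (+-cong (0^ d) (sum-cong-≋ {m} (λ i → x^d≈1 (suc (toℕ i)) (s≤s (Fin.toℕ<n i))))) ⟩
        1# + (0# + sum {m} (replicate m 1#))                ≈⟨ +-congˡ (trans (+-identityˡ _) (sum-replicate m)) ⟩
        suc m · 1#                                          ≈⟨ p≈0 ⟩
        0#                                                  ∎

-- Group rings of cyclic groups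

ℤ/_ : ℕ → CommutativeRing 0ℓ 0ℓ
ℤ/ p = Quotient.quotient ℤ.+-*-commutativeRing (+ p)

a-[a-x]≡x : ∀ a x → a ℤ.- (a ℤ.- x) ≡ x
a-[a-x]≡x = ℤ.solve-∀

module Residues (p : ℕ) .{{_ : ℕ.NonZero p}} where

  open Quotient ℤ.+-*-commutativeRing (+ p) public
    using (≈⇒≋; divides-difference; difference) renaming (_≋_ to _≈ₚ_)
  private module Q = Quotient ℤ.+-*-commutativeRing (+ p)
  open CommutativeRing (ℤ/ p) public
    using () renaming (refl to reflₚ; sym to symₚ; trans to transₚ; setoid to setoidₚ)

  ≡⇒≈ₚ : ∀ {x y} → x ≡ y → x ≈ₚ y
  ≡⇒≈ₚ = ≈⇒≋

  +-congʳₚ : ∀ a {x y} → x ≈ₚ y → x ℤ.+ a ≈ₚ y ℤ.+ a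
  +-congʳₚ a {x} {y} e = Q.≋-+-cong {x} {a} {y} {a} e reflₚ

  -congˡₚ : ∀ a {x y} → x ≈ₚ y → a ℤ.- x ≈ₚ a ℤ.- y
  -congˡₚ a {x} {y} e = Q.≋-+-cong {a} {ℤ.- x} {a} {ℤ.- y} reflₚ (Q.≋-neg-cong e)

  *-congˡₚ : ∀ a {x y} → x ≈ₚ y → a ℤ.* x ≈ₚ a ℤ.* y
  *-congˡₚ a {x} {y} e = Q.≋-*-cong {a} {x} {a} {y} reflₚ e

  *-congʳₚ : ∀ a {x y} → x ≈ₚ y → x ℤ.* a ≈ₚ y ℤ.* a
  *-congʳₚ a {x} {y} e = Q.≋-*-cong {x} {a} {y} {a} e reflₚ

  ≈ₚ⇒∣ : ∀ {x y} → x ≈ₚ y → + p ℤ.∣ x ℤ.- y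
  ≈ₚ⇒∣ (divides-difference (q Divides., e)) = ℤ.divides q (≡.sym e)

  ∣⇒≈ₚ : ∀ {x y} → + p ℤ.∣ x ℤ.- y → x ≈ₚ y
  ∣⇒≈ₚ (ℤ.divides q e) = divides-difference $ q Divides., ≡.sym e

  rep : Fin p → ℤ
  rep i = + toℕ i

  res : ℤ → Fin p
  res x = fromℕ< (ℤ.n%ℕd<d x p)

  rep-res : ∀ x → rep (res x) ≈ₚ x
  rep-res x = symₚ (divides-difference ((x ℤ./ℕ p) Divides., (begin
    (x ℤ./ℕ p) ℤ.* + p                                       ≡⟨ lem (+ (x ℤ.%ℕ p)) ((x ℤ./ℕ p) ℤ.* + p) ⟩
    (+ (x ℤ.%ℕ p) ℤ.+ (x ℤ./ℕ p) ℤ.* + p) ℤ.- + (x ℤ.%ℕ p)   ≡⟨ cong₂ ℤ._-_ (≡.sym (ℤ.a≡a%ℕn+[a/ℕn]*n x p))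
                                                                    (cong +_ (≡.sym (Fin.toℕ-fromℕ< (ℤ.n%ℕd<d x p)))) ⟩
    x ℤ.- rep (res x)                                        ∎)))
    where
    open ≡-Reasoning
    lem : ∀ r q → q ≡ (r ℤ.+ q) ℤ.- r
    lem = ℤ.solve-∀

  rep-injective : ∀ {i j} → rep i ≈ₚ rep j → i ≡ j
  rep-injective {i} {j} i≈j = Fin.toℕ-injective (ℕ.∣m-n∣≡0⇒m≡n (small (subst (p ℕ.∣_)
    (≡.trans (cong ∣_∣ (ℤ.m-n≡m⊖n (toℕ i) (toℕ j))) (∣⊖∣ (toℕ i) (toℕ j))) (ℤ.∣⇒∣ᵤ (≈ₚ⇒∣ i≈j)))))
    where
    ∣⊖∣ : ∀ m n → ∣ m ℤ.⊖ n ∣ ≡ ℕ.∣ m - n ∣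
    ∣⊖∣ m n with ℕ.≤-total m n
    ... | inj₁ m≤n = ≡.trans (ℤ.∣⊖∣-≤ m≤n) (≡.sym (ℕ.m≤n⇒∣m-n∣≡n∸m m≤n))
    ... | inj₂ n≤m = ≡.trans (ℤ.∣m⊖n∣≡∣n⊖m∣ m n) (≡.trans (ℤ.∣⊖∣-≤ n≤m) (≡.sym (ℕ.m≤n⇒∣n-m∣≡n∸m n≤m)))

    d<p : ℕ.∣ toℕ i - toℕ j ∣ ℕ.< p
    d<p = ℕ.≤-<-trans (ℕ.∣m-n∣≤m⊔n (toℕ i) (toℕ j)) (ℕ.⊔-lub (Fin.toℕ<n i) (Fin.toℕ<n j))

    small : p ℕ.∣ ℕ.∣ toℕ i - toℕ j ∣ → ℕ.∣ toℕ i - toℕ j ∣ ≡ 0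
    small p∣d with ℕ.∣ toℕ i - toℕ j ∣ | d<p
    ... | zero  | _   = ≡.refl
    ... | suc d | d<p = contradiction (ℕ.∣⇒≤ p∣d) (ℕ.<⇒≱ d<p)

  infix 4 _≟ₚ_
  _≟ₚ_ : ∀ x y → Dec (x ≈ₚ y)
  x ≟ₚ y = map′ (λ e → transₚ (symₚ (rep-res x)) (transₚ (≡⇒≈ₚ (cong rep e)) (rep-res y)))
                (λ x≈y → rep-injective (transₚ (rep-res x) (transₚ x≈y (symₚ (rep-res y)))))
                (res x Fin.≟ res y)

module ResidueSum {c ℓ} (A : CommutativeRing c ℓ) (p : ℕ) .{{_ : ℕ.NonZero p}} where
  open CommutativeRing A hiding (zero)
  open Multiples semiring renaming (_×_ to _·_)
  open Sums semiring
  open SetoidReasoning setoid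
  open Residues p

  -- A function on residues is kept as a function on ℤ that respects congruence. Index arithmetic
  -- then stays integer arithmetic, and only the sum itself ranges over `Fin p`.
  Periodic : (ℤ → Carrier) → Set _
  Periodic f = ∀ {x y} → x ≈ₚ y → f x ≈ f y

  -- Opaque, so that unification can recover f from ∑ f.
  opaque
    ∑ : (ℤ → Carrier) → Carrier
    ∑ f = sum {p} (λ i → f (rep i))

    ∑-cong : ∀ {f g} → (∀ x → f x ≈ g x) → ∑ f ≈ ∑ g
    ∑-cong e = sum-cong-≋ {p} (λ i → e (rep i))

    ∑-+ : ∀ f g → ∑ (λ x → f x + g x) ≈ ∑ f + ∑ g
    ∑-+ f g = ∑-distrib-+ {p} _ _

    ∑-*ˡ : ∀ a f → a * ∑ f ≈ ∑ (λ x → a * f x)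
    ∑-*ˡ a f = *-distribˡ-sum {p} a _

    ∑-*ʳ : ∀ a f → ∑ f * a ≈ ∑ (λ x → f x * a)
    ∑-*ʳ a f = *-distribʳ-sum {p} a _

    ∑-swap : ∀ (f : ℤ → ℤ → Carrier) → ∑ (λ x → ∑ (f x)) ≈ ∑ (λ y → ∑ (λ x → f x y))
    ∑-swap f = ∑-comm {p} {p} _

    ∑-const : ∀ a → ∑ (λ _ → a) ≈ p · a
    ∑-const a = sum-replicate p

    -- The maps need to be mutually inverse only up to congruence; on the representatives they
    -- induce a permutation of `Fin p`. The shifts, reflections, scalings and inversions of the
    -- summation variable are all instances.
    ∑-substitute : ∀ {f} → Periodic f → (φ ψ : ℤ → ℤ) →
      (∀ {x y} → x ≈ₚ y → φ x ≈ₚ φ y) → (∀ {x y} → x ≈ₚ y → ψ x ≈ₚ ψ y) →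
      (∀ x → φ (ψ x) ≈ₚ x) → (∀ x → ψ (φ x) ≈ₚ x) →
      ∑ (λ x → f (φ x)) ≈ ∑ f
    ∑-substitute {f} per φ ψ φ-cong ψ-cong φψ ψφ = begin
      ∑ (λ x → f (φ x))                          ≈⟨ ∑-cong (λ x → per (rep-res (φ x))) ⟨
      sum {p} (λ i → f (rep (res (φ (rep i)))))  ≈⟨ sum-permute {p} {p} (λ i → f (rep i)) π ⟨
      ∑ f                                        ∎
      where
      π : Permutation p p
      π = permutation (λ i → res (φ (rep i))) (λ i → res (ψ (rep i)))
        (λ i → rep-injective (transₚ (rep-res _) (transₚ (φ-cong (rep-res _)) (φψ _))))
        (λ i → rep-injective (transₚ (rep-res _) (transₚ (ψ-cong (rep-res _)) (ψφ _))))

  ∑-shift : ∀ {f} → Periodic f → ∀ a → ∑ (λ x → f (x ℤ.+ a)) ≈ ∑ f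
  ∑-shift per a = ∑-substitute per (ℤ._+ a) (ℤ._- a)
    (+-congʳₚ a) (+-congʳₚ (ℤ.- a)) (λ x → ≡⇒≈ₚ (lem₁ x a)) (λ x → ≡⇒≈ₚ (lem₂ x a))
    where
    lem₁ : ∀ x a → (x ℤ.- a) ℤ.+ a ≡ x
    lem₁ = ℤ.solve-∀
    lem₂ : ∀ x a → (x ℤ.+ a) ℤ.- a ≡ x
    lem₂ = ℤ.solve-∀

  ∑-reflect : ∀ {f} → Periodic f → ∀ a → ∑ (λ x → f (a ℤ.- x)) ≈ ∑ f
  ∑-reflect per a = ∑-substitute per (λ x → a ℤ.- x) (λ x → a ℤ.- x)
    (-congˡₚ a) (-congˡₚ a)
    (λ x → ≡⇒≈ₚ (a-[a-x]≡x a x)) (λ x → ≡⇒≈ₚ (a-[a-x]≡x a x))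

  ∑-scale : ∀ {f} → Periodic f → ∀ a b → a ℤ.* b ≈ₚ 1ℤ → ∑ (λ x → f (a ℤ.* x)) ≈ ∑ f
  ∑-scale per a b ab≈1 = ∑-substitute per (a ℤ.*_) (b ℤ.*_)
    (*-congˡₚ a) (*-congˡₚ b)
    (λ x → transₚ (≡⇒≈ₚ (≡.sym (ℤ.*-assoc a b x))) (transₚ (*-congʳₚ x ab≈1) (≡⇒≈ₚ (ℤ.*-identityˡ x))))
    (λ x → transₚ (≡⇒≈ₚ (≡.trans (≡.sym (ℤ.*-assoc b a x)) (cong (ℤ._* x) (ℤ.*-comm b a))))
      (transₚ (*-congʳₚ x ab≈1) (≡⇒≈ₚ (ℤ.*-identityˡ x))))

  opaque
    δ : ℤ → Carrier
    δ x = if does (x ≟ₚ 0ℤ) then 1# else 0#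

    δ≈1 : ∀ {x} → x ≈ₚ 0ℤ → δ x ≈ 1#
    δ≈1 {x} x≈0 = reflexive (cong (if_then 1# else 0#) (dec-true (x ≟ₚ 0ℤ) x≈0))

    δ≈0 : ∀ {x} → ¬ x ≈ₚ 0ℤ → δ x ≈ 0#
    δ≈0 {x} x≉0 = reflexive (cong (if_then 1# else 0#) (dec-false (x ≟ₚ 0ℤ) x≉0))

  δ-periodic : Periodic δ
  δ-periodic {x} {y} x≈y with x ≟ₚ 0ℤ
  ... | yes x≈0 = trans (δ≈1 x≈0) (sym (δ≈1 (transₚ (symₚ x≈y) x≈0)))
  ... | no  x≉0 = trans (δ≈0 x≉0) (sym (δ≈0 (λ y≈0 → x≉0 (transₚ x≈y y≈0))))

  opaque
    unfolding ∑

    ∑-δ : ∀ {f} → Periodic f → ∑ (λ x → δ x * f x) ≈ f 0ℤ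
    ∑-δ {f} per = go p ≡.refl
      where
      go : ∀ n → n ≡ p → ∑ (λ x → δ x * f x) ≈ f 0ℤ
      go zero    ≡.refl = ⊥-elim (ℕ.≢-nonZero⁻¹ 0 ≡.refl)
      go (suc m) ≡.refl = begin
        δ 0ℤ * f 0ℤ + sum {m} (λ i → δ (+ suc (toℕ i)) * f (+ suc (toℕ i)))
          ≈⟨ +-cong (*-congʳ (δ≈1 reflₚ))
               (sum-cong-≋ {m} λ i → trans (*-congʳ (δ≈0 (λ e → case rep-injective {suc i} {zero} e of λ ()))) (zeroˡ _)) ⟩
        1# * f 0ℤ + sum {m} (replicate m 0#)
          ≈⟨ +-cong (*-identityˡ _) (sum-replicate-zero m) ⟩
        f 0ℤ + 0#
          ≈⟨ +-identityʳ _ ⟩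
        f 0ℤ ∎

  ∑-δ-reflected : ∀ {f} → Periodic f → ∀ a → ∑ (λ x → f x * δ (a ℤ.- x)) ≈ f a
  ∑-δ-reflected {f} per a = begin
    ∑ (λ x → f x * δ (a ℤ.- x))
      ≈⟨ ∑-cong (λ x → *-comm _ _) ⟩
    ∑ (λ x → δ (a ℤ.- x) * f x)
      ≈⟨ ∑-cong (λ x → *-congˡ (per (≡⇒≈ₚ (a-[a-x]≡x a x)))) ⟨
    ∑ (λ x → δ (a ℤ.- x) * f (a ℤ.- (a ℤ.- x)))
      ≈⟨ ∑-reflect {λ x → δ x * f (a ℤ.- x)}
           (λ e → *-cong (δ-periodic e) (per (-congˡₚ a e))) a ⟩
    ∑ (λ x → δ x * f (a ℤ.- x))
      ≈⟨ ∑-δ {λ x → f (a ℤ.- x)} (λ e → per (-congˡₚ a e)) ⟩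
    f (a ℤ.- 0ℤ)
      ≡⟨ cong f (ℤ.+-identityʳ a) ⟩
    f a ∎

-- The group ring A[ℤ/p]: the function f stands for the formal sum of f x [x].
module GroupRing {c ℓ} (A : CommutativeRing c ℓ) (p : ℕ) .{{_ : ℕ.NonZero p}} where
  open CommutativeRing A hiding (zero)
  open ResidueSum A p
  open Residues p
  open SetoidReasoning setoid

  record Element : Set (c ⊔ ℓ) where
    constructor element
    field
      coeff    : ℤ → Carrier
      periodic : Periodic coeff

  open Element public

  infix 4 _≐_
  record _≐_ (f g : Element) : Set ℓ where
    constructor pointwise
    field at : ∀ x → coeff f x ≈ coeff g x

  open _≐_ public

  convolve : (ℤ → Carrier) → (ℤ → Carrier) → ℤ → Carrier
  convolve f g s = ∑ (λ t → f t * g (s ℤ.- t))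

  infixl 6 _⊞_
  infixl 7 _⋆_

  _⊞_ _⋆_ : Element → Element → Element
  f ⊞ g = element (λ x → coeff f x + coeff g x) (λ e → +-cong (periodic f e) (periodic g e))
  f ⋆ g = element (convolve (coeff f) (coeff g))
    (λ e → ∑-cong (λ t → *-congˡ (periodic g (+-congʳₚ (ℤ.- t) e))))

  neg : Element → Element
  neg f = element (λ x → - coeff f x) (λ e → -‿cong (periodic f e))

  0ᴳ 1ᴳ : Element
  0ᴳ = element (λ _ → 0#) (λ _ → refl)
  1ᴳ = element δ δ-periodic

  ⋆-cong : ∀ {f f′ g g′} → f ≐ f′ → g ≐ g′ → f ⋆ g ≐ f′ ⋆ g′
  ⋆-cong e h = pointwise λ s → ∑-cong (λ t → *-cong (at e t) (at h (s ℤ.- t)))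

  ⋆-comm : ∀ f g → f ⋆ g ≐ g ⋆ f
  ⋆-comm f g = pointwise λ s → begin
    ∑ (λ t → coeff f t * coeff g (s ℤ.- t))
      ≈⟨ ∑-reflect (λ e → *-cong (periodic f e) (periodic g (-congˡₚ s e))) s ⟨
    ∑ (λ t → coeff f (s ℤ.- t) * coeff g (s ℤ.- (s ℤ.- t)))
      ≈⟨ ∑-cong (λ t → trans (*-congˡ (periodic g (≡⇒≈ₚ (a-[a-x]≡x s t)))) (*-comm _ _)) ⟩
    ∑ (λ t → coeff g t * coeff f (s ℤ.- t)) ∎

  -- After the exchange of the two sums, the substitution of `t + u` for `t` in the inner one gives
  -- the other bracketing.
  ⋆-assoc : ∀ f g h → (f ⋆ g) ⋆ h ≐ f ⋆ (g ⋆ h)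
  ⋆-assoc f g h = pointwise λ s → begin
    ∑ (λ t → ∑ (λ u → coeff f u * coeff g (t ℤ.- u)) * coeff h (s ℤ.- t))
      ≈⟨ ∑-cong (λ t → ∑-*ʳ _ _) ⟩
    ∑ (λ t → ∑ (λ u → coeff f u * coeff g (t ℤ.- u) * coeff h (s ℤ.- t)))
      ≈⟨ ∑-swap _ ⟩
    ∑ (λ u → ∑ (λ t → coeff f u * coeff g (t ℤ.- u) * coeff h (s ℤ.- t)))
      ≈⟨ ∑-cong (λ u → trans (∑-cong (λ t → *-assoc _ _ _)) (sym (∑-*ˡ _ _))) ⟩
    ∑ (λ u → coeff f u * ∑ (λ t → coeff g (t ℤ.- u) * coeff h (s ℤ.- t)))
      ≈⟨ ∑-cong (λ u → *-congˡ (shift s u)) ⟩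
    ∑ (λ u → coeff f u * ∑ (λ t → coeff g t * coeff h ((s ℤ.- u) ℤ.- t))) ∎
    where
    shift : ∀ s u → ∑ (λ t → coeff g (t ℤ.- u) * coeff h (s ℤ.- t))
                  ≈ ∑ (λ t → coeff g t * coeff h ((s ℤ.- u) ℤ.- t))
    shift s u = begin
      ∑ (λ t → coeff g (t ℤ.- u) * coeff h (s ℤ.- t))
        ≈⟨ ∑-shift (λ e → *-cong (periodic g (+-congʳₚ (ℤ.- u) e)) (periodic h (-congˡₚ s e))) u ⟨
      ∑ (λ t → coeff g ((t ℤ.+ u) ℤ.- u) * coeff h (s ℤ.- (t ℤ.+ u)))
        ≈⟨ ∑-cong (λ t → *-cong (periodic g (≡⇒≈ₚ (lem₁ t u))) (periodic h (≡⇒≈ₚ (lem₂ s t u)))) ⟩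
      ∑ (λ t → coeff g t * coeff h ((s ℤ.- u) ℤ.- t)) ∎
      where
      lem₁ : ∀ t u → (t ℤ.+ u) ℤ.- u ≡ t
      lem₁ = ℤ.solve-∀
      lem₂ : ∀ s t u → s ℤ.- (t ℤ.+ u) ≡ (s ℤ.- u) ℤ.- t
      lem₂ = ℤ.solve-∀

  ⋆-identityʳ : ∀ f → f ⋆ 1ᴳ ≐ f
  ⋆-identityʳ f = pointwise (∑-δ-reflected (periodic f))

  ⋆-distribˡ : ∀ f g h → f ⋆ (g ⊞ h) ≐ f ⋆ g ⊞ f ⋆ h
  ⋆-distribˡ f g h = pointwise λ s → trans (∑-cong (λ t → distribˡ _ _ _)) (∑-+ _ _)

  ≐-trans : ∀ {f g h} → f ≐ g → g ≐ h → f ≐ h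
  ≐-trans e e′ = pointwise λ x → trans (at e x) (at e′ x)

  groupRing : CommutativeRing (c ⊔ ℓ) ℓ
  groupRing = record
    { Carrier = Element ; _≈_ = _≐_ ; _+_ = _⊞_ ; _*_ = _⋆_ ; -_ = neg ; 0# = 0ᴳ ; 1# = 1ᴳ
    ; isCommutativeRing = record
      { isRing = record
        { +-isAbelianGroup = record
          { isGroup = record
            { isMonoid = record
              { isSemigroup = record
                { isMagma = record
                  { isEquivalence = record
                    { refl = pointwise λ _ → refl
                    ; sym = λ e → pointwise λ x → sym (at e x)
                    ; trans = ≐-trans }
                  ; ∙-cong = λ e h → pointwise λ x → +-cong (at e x) (at h x) }
                ; assoc = λ f g h → pointwise λ x → +-assoc _ _ _ }
              ; identity = (λ f → pointwise λ x → +-identityˡ _) , (λ f → pointwise λ x → +-identityʳ _) }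
            ; inverse = (λ f → pointwise λ x → -‿inverseˡ _) , (λ f → pointwise λ x → -‿inverseʳ _)
            ; ⁻¹-cong = λ e → pointwise λ x → -‿cong (at e x) }
          ; comm = λ f g → pointwise λ x → +-comm _ _ }
        ; *-cong = ⋆-cong
        ; *-assoc = ⋆-assoc
        ; *-identity = (λ f → ≐-trans (⋆-comm 1ᴳ f) (⋆-identityʳ f)) , ⋆-identityʳ
        ; distrib = ⋆-distribˡ , λ f g h → ≐-trans (⋆-comm (g ⊞ h) f) (≐-trans (⋆-distribˡ f g h)
            (pointwise λ x → +-cong (at (⋆-comm f g) x) (at (⋆-comm f h) x))) }
      ; *-comm = ⋆-comm } }

-- Arithmetic in the prime field

module PrimeResidues (p : ℕ) .{{_ : ℕ.NonZero p}} (prime-p : ℕ.Prime p) where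
  open Residues p
  open Exponentiation (CommutativeRing.commutativeSemiring (ℤ/ p)) using (_^_; ^-congˡ)
  open Multiples (CommutativeRing.semiring (ℤ/ p)) using () renaming (_×_ to _·_)
  private module 𝔽 = CommutativeRing (ℤ/ p)

  ∣⇒≈0 : ∀ {x} → + p ℤ.∣ x → x ≈ₚ 0ℤ
  ∣⇒≈0 {x} = ∣⇒≈ₚ ∘ subst (+ p ℤ.∣_) (≡.sym (ℤ.+-identityʳ x))

  ≈0⇒∣ : ∀ {x} → x ≈ₚ 0ℤ → + p ℤ.∣ x
  ≈0⇒∣ {x} = subst (+ p ℤ.∣_) (ℤ.+-identityʳ x) ∘ ≈ₚ⇒∣

  euclid : ∀ x y → x ℤ.* y ≈ₚ 0ℤ → x ≈ₚ 0ℤ ⊎ y ≈ₚ 0ℤ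
  euclid x y xy≈0 with ℕ.euclidsLemma ∣ x ∣ ∣ y ∣ prime-p
                         (subst (p ℕ.∣_) (ℤ.abs-* x y) (ℤ.∣⇒∣ᵤ (≈0⇒∣ xy≈0)))
  ... | inj₁ p∣x = inj₁ (∣⇒≈0 (ℤ.∣ᵤ⇒∣ p∣x))
  ... | inj₂ p∣y = inj₂ (∣⇒≈0 (ℤ.∣ᵤ⇒∣ p∣y))

  1≉0 : ¬ 1ℤ ≈ₚ 0ℤ
  1≉0 1≈0 = ℕ.¬prime[1] (subst ℕ.Prime (ℕ.∣1⇒≡1 (ℤ.∣⇒∣ᵤ (≈0⇒∣ 1≈0))) prime-p)

  n·1≡n : ∀ n → n · 1ℤ ≡ + n
  n·1≡n zero    = ≡.refl
  n·1≡n (suc n) = cong (λ x → 1ℤ ℤ.+ x) (n·1≡n n)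

  fermat : ∀ x → x ^ p ≈ₚ x
  fermat x = transₚ (^-congˡ p (symₚ (rep-res x))) (transₚ (go (toℕ (res x))) (rep-res x))
    where
    open Frobenius (ℤ/ p)

    add-p : Additive p
    add-p = prime-additive prime-p (transₚ (≡⇒≈ₚ (n·1≡n p)) (Quotient.γ≋0 ℤ.+-*-commutativeRing (+ p)))

    1^ : ∀ n → 1ℤ ^ n ≡ 1ℤ
    1^ zero    = ≡.refl
    1^ (suc n) = ≡.trans (ℤ.*-identityˡ (1ℤ ^ n)) (1^ n)

    0^ : ∀ n → .{{ℕ.NonZero n}} → 0ℤ ^ n ≡ 0ℤ
    0^ (suc n) = ≡.refl

    go : ∀ n → (+ n) ^ p ≈ₚ + n
    go zero    = ≡⇒≈ₚ (0^ p)
    go (suc n) = transₚ (^-distrib-+ add-p 1ℤ (+ n))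
      (Quotient.≋-+-cong ℤ.+-*-commutativeRing (+ p) {1ℤ ^ p} {(+ n) ^ p} {1ℤ} {+ n} (≡⇒≈ₚ (1^ p)) (go n))

  fermat-unit : ∀ {x} → ¬ x ≈ₚ 0ℤ → x ^ (p ℕ.∸ 1) ≈ₚ 1ℤ
  fermat-unit {x} x≉0 = go p ≡.refl
    where
    go : ∀ q → q ≡ p → x ^ (q ℕ.∸ 1) ≈ₚ 1ℤ
    go zero    ≡.refl = ⊥-elim (ℕ.¬prime[0] prime-p)
    go (suc m) ≡.refl = [ (λ x≈0 → contradiction x≈0 x≉0) , (λ e → ∣⇒≈ₚ (≈0⇒∣ e)) ]′
      (euclid x (x ^ m ℤ.- 1ℤ) (transₚ (≡⇒≈ₚ (lem x (x ^ m))) (∣⇒≈0 (≈ₚ⇒∣ (fermat x)))))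
      where
      lem : ∀ x y → x ℤ.* (y ℤ.- 1ℤ) ≡ x ℤ.* y ℤ.- x
      lem = ℤ.solve-∀

  -- Not just x ^ (p - 2), so that inv 0 = 0 also for p = 2.
  inv : ℤ → ℤ
  inv x = x ℤ.* (x ^ (p ℕ.∸ 2) ℤ.* x ^ (p ℕ.∸ 2))

  inv-cong : ∀ {x y} → x ≈ₚ y → inv x ≈ₚ inv y
  inv-cong {x} {y} e = 𝔽.*-cong {x} {y} e
    (𝔽.*-cong {x ^ (p ℕ.∸ 2)} {y ^ (p ℕ.∸ 2)} {x ^ (p ℕ.∸ 2)} {y ^ (p ℕ.∸ 2)} e^ e^)
    where
    e^ = ^-congˡ (p ℕ.∸ 2) e

  -- The product is the square of `x ^ (p - 1)`, which Fermat makes 1.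
  *-inv : ∀ {x} → ¬ x ≈ₚ 0ℤ → x ℤ.* inv x ≈ₚ 1ℤ
  *-inv {x} x≉0 = transₚ (≡⇒≈ₚ (lem x (x ^ (p ℕ.∸ 2))))
    (𝔽.*-cong {x ℤ.* x ^ (p ℕ.∸ 2)} {1ℤ} {x ℤ.* x ^ (p ℕ.∸ 2)} {1ℤ} x^[p-1] x^[p-1])
    where
    lem : ∀ x y → x ℤ.* (x ℤ.* (y ℤ.* y)) ≡ (x ℤ.* y) ℤ.* (x ℤ.* y)
    lem = ℤ.solve-∀
    suc-p-2 : ∀ q → q ≡ p → suc (q ℕ.∸ 2) ≡ q ℕ.∸ 1
    suc-p-2 0 ≡.refl             = ⊥-elim (ℕ.¬prime[0] prime-p)
    suc-p-2 1 ≡.refl             = ⊥-elim (ℕ.¬prime[1] prime-p)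
    suc-p-2 (suc (suc q)) ≡.refl = ≡.refl
    x^[p-1] : x ^ suc (p ℕ.∸ 2) ≈ₚ 1ℤ
    x^[p-1] = transₚ (≡⇒≈ₚ (cong (x ^_) (suc-p-2 p ≡.refl))) (fermat-unit x≉0)

  unit : ∀ {x y} → x ℤ.* y ≈ₚ 1ℤ → ¬ y ≈ₚ 0ℤ
  unit {x} {y} xy≈1 y≈0 = 1≉0 (transₚ (symₚ xy≈1) (transₚ (*-congˡₚ x y≈0) (≡⇒≈ₚ (ℤ.*-zeroʳ x))))

  inv-involutive : ∀ x → inv (inv x) ≈ₚ x
  inv-involutive x with x ≟ₚ 0ℤ
  ... | yes x≈0 = transₚ (inv-cong (inv-cong x≈0)) (symₚ x≈0)
  ... | no  x≉0 = begin
    inv (inv x)                     ≡⟨ ℤ.*-identityˡ _ ⟨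
    1ℤ ℤ.* inv (inv x)              ≈⟨ *-congʳₚ (inv (inv x)) (*-inv x≉0) ⟨
    (x ℤ.* inv x) ℤ.* inv (inv x)   ≡⟨ ℤ.*-assoc x (inv x) _ ⟩
    x ℤ.* (inv x ℤ.* inv (inv x))   ≈⟨ *-congˡₚ x (*-inv (unit {x} (*-inv x≉0))) ⟩
    x ℤ.* 1ℤ                        ≡⟨ ℤ.*-identityʳ x ⟩
    x                               ∎
    where open SetoidReasoning setoidₚ

-- Gauss and Jacobi sums

module GaussSum {c ℓ} (A : CommutativeRing c ℓ) (p : ℕ) .{{_ : ℕ.NonZero p}} (prime-p : ℕ.Prime p) where
  open CommutativeRing A hiding (zero)
  open Multiples semiring renaming (_×_ to _·_)
  open AbelianGroupProperties +-abelianGroup using (x≈z//y)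
  open CommutativeSemigroupProperties *-commutativeSemigroup
  open ResidueSum A p
  open Residues p
  open PrimeResidues p prime-p hiding (n·1≡n)
  open GroupRing A p
  open SetoidReasoning setoid

  record Multiplicative (φ : ℤ → Carrier) : Set (c ⊔ ℓ) where
    field
      cong-φ : Periodic φ
      homo   : ∀ x y → φ (x ℤ.* y) ≈ φ x * φ y
      at-0   : φ 0ℤ ≈ 0#

    ≈0 : ∀ {x} → x ≈ₚ 0ℤ → φ x ≈ 0#
    ≈0 e = trans (cong-φ e) at-0

  jacobi : (φ ψ : ℤ → Carrier) → Carrier
  jacobi φ ψ = ∑ (λ u → φ u * ψ (1ℤ ℤ.- u))

  module _ {φ ψ} (mφ : Multiplicative φ) (mψ : Multiplicative ψ) where
    private
      module φ = Multiplicative mφ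
      module ψ = Multiplicative mψ

    -- Substituting `t = s u` pulls the values at `s` out of the sum. This needs `s` invertible, so
    -- the coefficient at 0 is treated separately.
    convolve-unit : ∀ {s} → ¬ s ≈ₚ 0ℤ → convolve φ ψ s ≈ (φ s * ψ s) * jacobi φ ψ
    convolve-unit {s} s≉0 = begin
      ∑ (λ t → φ t * ψ (s ℤ.- t))
        ≈⟨ ∑-scale (λ e → *-cong (φ.cong-φ e) (ψ.cong-φ (-congˡₚ s e))) s (inv s) (*-inv s≉0) ⟨
      ∑ (λ u → φ (s ℤ.* u) * ψ (s ℤ.- s ℤ.* u))
        ≈⟨ ∑-cong (λ u → *-cong (φ.homo s u) (trans (reflexive (cong ψ (lem s u))) (ψ.homo s _))) ⟩
      ∑ (λ u → (φ s * φ u) * (ψ s * ψ (1ℤ ℤ.- u)))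
        ≈⟨ ∑-cong (λ u → interchange _ _ _ _) ⟩
      ∑ (λ u → (φ s * ψ s) * (φ u * ψ (1ℤ ℤ.- u)))
        ≈⟨ ∑-*ˡ _ _ ⟨
      (φ s * ψ s) * jacobi φ ψ ∎
      where
      lem : ∀ s u → s ℤ.- s ℤ.* u ≡ s ℤ.* (1ℤ ℤ.- u)
      lem = ℤ.solve-∀

    convolve-zero : ∀ {s} → s ≈ₚ 0ℤ → convolve φ ψ s ≈ ψ ℤ.-1ℤ * ∑ (λ t → φ t * ψ t)
    convolve-zero {s} s≈0 = begin
      ∑ (λ t → φ t * ψ (s ℤ.- t))
        ≈⟨ ∑-cong (λ t → *-congˡ (trans (ψ.cong-φ (transₚ (+-congʳₚ (ℤ.- t) s≈0) (≡⇒≈ₚ (lem t)))) (ψ.homo ℤ.-1ℤ t))) ⟩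
      ∑ (λ t → φ t * (ψ ℤ.-1ℤ * ψ t))
        ≈⟨ ∑-cong (λ t → x∙yz≈y∙xz _ _ _) ⟩
      ∑ (λ t → ψ ℤ.-1ℤ * (φ t * ψ t))
        ≈⟨ ∑-*ˡ _ _ ⟨
      ψ ℤ.-1ℤ * ∑ (λ t → φ t * ψ t) ∎
      where
      lem : ∀ t → 0ℤ ℤ.- t ≡ ℤ.-1ℤ ℤ.* t
      lem = ℤ.solve-∀

  infix 10 _²
  _² : (ℤ → Carrier) → ℤ → Carrier
  (φ ²) x = φ x * φ x

  -- The two vanishing sums are fields because the coefficient ring may have zero divisors:
  -- cancelling the factor `χ x - 1` in the usual argument is possible over `D` but not in its
  -- quotients.
  record IsCubicCharacter (χ : ℤ → Carrier) : Set (c ⊔ ℓ) where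
    field
      multiplicative : Multiplicative χ
      cube           : ∀ {x} → ¬ x ≈ₚ 0ℤ → χ x * (χ ²) x ≈ 1#
      ∑χ≈0           : ∑ χ ≈ 0#
      ∑χ²≈0          : ∑ (χ ²) ≈ 0#

    open Multiplicative multiplicative public

  module _ {χ} (isχ : IsCubicCharacter χ) where
    open IsCubicCharacter isχ

    χ²-multiplicative : Multiplicative (χ ²)
    χ²-multiplicative = record
      { cong-φ = λ e → *-cong (cong-φ e) (cong-φ e)
      ; homo   = λ x y → trans (*-cong (homo x y) (homo x y)) (interchange _ _ _ _)
      ; at-0   = trans (*-congʳ at-0) (zeroˡ _) }

    χ²²≈χ : ∀ x → ((χ ²) ²) x ≈ χ x
    χ²²≈χ x with x ≟ₚ 0ℤ
    ... | yes x≈0 = trans (trans (*-congʳ (trans (*-congʳ (≈0 x≈0)) (zeroˡ _))) (zeroˡ _)) (sym (≈0 x≈0))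
    ... | no  x≉0 = begin
      (χ x * χ x) * (χ x * χ x)   ≈⟨ *-assoc _ _ _ ⟩
      χ x * (χ x * (χ x * χ x))   ≈⟨ *-congˡ (cube x≉0) ⟩
      χ x * 1#                    ≈⟨ *-identityʳ _ ⟩
      χ x                         ∎

    χ²-isCubicCharacter : IsCubicCharacter (χ ²)
    χ²-isCubicCharacter = record
      { multiplicative = χ²-multiplicative
      ; cube  = λ x≉0 → trans (*-congˡ (χ²²≈χ _)) (trans (*-comm _ _) (cube x≉0))
      ; ∑χ≈0  = ∑χ²≈0
      ; ∑χ²≈0 = trans (∑-cong χ²²≈χ) ∑χ≈0 }

    χ[1]≈1 : χ 1ℤ ≈ 1#
    χ[1]≈1 = begin
      χ 1ℤ                   ≡⟨⟩
      χ (1ℤ ℤ.* 1ℤ)          ≈⟨ homo 1ℤ 1ℤ ⟩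
      χ 1ℤ * χ 1ℤ            ≡⟨⟩
      χ 1ℤ * χ (1ℤ ℤ.* 1ℤ)   ≈⟨ *-congˡ (homo 1ℤ 1ℤ) ⟩
      χ 1ℤ * (χ 1ℤ * χ 1ℤ)   ≈⟨ cube 1≉0 ⟩
      1#                     ∎

    -- `-1` is its own cube, and a cube of a unit has character value 1.
    χ[-1]≈1 : χ ℤ.-1ℤ ≈ 1#
    χ[-1]≈1 = begin
      χ ℤ.-1ℤ                          ≡⟨⟩
      χ (ℤ.-1ℤ ℤ.* (ℤ.-1ℤ ℤ.* ℤ.-1ℤ))  ≈⟨ trans (homo _ _) (*-congˡ (homo _ _)) ⟩
      χ ℤ.-1ℤ * (χ ℤ.-1ℤ * χ ℤ.-1ℤ)    ≈⟨ cube (unit {ℤ.-1ℤ} {ℤ.-1ℤ} reflₚ) ⟩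
      1#                               ∎

    P J : Carrier
    P = p · 1#
    J = jacobi χ χ

    -- χ(u) χ²(1 - u) = χ²(u⁻¹ - 1) for u ≠ 0, and u⁻¹ runs through the residues.
    jacobi-χ-χ² : jacobi χ (χ ²) ≈ - 1#
    jacobi-χ-χ² = begin
      jacobi χ (χ ²)            ≈⟨ x≈z//y _ _ _ sum≈0 ⟩
      0# - 1#                   ≈⟨ +-identityˡ _ ⟩
      - 1#                      ∎
      where
      module χ² = Multiplicative χ²-multiplicative

      per-1 : Periodic (λ v → (χ ²) (v ℤ.- 1ℤ))
      per-1 e = χ².cong-φ (+-congʳₚ (ℤ.- 1ℤ) e)

      -- The summand `δ u` corrects the residue 0: there `χ u` vanishes, whereas `inv u` is 0 and
      -- the right side is the value 1 of the squared character at `-1`.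
      term : ∀ u → χ u * (χ ²) (1ℤ ℤ.- u) + δ u ≈ (χ ²) (inv u ℤ.- 1ℤ)
      term u with u ≟ₚ 0ℤ
      ... | yes u≈0 = begin
        χ u * (χ ²) (1ℤ ℤ.- u) + δ u   ≈⟨ +-cong (trans (*-congʳ (≈0 u≈0)) (zeroˡ _)) (δ≈1 u≈0) ⟩
        0# + 1#                        ≈⟨ +-identityˡ 1# ⟩
        1#                             ≈⟨ trans (*-cong χ[-1]≈1 χ[-1]≈1) (*-identityˡ _) ⟨
        (χ ²) (0ℤ ℤ.- 1ℤ)              ≈⟨ per-1 (inv-cong u≈0) ⟨
        (χ ²) (inv u ℤ.- 1ℤ)           ∎
      ... | no  u≉0 = begin
        χ u * (χ ²) (1ℤ ℤ.- u) + δ u            ≈⟨ trans (+-congˡ (δ≈0 u≉0)) (+-identityʳ _) ⟩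
        χ u * (χ ²) (1ℤ ℤ.- u)                  ≈⟨ *-congʳ χu≈χ²v ⟩
        (χ ²) (inv u) * (χ ²) (1ℤ ℤ.- u)        ≈⟨ χ².homo _ _ ⟨
        (χ ²) (inv u ℤ.* (1ℤ ℤ.- u))            ≡⟨ cong (χ ²) (lem (inv u) u) ⟩
        (χ ²) (inv u ℤ.- u ℤ.* inv u)           ≈⟨ χ².cong-φ (-congˡₚ (inv u) (*-inv u≉0)) ⟩
        (χ ²) (inv u ℤ.- 1ℤ)                    ∎
        where
        lem : ∀ v u → v ℤ.* (1ℤ ℤ.- u) ≡ v ℤ.- u ℤ.* v
        lem = ℤ.solve-∀
        χuχv≈1 : χ u * χ (inv u) ≈ 1#
        χuχv≈1 = trans (sym (homo _ _)) (trans (cong-φ (*-inv u≉0)) χ[1]≈1)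
        χu≈χ²v : χ u ≈ (χ ²) (inv u)
        χu≈χ²v = begin
          χ u                             ≈⟨ *-identityʳ _ ⟨
          χ u * 1#                        ≈⟨ *-congˡ (cube (unit {u} (*-inv u≉0))) ⟨
          χ u * (χ (inv u) * (χ ²) (inv u)) ≈⟨ *-assoc _ _ _ ⟨
          (χ u * χ (inv u)) * (χ ²) (inv u) ≈⟨ *-congʳ χuχv≈1 ⟩
          1# * (χ ²) (inv u)              ≈⟨ *-identityˡ _ ⟩
          (χ ²) (inv u)                   ∎

      sum≈0 : jacobi χ (χ ²) + 1# ≈ 0#
      sum≈0 = begin
        jacobi χ (χ ²) + 1#
          ≈⟨ +-congˡ (trans (∑-cong (λ x → sym (*-identityʳ _))) (∑-δ {λ _ → 1#} (λ _ → refl))) ⟨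
        jacobi χ (χ ²) + ∑ δ
          ≈⟨ ∑-+ _ _ ⟨
        ∑ (λ u → χ u * (χ ²) (1ℤ ℤ.- u) + δ u)
          ≈⟨ ∑-cong term ⟩
        ∑ (λ u → (χ ²) (inv u ℤ.- 1ℤ))
          ≈⟨ ∑-substitute per-1 inv inv inv-cong inv-cong inv-involutive inv-involutive ⟩
        ∑ (λ v → (χ ²) (v ℤ.- 1ℤ))
          ≈⟨ ∑-shift χ².cong-φ (ℤ.- 1ℤ) ⟩
        ∑ (χ ²)
          ≈⟨ ∑χ²≈0 ⟩
        0# ∎

    convolve-χ-χ : ∀ s → convolve χ χ s ≈ J * (χ ²) s
    convolve-χ-χ s with s ≟ₚ 0ℤ
    ... | no  s≉0 = trans (convolve-unit multiplicative multiplicative s≉0) (*-comm _ _)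
    ... | yes s≈0 = begin
      convolve χ χ s          ≈⟨ convolve-zero multiplicative multiplicative s≈0 ⟩
      χ ℤ.-1ℤ * ∑ (χ ²)       ≈⟨ trans (*-congˡ ∑χ²≈0) (zeroʳ _) ⟩
      0#                      ≈⟨ zeroʳ J ⟨
      J * 0#                  ≈⟨ *-congˡ (Multiplicative.≈0 χ²-multiplicative s≈0) ⟨
      J * (χ ²) s             ∎

    -- Away from 0 the two characters multiply to 1 and leave their Jacobi sum `- 1#`; at 0 the
    -- convolution counts the `p - 1` nonzero residues.
    convolve-χ-χ² : ∀ s → convolve χ (χ ²) s ≈ P * δ s - 1#
    convolve-χ-χ² s with s ≟ₚ 0ℤ
    ... | no  s≉0 = begin
      convolve χ (χ ²) s                       ≈⟨ convolve-unit multiplicative χ²-multiplicative s≉0 ⟩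
      (χ s * (χ ²) s) * jacobi χ (χ ²)         ≈⟨ *-cong (cube s≉0) jacobi-χ-χ² ⟩
      1# * - 1#                                ≈⟨ *-identityˡ _ ⟩
      - 1#                                     ≈⟨ +-identityˡ _ ⟨
      0# - 1#                                  ≈⟨ +-congʳ (trans (*-congˡ (δ≈0 s≉0)) (zeroʳ P)) ⟨
      P * δ s - 1#                             ∎
    ... | yes s≈0 = begin
      convolve χ (χ ²) s                       ≈⟨ convolve-zero multiplicative χ²-multiplicative s≈0 ⟩
      (χ ²) ℤ.-1ℤ * ∑ (λ t → χ t * (χ ²) t)    ≈⟨ *-congʳ (trans (*-cong χ[-1]≈1 χ[-1]≈1) (*-identityˡ _)) ⟩
      1# * ∑ (λ t → χ t * (χ ²) t)             ≈⟨ *-identityˡ _ ⟩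
      ∑ (λ t → χ t * (χ ²) t)                  ≈⟨ x≈z//y _ _ _ sum≈P ⟩
      P - 1#                                   ≈⟨ +-congʳ (trans (*-congˡ (δ≈1 s≈0)) (*-identityʳ P)) ⟨
      P * δ s - 1#                             ∎
      where
      term : ∀ t → χ t * (χ ²) t + δ t ≈ 1#
      term t with t ≟ₚ 0ℤ
      ... | yes t≈0 = trans (+-cong (trans (*-congʳ (≈0 t≈0)) (zeroˡ _)) (δ≈1 t≈0)) (+-identityˡ 1#)
      ... | no  t≉0 = trans (+-cong (cube t≉0) (δ≈0 t≉0)) (+-identityʳ 1#)

      sum≈P : ∑ (λ t → χ t * (χ ²) t) + 1# ≈ P
      sum≈P = begin
        ∑ (λ t → χ t * (χ ²) t) + 1#
          ≈⟨ +-congˡ (trans (∑-cong (λ x → sym (*-identityʳ _))) (∑-δ {λ _ → 1#} (λ _ → refl))) ⟨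
        ∑ (λ t → χ t * (χ ²) t) + ∑ δ      ≈⟨ ∑-+ _ _ ⟨
        ∑ (λ t → χ t * (χ ²) t + δ t)      ≈⟨ ∑-cong term ⟩
        ∑ (λ _ → 1#)                       ≈⟨ ∑-const 1# ⟩
        P                                  ∎

-- Powers of the Gauss sum in the group ring

module GaussSumPowers {c ℓ} (A : CommutativeRing c ℓ) (p : ℕ) .{{_ : ℕ.NonZero p}} (prime-p : ℕ.Prime p)
  {χ : ℤ → CommutativeRing.Carrier A} (isχ : GaussSum.IsCubicCharacter A p prime-p χ) where
  open GaussSum A p prime-p
  open CommutativeRing A hiding (zero)
  open Multiples semiring renaming (_×_ to _·_)
  open Exponentiation commutativeSemiring
  open RingProperties ring using (-0#≈0#)
  open CommutativeSemigroupProperties *-commutativeSemigroup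
  open ResidueSum A p
  open Residues p
  open PrimeResidues p prime-p using (inv; *-inv)
  open GroupRing A p
  open IsCubicCharacter isχ

  private
    module 𝔾 = CommutativeRing groupRing
    module 𝔾^ = Exponentiation 𝔾.commutativeSemiring
    module 𝔾· = Multiples 𝔾.semiring
    module 𝔾∑ = Sums 𝔾.semiring

  infixr 8 _^ᴳ_
  _^ᴳ_ : Element → ℕ → Element
  _^ᴳ_ = 𝔾^._^_

  infixr 7 _⊙_
  _⊙_ : Carrier → Element → Element
  a ⊙ f = element (λ x → a * coeff f x) (λ e → *-congˡ (periodic f e))

  ⊙-cong : ∀ {a b f g} → a ≈ b → f ≐ g → a ⊙ f ≐ b ⊙ g
  ⊙-cong a≈b f≐g = pointwise λ x → *-cong a≈b (at f≐g x)

  ⊙-⊙ : ∀ a b f → a ⊙ b ⊙ f ≐ (a * b) ⊙ f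
  ⊙-⊙ a b f = pointwise λ x → sym (*-assoc _ _ _)

  ⊙-⋆ : ∀ a b f g → (a ⊙ f) ⋆ (b ⊙ g) ≐ (a * b) ⊙ (f ⋆ g)
  ⊙-⋆ a b f g = pointwise λ x → trans (∑-cong (λ t → interchange _ _ _ _)) (sym (∑-*ˡ _ _))

  ⋆-⊙ : ∀ a f g → f ⋆ (a ⊙ g) ≐ a ⊙ (f ⋆ g)
  ⋆-⊙ a f g = pointwise λ x → trans (∑-cong (λ t → x∙yz≈y∙xz _ _ _)) (sym (∑-*ˡ _ _))

  ⋆-congˡ : ∀ f {g h} → g ≐ h → f ⋆ g ≐ f ⋆ h
  ⋆-congˡ f {g} {h} = ⋆-cong {f} {f} {g} {h} 𝔾.refl

  ⊙-^ : ∀ a f n → (a ⊙ f) ^ᴳ n ≐ (a ^ n) ⊙ (f ^ᴳ n)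
  ⊙-^ a f zero    = pointwise λ x → sym (*-identityˡ _)
  ⊙-^ a f (suc n) = ≐-trans (⋆-congˡ (a ⊙ f) (⊙-^ a f n)) (⊙-⋆ a (a ^ n) f (f ^ᴳ n))

  -- The basis element [a] of the group ring.
  shift : ℤ → Element
  shift a = element (λ x → δ (x ℤ.- a)) (λ e → δ-periodic (+-congʳₚ (ℤ.- a) e))

  shift-⋆ : ∀ a b → shift a ⋆ shift b ≐ shift (a ℤ.+ b)
  shift-⋆ a b = pointwise λ s → trans
    (∑-cong (λ t → *-congˡ (reflexive (cong δ (lem₁ s t b)))))
    (trans (∑-δ-reflected (periodic (shift a)) (s ℤ.- b)) (reflexive (cong δ (lem₂ s a b))))
    where
    lem₁ : ∀ s t b → (s ℤ.- t) ℤ.- b ≡ (s ℤ.- b) ℤ.- t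
    lem₁ = ℤ.solve-∀
    lem₂ : ∀ s a b → (s ℤ.- b) ℤ.- a ≡ s ℤ.- (a ℤ.+ b)
    lem₂ = ℤ.solve-∀

  shift-^ : ∀ a n → shift a ^ᴳ n ≐ shift (+ n ℤ.* a)
  shift-^ a zero    = pointwise λ x → reflexive (cong δ (≡.sym (ℤ.+-identityʳ x)))
  shift-^ a (suc n) = ≐-trans (⋆-congˡ (shift a) (shift-^ a n)) (≐-trans (shift-⋆ a (+ n ℤ.* a))
    (pointwise λ x → reflexive (cong (λ y → δ (x ℤ.- y)) (lem (+ n) a))))
    where
    lem : ∀ m a → a ℤ.+ m ℤ.* a ≡ (1ℤ ℤ.+ m) ℤ.* a
    lem = ℤ.solve-∀

  -- `G²` is the Gauss sum of the squared character and not the square of `G`. `U` is the sum of all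
  -- group elements, the quantity that would be 0 for actual roots of unity.
  G G² U : Element
  G  = element χ cong-φ
  G² = element (χ ²) (λ e → *-cong (cong-φ e) (cong-φ e))
  U  = element (λ _ → 1#) (λ _ → refl)

  private
    j q : Carrier
    j = J isχ
    q = P isχ

  G⋆G : G ⋆ G ≐ j ⊙ G²
  G⋆G = pointwise (convolve-χ-χ isχ)

  G⋆G² : G ⋆ G² ≐ q ⊙ 1ᴳ ⊞ neg U
  G⋆G² = pointwise (convolve-χ-χ² isχ)

  G⋆U : G ⋆ U ≐ 0ᴳ
  G⋆U = pointwise λ s → trans (∑-cong (λ t → *-identityʳ _)) ∑χ≈0

  -- The product `G ⋆ G²` still contains `U`, and a further factor `G` annihilates it. This is what
  -- turns the formula for a cube into one for a fourth power.
  G⋆G⋆G² : G ⋆ (G ⋆ G²) ≐ q ⊙ G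
  G⋆G⋆G² = pointwise λ s → begin
    coeff (G ⋆ (G ⋆ G²)) s
      ≈⟨ at (⋆-congˡ G G⋆G²) s ⟩
    coeff (G ⋆ (q ⊙ 1ᴳ ⊞ neg U)) s
      ≈⟨ at (⋆-distribˡ G (q ⊙ 1ᴳ) (neg U)) s ⟩
    coeff (G ⋆ (q ⊙ 1ᴳ)) s + coeff (G ⋆ neg U) s
      ≈⟨ +-cong (at (⋆-⊙ q G 1ᴳ) s) (sym (at (RingProperties.-‿distribʳ-* 𝔾.ring G U) s)) ⟩
    q * coeff (G ⋆ 1ᴳ) s - coeff (G ⋆ U) s
      ≈⟨ +-cong (*-congˡ (at (⋆-identityʳ G) s)) (-‿cong (at G⋆U s)) ⟩
    q * χ s - 0#
      ≈⟨ trans (+-congˡ -0#≈0#) (+-identityʳ _) ⟩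
    q * χ s ∎
    where open SetoidReasoning setoid

  G^4 : G ⋆ (G ⋆ (G ⋆ G)) ≐ (j * q) ⊙ G
  G^4 = begin
    G ⋆ (G ⋆ (G ⋆ G))     ≈⟨ ⋆-congˡ G (⋆-congˡ G G⋆G) ⟩
    G ⋆ (G ⋆ (j ⊙ G²))    ≈⟨ ⋆-congˡ G (⋆-⊙ j G G²) ⟩
    G ⋆ (j ⊙ (G ⋆ G²))    ≈⟨ ⋆-⊙ j G (G ⋆ G²) ⟩
    j ⊙ (G ⋆ (G ⋆ G²))    ≈⟨ ⊙-cong refl G⋆G⋆G² ⟩
    j ⊙ q ⊙ G             ≈⟨ ⊙-⊙ j q G ⟩
    (j * q) ⊙ G           ∎
    where open SetoidReasoning 𝔾.setoid

  G^[1+3k] : ∀ k → G ^ᴳ suc (k ℕ.* 3) ≐ ((j * q) ^ k) ⊙ G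
  G^[1+3k] zero    = ≐-trans (𝔾.*-identityʳ G) (pointwise λ x → sym (*-identityˡ _))
  G^[1+3k] (suc k) = begin
    G ⋆ (G ⋆ (G ⋆ G ^ᴳ suc (k ℕ.* 3)))
      ≈⟨ ⋆-congˡ G (⋆-congˡ G (⋆-congˡ G (G^[1+3k] k))) ⟩
    G ⋆ (G ⋆ (G ⋆ (a ⊙ G)))
      ≈⟨ ⋆-congˡ G (⋆-congˡ G (⋆-⊙ a G G)) ⟩
    G ⋆ (G ⋆ (a ⊙ (G ⋆ G)))
      ≈⟨ ⋆-congˡ G (⋆-⊙ a G (G ⋆ G)) ⟩
    G ⋆ (a ⊙ (G ⋆ (G ⋆ G)))
      ≈⟨ ⋆-⊙ a G (G ⋆ (G ⋆ G)) ⟩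
    a ⊙ (G ⋆ (G ⋆ (G ⋆ G)))
      ≈⟨ ⊙-cong refl G^4 ⟩
    a ⊙ (j * q) ⊙ G
      ≈⟨ ⊙-⊙ a (j * q) G ⟩
    (a * (j * q)) ⊙ G
      ≈⟨ ⊙-cong (*-comm _ _) 𝔾.refl ⟩
    ((j * q) ^ suc k) ⊙ G ∎
    where
    open SetoidReasoning 𝔾.setoid
    a : Carrier
    a = (j * q) ^ k

  opaque
    unfolding ∑

    coeff-sum : ∀ (F : ℤ → Element) x → coeff (𝔾∑.sum {p} (λ i → F (rep i))) x ≈ ∑ (λ t → coeff (F t) x)
    coeff-sum F x = go (λ i → F (rep i))
      where
      open Sums semiring using (sum)
      go : ∀ {n} (F : Fin n → Element) → coeff (𝔾∑.sum F) x ≈ sum (λ i → coeff (F i) x)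
      go {zero}  F = refl
      go {suc n} F = +-congˡ (go (F ∘ suc))

  groupRing-char : ∀ l → l · 1# ≈ 0# → l 𝔾·.× 1ᴳ ≐ 0ᴳ
  groupRing-char l l≈0 = pointwise λ x → begin
    coeff (l 𝔾·.× 1ᴳ) x   ≈⟨ go l x ⟩
    l · δ x               ≈⟨ ×-congʳ l (*-identityˡ _) ⟨
    l · (1# * δ x)        ≈⟨ ×-assoc-* l 1# (δ x) ⟨
    (l · 1#) * δ x        ≈⟨ *-congʳ l≈0 ⟩
    0# * δ x              ≈⟨ zeroˡ _ ⟩
    0#                    ∎
    where
    open SetoidReasoning setoid
    go : ∀ n x → coeff (n 𝔾·.× 1ᴳ) x ≈ n · δ x
    go zero    x = refl
    go (suc n) x = +-congˡ (go n x)

  -- Additivity gives `G ^ᴳ n` as the sum of `χ t ^ n` times [n t]. As `n` is invertible modulo `p`,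
  -- only `t = 1` contributes at [n], where the character value is 1 whatever the exponent.
  coeff-G^ : ∀ n → 0 ℕ.< n → Frobenius.Additive groupRing n → ¬ + n ≈ₚ 0ℤ →
    coeff (G ^ᴳ n) (+ n) ≈ 1#
  coeff-G^ n 0<n add n≉0 = begin
    coeff (G ^ᴳ n) (+ n)
      ≈⟨ at (𝔾^.^-congˡ n G-expansion) (+ n) ⟩
    coeff (𝔾∑.sum {p} (λ i → χ (rep i) ⊙ shift (rep i)) ^ᴳ n) (+ n)
      ≈⟨ at (Frobenius.additive-sum groupRing 0<n add {p} (λ i → χ (rep i) ⊙ shift (rep i))) (+ n) ⟩
    coeff (𝔾∑.sum {p} (λ i → (χ (rep i) ⊙ shift (rep i)) ^ᴳ n)) (+ n)
      ≈⟨ coeff-sum (λ t → (χ t ⊙ shift t) ^ᴳ n) (+ n) ⟩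
    ∑ (λ t → coeff ((χ t ⊙ shift t) ^ᴳ n) (+ n))
      ≈⟨ ∑-cong (λ t → trans (at (⊙-^ (χ t) (shift t) n) (+ n)) (*-congˡ (at (shift-^ t n) (+ n)))) ⟩
    ∑ (λ t → χ t ^ n * δ (+ n ℤ.- + n ℤ.* t))
      ≈⟨ ∑-cong (λ t → *-congˡ (δ-scale t)) ⟩
    ∑ (λ t → χ t ^ n * δ (1ℤ ℤ.- t))
      ≈⟨ ∑-δ-reflected {λ t → χ t ^ n} (λ e → ^-congˡ n (cong-φ e)) 1ℤ ⟩
    χ 1ℤ ^ n
      ≈⟨ ^-congˡ n (χ[1]≈1 isχ) ⟩
    1# ^ n
      ≈⟨ 1^ n ⟩
    1# ∎
    where
    open SetoidReasoning setoid

    1^ : ∀ n → 1# ^ n ≈ 1#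
    1^ zero    = refl
    1^ (suc n) = trans (*-identityˡ _) (1^ n)

    G-expansion : G ≐ 𝔾∑.sum {p} (λ i → χ (rep i) ⊙ shift (rep i))
    G-expansion = pointwise λ x →
      sym (trans (coeff-sum (λ t → χ t ⊙ shift t) x) (∑-δ-reflected cong-φ x))

    lem₁ : ∀ n t → n ℤ.- n ℤ.* t ≡ n ℤ.* (1ℤ ℤ.- t)
    lem₁ = ℤ.solve-∀

    lem₂ : ∀ m n y → m ℤ.* (n ℤ.* y) ≡ (n ℤ.* m) ℤ.* y
    lem₂ = ℤ.solve-∀

    δ-scale : ∀ t → δ (+ n ℤ.- + n ℤ.* t) ≈ δ (1ℤ ℤ.- t)
    δ-scale t = trans (reflexive (cong δ (lem₁ (+ n) t))) (go (1ℤ ℤ.- t))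
      where
      go : ∀ y → δ (+ n ℤ.* y) ≈ δ y
      go y with y ≟ₚ 0ℤ
      ... | yes y≈0 = trans (δ≈1 (transₚ (*-congˡₚ (+ n) y≈0) (≡⇒≈ₚ (ℤ.*-zeroʳ (+ n))))) (sym (δ≈1 y≈0))
      ... | no  y≉0 = trans (δ≈0 (λ ny≈0 → y≉0 (transₚ (symₚ (≡⇒≈ₚ (ℤ.*-identityˡ y)))
              (transₚ (symₚ (*-congʳₚ y (*-inv n≉0))) (transₚ (≡⇒≈ₚ (≡.sym (lem₂ (inv (+ n)) (+ n) y)))
                (transₚ (*-congˡₚ (inv (+ n)) ny≈0) (≡⇒≈ₚ (ℤ.*-zeroʳ (inv (+ n)))))))))) (sym (δ≈0 y≉0))

  -- The coefficients at [n] of the two evaluations of `G ^ᴳ n`, for `n = 1 + 3 k`. The parameters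
  -- `a` and `b` admit the explicit values π and p, to which the sums are only equivalent.
  J*P-power : ∀ {a b} k → j ≈ a → q ≈ b →
    Frobenius.Additive groupRing (suc (k ℕ.* 3)) → ¬ + suc (k ℕ.* 3) ≈ₚ 0ℤ →
    (a * b) ^ k * χ (+ suc (k ℕ.* 3)) ≈ 1#
  J*P-power k j≈a q≈b add n≉0 =
    trans (*-congʳ (^-congˡ k (*-cong (sym j≈a) (sym q≈b))))
      (trans (sym (at (G^[1+3k] k) (+ suc (k ℕ.* 3)))) (coeff-G^ (suc (k ℕ.* 3)) (s≤s z≤n) add n≉0))

  -- Two evaluations of the coefficient at [3] of the cube of `G`: additivity of cubing gives 1, and
  -- multiplying out gives `j * (q * δ 3 - 1)`, in which `δ` vanishes because 3 is nonzero modulo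
  -- `p`.
  J≈-1 : 3 · 1# ≈ 0# → ¬ + 3 ≈ₚ 0ℤ → j * - 1# ≈ 1#
  J≈-1 3≈0 3≉0 = begin
    j * - 1#                                   ≈⟨ *-congˡ (+-identityˡ _) ⟨
    j * (0# - 1#)                              ≈⟨ *-congˡ (+-congʳ (trans (*-congˡ (δ≈0 3≉0)) (zeroʳ q))) ⟨
    coeff (j ⊙ (q ⊙ 1ᴳ ⊞ neg U)) (+ 3)         ≈⟨ *-congˡ (at G⋆G² (+ 3)) ⟨
    coeff (j ⊙ (G ⋆ G²)) (+ 3)                 ≈⟨ at (⋆-⊙ j G G²) (+ 3) ⟨
    coeff (G ⋆ (j ⊙ G²)) (+ 3)                 ≈⟨ at (⋆-congˡ G G⋆G) (+ 3) ⟨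
    coeff (G ⋆ (G ⋆ G)) (+ 3)                  ≈⟨ at (⋆-congˡ G (⋆-congˡ G (⋆-identityʳ G))) (+ 3) ⟨
    coeff (G ^ᴳ 3) (+ 3)                       ≈⟨ coeff-G^ 3 (s≤s z≤n) (Frobenius.prime-additive groupRing prime[3] (groupRing-char 3 3≈0)) 3≉0 ⟩
    1#                                         ∎
    where
    open SetoidReasoning setoid
    prime[3] : ℕ.Prime 3
    prime[3] = toWitness {a? = ℕ.prime? 3} _

  -- In `G ⋆ G ⋆ G²` either the first two factors are replaced by `j ⊙ G²`, so that the Jacobi sum
  -- of the squared character appears, or the last two are multiplied first. The coefficients are
  -- compared at 1, where the character is 1.
  J*J²≈P : j * J (χ²-isCubicCharacter isχ) ≈ q
  J*J²≈P = begin
    j * j²                          ≈⟨ *-identityʳ _ ⟨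
    (j * j²) * 1#                   ≈⟨ *-congˡ (χ[1]≈1 isχ) ⟨
    (j * j²) * χ 1ℤ                 ≈⟨ *-assoc _ _ _ ⟩
    j * (j² * χ 1ℤ)                 ≈⟨ *-congˡ (*-congˡ (χ²²≈χ isχ 1ℤ)) ⟨
    j * (j² * ((χ ²) ²) 1ℤ)         ≈⟨ *-congˡ (convolve-χ-χ (χ²-isCubicCharacter isχ) 1ℤ) ⟨
    j * coeff (G² ⋆ G²) 1ℤ          ≈⟨ at (⋆-⊙ j G² G²) 1ℤ ⟨
    coeff (G² ⋆ (j ⊙ G²)) 1ℤ        ≈⟨ at (⋆-comm G² (j ⊙ G²)) 1ℤ ⟩
    coeff ((j ⊙ G²) ⋆ G²) 1ℤ        ≈⟨ at (⋆-cong {G ⋆ G} {j ⊙ G²} {G²} {G²} G⋆G 𝔾.refl) 1ℤ ⟨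
    coeff ((G ⋆ G) ⋆ G²) 1ℤ         ≈⟨ at (⋆-assoc G G G²) 1ℤ ⟩
    coeff (G ⋆ (G ⋆ G²)) 1ℤ         ≈⟨ at G⋆G⋆G² 1ℤ ⟩
    q * χ 1ℤ                        ≈⟨ *-congˡ (χ[1]≈1 isχ) ⟩
    q * 1#                          ≈⟨ *-identityʳ q ⟩
    q                               ∎
    where
    open SetoidReasoning setoid
    j² : Carrier
    j² = J (χ²-isCubicCharacter isχ)

-- Arithmetic of the Eisenstein integers

open import Defs
open ≡ using (refl; sym; trans)

module 𝔻 = CommutativeRing D-commutativeRing

D-solver : AlmostCommutativeRing 0ℓ 0ℓ
D-solver = fromCommutativeRing D-commutativeRing λ α → dec⇒maybe (0D ≟ α)

D/_ : D → CommutativeRing 0ℓ 0ℓ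
D/ γ = Quotient.quotient D-commutativeRing γ

module Mod (γ : D) where
  open CommutativeRing (D/ γ) public
    using (_≈_; setoid; *-cong; *-congˡ; *-congʳ; +-cong; reflexive)
    renaming (sym to ≈-sym; trans to ≈-trans)
  open Exponentiation (CommutativeRing.commutativeSemiring (D/ γ)) public using (^-congˡ)
  open SetoidReasoning setoid public

open Exponentiation 𝔻.commutativeSemiring
  using (^-assocʳ; ^-distrib-*)

∣-⊛ˡ : ∀ {γ α} β → γ ∣ α → γ ∣ β ⊛ α
∣-⊛ˡ {γ} β (q Divides., e) = (β ⊛ q) Divides., trans (𝔻.*-assoc β q γ) (cong (β ⊛_) e)

∣-⊛ʳ : ∀ {γ α} β → γ ∣ α → γ ∣ α ⊛ β
∣-⊛ʳ {γ} {α} β γ∣α = subst (γ ∣_) (𝔻.*-comm β α) (∣-⊛ˡ β γ∣α)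

∣-⊕ : ∀ {γ α β} → γ ∣ α → γ ∣ β → γ ∣ α ⊕ β
∣-⊕ {γ} (q Divides., e) (r Divides., f) =
  (q ⊕ r) Divides., trans (𝔻.distribʳ γ q r) (cong₂ _⊕_ e f)

∣-trans : ∀ {α β γ} → α ∣ β → β ∣ γ → α ∣ γ
∣-trans {α} α∣β (q Divides., e) = subst (α ∣_) e (∣-⊛ˡ q α∣β)

∣-refl : ∀ α → α ∣ α
∣-refl α = 1D Divides., 𝔻.*-identityˡ α

⊖-zeroʳ : ∀ α → α ⊖ 0D ≡ α
⊖-zeroʳ = solve-∀ D-solver

∣⇒≡0 : ∀ {γ α} → γ ∣ α → α ≡ 0D [mod γ ]
∣⇒≡0 {γ} {α} = subst (γ ∣_) (sym (⊖-zeroʳ α))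

≡0⇒∣ : ∀ {γ α} → α ≡ 0D [mod γ ] → γ ∣ α
≡0⇒∣ {γ} {α} = subst (γ ∣_) (⊖-zeroʳ α)

⊖≡0⇒≡ : ∀ {α β} → α ⊖ β ≡ 0D → α ≡ β
⊖≡0⇒≡ {α} {β} e = trans (lemma α β) (trans (cong (_⊕ β) e) (𝔻.+-identityˡ β))
  where
  lemma : ∀ α β → α ≡ (α ⊖ β) ⊕ β
  lemma = solve-∀ D-solver

fromℤ-* : ∀ m n → fromℤ (m ℤ.* n) ≡ fromℤ m ⊛ fromℤ n
fromℤ-* m n = cong₂ _+ω_ (lem₁ m n) (lem₂ m n)
  where
  open Data.Integer.Base using (_+_; _*_; _-_)
  lem₁ : ∀ a c → a * c ≡ a * c - 0ℤ * 0ℤ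
  lem₁ = ℤ.solve-∀
  lem₂ : ∀ a c → 0ℤ ≡ a * 0ℤ + 0ℤ * c - 0ℤ * 0ℤ
  lem₂ = ℤ.solve-∀

fromℤ-^ : ∀ m k → fromℤ (m ℤ.^ k) ≡ fromℤ m ^ k
fromℤ-^ m zero    = refl
fromℤ-^ m (suc k) = trans (fromℤ-* m (m ℤ.^ k)) (cong (fromℤ m ⊛_) (fromℤ-^ m k))

fromℤ-∣ : ∀ {m n} → m ℤ.∣ n → fromℤ m ∣ fromℤ n
fromℤ-∣ {m} (ℤ.divides q e) = fromℤ q Divides., trans (sym (fromℤ-* q m)) (cong fromℤ (sym e))

fromℤ∣⇒∣re : ∀ {m α} → fromℤ m ∣ α → m ℤ.∣ re α
fromℤ∣⇒∣re {m} (q Divides., e) = ℤ.divides (re q) (trans (cong re (sym e)) (cong re (⊛-fromℤ q m)))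

fromℤ∣⇒∣im : ∀ {m α} → fromℤ m ∣ α → m ℤ.∣ im α
fromℤ∣⇒∣im {m} (q Divides., e) = ℤ.divides (im q) (trans (cong im (sym e)) (cong im (⊛-fromℤ q m)))

conj-⊕ : ∀ α β → conj (α ⊕ β) ≡ conj α ⊕ conj β
conj-⊕ (a +ω b) (c +ω d) = cong₂ _+ω_ (lem₁ a b c d) (lem₂ b d)
  where
  open Data.Integer.Base using (_+_; _-_; -_)
  lem₁ : ∀ a b c d → (a + c) - (b + d) ≡ (a - b) + (c - d)
  lem₁ = ℤ.solve-∀
  lem₂ : ∀ b d → - (b + d) ≡ - b + - d
  lem₂ = ℤ.solve-∀

conj-⊛ : ∀ α β → conj (α ⊛ β) ≡ conj α ⊛ conj β
conj-⊛ (a +ω b) (c +ω d) = cong₂ _+ω_ (lem₁ a b c d) (lem₂ a b c d)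
  where
  open Data.Integer.Base using (_+_; _*_; _-_; -_)
  lem₁ : ∀ a b c d → (a * c - b * d) - (a * d + b * c - b * d)
                   ≡ (a - b) * (c - d) - (- b) * (- d)
  lem₁ = ℤ.solve-∀
  lem₂ : ∀ a b c d → - (a * d + b * c - b * d)
                   ≡ (a - b) * (- d) + (- b) * (c - d) - (- b) * (- d)
  lem₂ = ℤ.solve-∀

norm-⊛ : ∀ α β → norm (α ⊛ β) ≡ norm α ℤ.* norm β
norm-⊛ α β = cong re (begin
  fromℤ (norm (α ⊛ β))                ≡⟨ ⊛-conj (α ⊛ β) ⟨
  (α ⊛ β) ⊛ conj (α ⊛ β)              ≡⟨ cong ((α ⊛ β) ⊛_) (conj-⊛ α β) ⟩
  (α ⊛ β) ⊛ (conj α ⊛ conj β)         ≡⟨ interchange α β (conj α) (conj β) ⟩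
  (α ⊛ conj α) ⊛ (β ⊛ conj β)         ≡⟨ cong₂ _⊛_ (⊛-conj α) (⊛-conj β) ⟩
  fromℤ (norm α) ⊛ fromℤ (norm β)     ≡⟨ fromℤ-* (norm α) (norm β) ⟨
  fromℤ (norm α ℤ.* norm β)           ∎)
  where
  open ≡-Reasoning
  open CommutativeSemigroupProperties 𝔻.*-commutativeSemigroup using (interchange)

norm-conj : ∀ α → norm (conj α) ≡ norm α
norm-conj (a +ω b) = lem a b
  where
  open Data.Integer.Base using (_+_; _*_; _-_; -_)
  lem : ∀ a b → (a - b) * (a - b) - (a - b) * (- b) + (- b) * (- b) ≡ a * a - a * b + b * b
  lem = ℤ.solve-∀

norm-fromℤ : ∀ n → norm (fromℤ n) ≡ n ℤ.* n
norm-fromℤ = lem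
  where
  open Data.Integer.Base using (_+_; _*_; _-_)
  lem : ∀ n → n * n - n * 0ℤ + 0ℤ * 0ℤ ≡ n * n
  lem = ℤ.solve-∀

∣norm∣-fromℤ : ∀ n → ∣ norm (fromℤ n) ∣ ≡ ∣ n ∣ ℕ.* ∣ n ∣
∣norm∣-fromℤ n = trans (cong ∣_∣ (norm-fromℤ n)) (ℤ.abs-* n n)

square-∣∣ : ∀ i → + (∣ i ∣ ℕ.* ∣ i ∣) ≡ i ℤ.* i
square-∣∣ (+ k)      = ℤ.pos-* k k
square-∣∣ ℤ.-[1+ k ] = refl

-- Completing the square. The absolute values make the left side a natural number, so that
-- positivity and size estimates can be read off.
4-norm : ∀ α → + (∣ + 2 ℤ.* re α ℤ.- im α ∣ ℕ.* ∣ + 2 ℤ.* re α ℤ.- im α ∣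
                   ℕ.+ 3 ℕ.* (∣ im α ∣ ℕ.* ∣ im α ∣)) ≡ + 4 ℤ.* norm α
4-norm (a +ω b) = begin
  + (m ℕ.* m) + + (3 ℕ.* (n ℕ.* n))
    ≡⟨ cong₂ _+_ (square-∣∣ (+ 2 * a - b))
         (trans (ℤ.pos-* 3 (n ℕ.* n)) (cong (+ 3 *_) (square-∣∣ b))) ⟩
  (+ 2 * a - b) * (+ 2 * a - b) + + 3 * (b * b)
    ≡⟨ lem a b ⟩
  + 4 * (a * a - a * b + b * b) ∎
  where
  open ≡-Reasoning
  open Data.Integer.Base using (_+_; _*_; _-_)
  m n : ℕ
  m = ∣ + 2 * a - b ∣
  n = ∣ b ∣
  lem : ∀ a b → (+ 2 * a - b) * (+ 2 * a - b) + + 3 * (b * b) ≡ + 4 * (a * a - a * b + b * b)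
  lem = ℤ.solve-∀

norm-nonNeg : ∀ α → + ∣ norm α ∣ ≡ norm α
norm-nonNeg α = go (norm α) (4-norm α)
  where
  go : ∀ x {m} → + m ≡ + 4 ℤ.* x → + ∣ x ∣ ≡ x
  -- For negative `x` the right side of the equation computes to a negative integer, so that no
  -- other case arises.
  go (+ n) _ = refl

∣norm∣-⊛ : ∀ α β → ∣ norm (α ⊛ β) ∣ ≡ ∣ norm α ∣ ℕ.* ∣ norm β ∣
∣norm∣-⊛ α β = trans (cong ∣_∣ (norm-⊛ α β)) (ℤ.abs-* (norm α) (norm β))

∣⇒∣norm∣ : ∀ {α β} → α ∣ β → ∣ norm α ∣ ℕ.∣ ∣ norm β ∣
∣⇒∣norm∣ {α} (q Divides., e) =
  ℕ.divides ∣ norm q ∣ (trans (cong (∣_∣ ∘ norm) (sym e)) (∣norm∣-⊛ q α))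

∣fromℤ-norm : ∀ α → α ∣ fromℤ (norm α)
∣fromℤ-norm α = conj α Divides., trans (𝔻.*-comm (conj α) α) (⊛-conj α)

⊛≡0 : ∀ α β → α ⊛ β ≡ 0D → α ≡ 0D ⊎ β ≡ 0D
⊛≡0 α β e = [ (λ N≡0 → inj₁ (norm≡0⇒≡0 α N≡0)) , (λ N≡0 → inj₂ (norm≡0⇒≡0 β N≡0)) ]′
  (ℤ.i*j≡0⇒i≡0∨j≡0 (norm α) (trans (sym (norm-⊛ α β)) (cong norm e)))

⊛-cancelʳ : ∀ α β γ → γ ≢ 0D → α ⊛ γ ≡ β ⊛ γ → α ≡ β
⊛-cancelʳ α β γ γ≢0 e = [ ⊖≡0⇒≡ , (λ γ≡0 → contradiction γ≡0 γ≢0) ]′ (⊛≡0 (α ⊖ β) γ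
  (trans (lem α β γ) (trans (cong (_⊖ β ⊛ γ) e) (𝔻.-‿inverseʳ (β ⊛ γ)))))
  where
  lem : ∀ α β γ → (α ⊖ β) ⊛ γ ≡ α ⊛ γ ⊖ β ⊛ γ
  lem = solve-∀ D-solver

-- A nonzero multiple `b` of 3 has `3 b² ≥ 27`, whereas four times the norm is only 4.
norm≡1∧3∣im⇒im≡0 : ∀ α → norm α ≡ 1ℤ → + 3 ℤ.∣ im α → im α ≡ 0ℤ
norm≡1∧3∣im⇒im≡0 (a +ω b) N≡1 (ℤ.divides c b≡3c) = trans b≡3c (cong (ℤ._* + 3) (ℤ.∣i∣≡0⇒i≡0 {c} c≡0))
  where
  m n k : ℕ
  m = ∣ + 2 ℤ.* a ℤ.- b ∣
  n = ∣ b ∣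
  k = ∣ c ∣

  n≡k*3 : n ≡ k ℕ.* 3
  n≡k*3 = trans (cong ∣_∣ b≡3c) (ℤ.abs-* c (+ 3))

  sum≡4 : m ℕ.* m ℕ.+ 3 ℕ.* (n ℕ.* n) ≡ 4
  sum≡4 = ℤ.+-injective (trans (4-norm (a +ω b)) (cong (+ 4 ℤ.*_) N≡1))

  c≡0 : k ≡ 0
  c≡0 = go k n≡k*3
    where
    open ℕ.≤-Reasoning
    go : ∀ k → n ≡ k ℕ.* 3 → k ≡ 0
    go zero    _ = refl
    go (suc j) e = contradiction (ℕ.≤-reflexive sum≡4) (ℕ.<⇒≱ (begin-strict
      4                                ≤⟨ ℕ.m≤m+n 4 22 ⟩
      26                               <⟨ ℕ.n<1+n 26 ⟩
      3 ℕ.* (3 ℕ.* 3)                  ≤⟨ ℕ.*-monoʳ-≤ 3 (ℕ.*-mono-≤ 3≤n 3≤n) ⟩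
      3 ℕ.* (n ℕ.* n)                  ≤⟨ ℕ.m≤n+m _ (m ℕ.* m) ⟩
      m ℕ.* m ℕ.+ 3 ℕ.* (n ℕ.* n)      ∎))
      where
      3≤n : 3 ℕ.≤ n
      3≤n = subst (3 ℕ.≤_) (sym e) (ℕ.m≤m+n 3 (j ℕ.* 3))

∣re∣≡1 : ∀ α → norm α ≡ 1ℤ → im α ≡ 0ℤ → ∣ re α ∣ ≡ 1
∣re∣≡1 (a +ω b) N≡1 b≡0 = ℕ.m*n≡1⇒m≡1 ∣ a ∣ ∣ a ∣ (ℤ.+-injective (begin
  + (∣ a ∣ ℕ.* ∣ a ∣)     ≡⟨ square-∣∣ a ⟩
  a ℤ.* a                 ≡⟨ norm-fromℤ a ⟨
  norm (a +ω 0ℤ)          ≡⟨ cong (λ x → norm (a +ω x)) b≡0 ⟨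
  norm (a +ω b)           ≡⟨ N≡1 ⟩
  1ℤ                      ∎))
  where open ≡-Reasoning

-- The six units are pairwise incongruent modulo 3. Divisibility of the second coordinate leaves 1
-- and `-1`, and 3 does not divide `-2`.
unit≡1 : ∀ α → norm α ≡ 1ℤ → α ≡ 1D [mod fromℤ (+ 3) ] → α ≡ 1D
unit≡1 (a +ω b) N≡1 α≡1 = cong₂ _+ω_ (go a (∣re∣≡1 (a +ω b) N≡1 b≡0) (fromℤ∣⇒∣re α≡1)) b≡0
  where
  open Data.Integer.Base using (_+_; _*_; _-_)
  b≡0 : b ≡ 0ℤ
  b≡0 = norm≡1∧3∣im⇒im≡0 (a +ω b) N≡1 (subst (+ 3 ℤ.∣_) (ℤ.+-identityʳ b) (fromℤ∣⇒∣im α≡1))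

  go : ∀ x → ∣ x ∣ ≡ 1 → + 3 ℤ.∣ (x ℤ.+ ℤ.- 1ℤ) → x ≡ 1ℤ
  go (+ 1)        refl _  = refl
  go ℤ.-[1+ 0 ]   refl d = contradiction (ℕ.∣⇒≤ (ℤ.∣⇒∣ᵤ d)) (ℕ.<⇒≱ (s≤s (s≤s (s≤s z≤n))))

-- The cubic residue character

infix 4 _≈[_]_
_≈[_]_ : D → D → D → Set
α ≈[ γ ] β = Quotient._≋_ D-commutativeRing γ α β

pattern difference∣ d = Quotient.divides-difference d

∣⇒≈0 : ∀ {γ α} → γ ∣ α → α ≈[ γ ] 0D
∣⇒≈0 γ∣α = difference∣ (∣⇒≡0 γ∣α)

≈0⇒∣ : ∀ {γ α} → α ≈[ γ ] 0D → γ ∣ α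
≈0⇒∣ (difference∣ d) = ≡0⇒∣ d

≈-∣ : ∀ {γ δ α β} → γ ∣ δ → α ≈[ δ ] β → α ≈[ γ ] β
≈-∣ γ∣δ (difference∣ d) = difference∣ (∣-trans γ∣δ d)

^-quotient : ∀ γ α n →
  RawSemiringDefs._^_ (Semiring.rawSemiring (CommutativeRing.semiring (D/ γ))) α n ≡ α ^ n
^-quotient γ α zero    = refl
^-quotient γ α (suc n) = cong (α ⊛_) (^-quotient γ α n)

^-cong-mod : ∀ {γ α β} n → α ≈[ γ ] β → α ^ n ≈[ γ ] β ^ n
^-cong-mod {γ} {α} {β} n e =
  subst₂ (λ x y → x ≈[ γ ] y) (^-quotient γ α n) (^-quotient γ β n) (Mod.^-congˡ γ n e)

1^ : ∀ n → 1D ^ n ≡ 1D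
1^ zero    = refl
1^ (suc n) = trans (𝔻.*-identityˡ _) (1^ n)

data μ₃ : D → Set where
  μ1  : μ₃ 1D
  μω  : μ₃ ω
  μω² : μ₃ (ω ^ 2)

μ₃-⊛ : ∀ {u v} → μ₃ u → μ₃ v → μ₃ (u ⊛ v)
μ₃-⊛ μ1  μ1  = μ1
μ₃-⊛ μ1  μω  = μω
μ₃-⊛ μ1  μω² = μω²
μ₃-⊛ μω  μ1  = μω
μ₃-⊛ μω  μω  = μω²
μ₃-⊛ μω  μω² = μ1
μ₃-⊛ μω² μ1  = μω²
μ₃-⊛ μω² μω  = μ1
μ₃-⊛ μω² μω² = μω

μ₃-cube : ∀ {u} → μ₃ u → u ⊛ (u ⊛ u) ≡ 1D
μ₃-cube μ1  = refl
μ₃-cube μω  = refl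
μ₃-cube μω² = refl

μ₃-conj : ∀ {u} → μ₃ u → u ⊛ u ≡ conj u
μ₃-conj μ1  = refl
μ₃-conj μω  = refl
μ₃-conj μω² = refl

-- Any two distinct cube roots of unity differ by a unit multiple of 1 - ω.
μ₃-unique : ∀ {π u v} → π ∤ 1D ⊖ ω → μ₃ u → μ₃ v → u ≈[ π ] v → u ≡ v
μ₃-unique π∤ μ1  μ1  _ = refl
μ₃-unique π∤ μω  μω  _ = refl
μ₃-unique π∤ μω² μω² _ = refl
μ₃-unique π∤ μ1  μω  (difference∣ d) = contradiction d π∤
μ₃-unique π∤ μω  μ1  (difference∣ d) = contradiction (∣-⊛ˡ (⊝ 1D) d) π∤
μ₃-unique π∤ μ1  μω² (difference∣ d) = contradiction (∣-⊛ˡ (⊝ ω) d) π∤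
μ₃-unique π∤ μω² μ1  (difference∣ d) = contradiction (∣-⊛ˡ ω d) π∤
μ₃-unique π∤ μω  μω² (difference∣ d) = contradiction (∣-⊛ˡ (ω ^ 2) d) π∤
μ₃-unique π∤ μω² μω  (difference∣ d) = contradiction (∣-⊛ˡ (⊝ (ω ^ 2)) d) π∤

-- The interface through which split and inert primes share one theory of `χ`. Fermat's congruence
-- is a field because its proof depends on the kind of prime.
record CubicModulus (π : D) : Set where
  field
    prime  : Prime π
    k      : ℕ
    norm≡  : ∣ norm π ∣ ≡ suc (k ℕ.* 3)
    π∤1-ω  : π ∤ 1D ⊖ ω
    fermat : ∀ α → α ^ suc (k ℕ.* 3) ≈[ π ] α

module CubicResidue {π : D} (cm : CubicModulus π) where
  open CubicModulus cm
  open Mod π using (*-cong; ≈-sym; ≈-trans; reflexive)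

  split-∣ : ∀ α β → π ∣ α ⊛ β → (π ∣ α) ⊎ (π ∣ β)
  split-∣ α β = RawSemiringDefs.Prime.split-∣ prime

  π∤1 : π ∤ 1D
  π∤1 = RawSemiringDefs.Prime.p∤1 prime

  k′≡k : (∣ norm π ∣ ℕ.∸ 1) ℕ./ 3 ≡ k
  k′≡k = trans (cong (λ n → (n ℕ.∸ 1) ℕ./ 3) norm≡) (ℕ.m*n/n≡m k 3)

  cancel-power : ∀ {α} m → π ∤ α → α ^ suc m ≈[ π ] α → α ^ m ≈[ π ] 1D
  cancel-power {α} m π∤α (difference∣ d) = [ (λ π∣α → contradiction π∣α π∤α) , difference∣ ]′
    (split-∣ α (α ^ m ⊖ 1D) (subst (π ∣_) (lem α (α ^ m)) d))
    where
    lem : ∀ α β → α ⊛ β ⊖ α ≡ α ⊛ (β ⊖ 1D)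
    lem = solve-∀ D-solver

  cube-roots : ∀ β → β ⊛ (β ⊛ β) ≈[ π ] 1D →
    (β ≡ 1D [mod π ]) ⊎ (β ≡ ω [mod π ]) ⊎ (β ≡ ω ^ 2 [mod π ])
  cube-roots β (difference∣ d) =
    [ inj₁ , (λ e → inj₂ (split-∣ (β ⊖ ω) (β ⊖ ω ^ 2) e)) ]′
      (split-∣ (β ⊖ 1D) ((β ⊖ ω) ⊛ (β ⊖ ω ^ 2)) (subst (π ∣_) (lem β) d))
    where
    lem : ∀ β → β ⊛ (β ⊛ β) ⊖ 1D ≡ (β ⊖ 1D) ⊛ ((β ⊖ ω) ⊛ (β ⊖ ω ⊛ ω))
    lem = solve-∀ D-solver

  private
    -- The branching of `χ` with its four decisions abstracted, so that they can be matched on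
    -- without unfolding the decision procedures.
    choose : ∀ {P₀ P₁ P₂ P₃ : Set} (d₀ : Dec P₀) (d₁ : Dec P₁) (d₂ : Dec P₂) (d₃ : Dec P₃) →
      D
    choose d₀ d₁ d₂ d₃ = if does d₀ then 0D
      else if does d₁ then 1D else if does d₂ then ω else if does d₃ then ω ^ 2 else 0D

    choose-zero : ∀ {P₀ P₁ P₂ P₃ : Set} (d₀ : Dec P₀) (d₁ : Dec P₁) (d₂ : Dec P₂) (d₃ : Dec P₃) →
      P₀ → choose d₀ d₁ d₂ d₃ ≡ 0D
    choose-zero (yes _) _ _ _ _ = refl
    choose-zero (no ¬p) _ _ _ p = contradiction p ¬p

    choose-spec : ∀ {γ β} {P₀ : Set} (d₀ : Dec P₀) (d₁ : Dec (β ≡ 1D [mod γ ]))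
      (d₂ : Dec (β ≡ ω [mod γ ])) (d₃ : Dec (β ≡ ω ^ 2 [mod γ ])) → ¬ P₀ →
      (β ≡ 1D [mod γ ]) ⊎ (β ≡ ω [mod γ ]) ⊎ (β ≡ ω ^ 2 [mod γ ]) →
      μ₃ (choose d₀ d₁ d₂ d₃) × β ≈[ γ ] choose d₀ d₁ d₂ d₃
    choose-spec (yes p) _ _ _ ¬p _ = contradiction p ¬p
    choose-spec (no _) (yes e) _ _ _ _ = μ1 , difference∣ e
    choose-spec (no _) (no _) (yes e) _ _ _ = μω , difference∣ e
    choose-spec (no _) (no _) (no _) (yes e) _ _ = μω² , difference∣ e
    choose-spec (no _) (no ¬1) (no ¬2) (no ¬3) _ (inj₁ e) = contradiction e ¬1
    choose-spec (no _) (no ¬1) (no ¬2) (no ¬3) _ (inj₂ (inj₁ e)) = contradiction e ¬2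
    choose-spec (no _) (no ¬1) (no ¬2) (no ¬3) _ (inj₂ (inj₂ e)) = contradiction e ¬3

    spec : ∀ {α} → π ∤ α → μ₃ (χ π α) × α ^ ((∣ norm π ∣ ℕ.∸ 1) ℕ./ 3) ≈[ π ] χ π α
    spec {α} π∤α = choose-spec (π ∣? α) (_≡_[mod_]? β 1D π) (_≡_[mod_]? β ω π) (_≡_[mod_]? β (ω ^ 2) π) π∤α
      (cube-roots β (subst (λ x → x ≈[ π ] 1D) (sym β³) (cancel-power (k ℕ.* 3) π∤α (fermat α))))
      where
      β : D
      β = α ^ ((∣ norm π ∣ ℕ.∸ 1) ℕ./ 3)
      β³ : β ⊛ (β ⊛ β) ≡ α ^ (k ℕ.* 3)
      β³ = trans (cong (λ x → β ⊛ (β ⊛ x)) (sym (𝔻.*-identityʳ β)))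
             (trans (^-assocʳ α ((∣ norm π ∣ ℕ.∸ 1) ℕ./ 3) 3) (cong (λ n → α ^ (n ℕ.* 3)) k′≡k))

  χ-μ₃ : ∀ {α} → π ∤ α → μ₃ (χ π α)
  χ-μ₃ π∤α = proj₁ (spec π∤α)

  χ-zero : ∀ {α} → π ∣ α → χ π α ≡ 0D
  χ-zero {α} π∣α = choose-zero (π ∣? α) (_≡_[mod_]? β 1D π) (_≡_[mod_]? β ω π) (_≡_[mod_]? β (ω ^ 2) π) π∣α
    where
    β : D
    β = α ^ ((∣ norm π ∣ ℕ.∸ 1) ℕ./ 3)

  k≢0 : ℕ.NonZero k
  k≢0 = ℕ.≢-nonZero λ k≡0 → π∤1 (subst (λ m → π ∣ fromℤ m)
    (trans (sym (norm-nonNeg π)) (trans (cong +_ norm≡) (cong (λ k → + suc (k ℕ.* 3)) k≡0))) (∣fromℤ-norm π))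

  χ-≈ : ∀ α → α ^ k ≈[ π ] χ π α
  χ-≈ α = go (π ∣? α)
    where
    ^≈0 : ∀ n → ℕ.NonZero n → π ∣ α → α ^ n ≈[ π ] 0D
    ^≈0 (suc n) _ π∣α = ∣⇒≈0 (∣-⊛ʳ (α ^ n) π∣α)
    go : Dec (π ∣ α) → α ^ k ≈[ π ] χ π α
    go (no π∤α)  = subst (λ n → α ^ n ≈[ π ] χ π α) k′≡k (proj₂ (spec π∤α))
    go (yes π∣α) = subst (α ^ k ≈[ π ]_) (sym (χ-zero π∣α)) (^≈0 k k≢0 π∣α)

  χ-determined : ∀ {α u} → π ∤ α → μ₃ u → α ^ k ≈[ π ] u → χ π α ≡ u
  χ-determined {α} π∤α μu e = μ₃-unique π∤1-ω (χ-μ₃ π∤α) μu (≈-trans (≈-sym (χ-≈ α)) e)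

  χ-cong : ∀ {α β} → α ≈[ π ] β → χ π α ≡ χ π β
  χ-cong {α} {β} e = go (π ∣? α)
    where
    go : Dec (π ∣ α) → χ π α ≡ χ π β
    go (yes π∣α) = trans (χ-zero π∣α) (sym (χ-zero (≈0⇒∣ (≈-trans (≈-sym e) (∣⇒≈0 π∣α)))))
    go (no  π∤α) = χ-determined π∤α (χ-μ₃ λ π∣β → π∤α (≈0⇒∣ (≈-trans e (∣⇒≈0 π∣β))))
                    (≈-trans (^-cong-mod k e) (χ-≈ β))

  χ-⊛ : ∀ α β → χ π (α ⊛ β) ≡ χ π α ⊛ χ π β
  χ-⊛ α β = go (π ∣? α) (π ∣? β)
    where
    go : Dec (π ∣ α) → Dec (π ∣ β) → χ π (α ⊛ β) ≡ χ π α ⊛ χ π β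
    go (yes π∣α) _ = trans (χ-zero (∣-⊛ʳ β π∣α)) (sym (trans (cong (_⊛ χ π β) (χ-zero π∣α)) (𝔻.zeroˡ (χ π β))))
    go (no _) (yes π∣β) = trans (χ-zero (∣-⊛ˡ α π∣β)) (sym (trans (cong (χ π α ⊛_) (χ-zero π∣β)) (𝔻.zeroʳ (χ π α))))
    go (no π∤α) (no π∤β) = χ-determined
      (λ d → [ π∤α , π∤β ]′ (split-∣ α β d)) (μ₃-⊛ (χ-μ₃ π∤α) (χ-μ₃ π∤β))
      (≈-trans (reflexive (^-distrib-* α β k)) (*-cong (χ-≈ α) (χ-≈ β)))

  χ²≡conj : ∀ α → χ π α ⊛ χ π α ≡ conj (χ π α)
  χ²≡conj α = go (π ∣? α)
    where
    go : Dec (π ∣ α) → χ π α ⊛ χ π α ≡ conj (χ π α)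
    go (yes π∣α) = trans (cong₂ _⊛_ (χ-zero π∣α) (χ-zero π∣α)) (sym (cong conj (χ-zero π∣α)))
    go (no π∤α)  = μ₃-conj (χ-μ₃ π∤α)

-- Fermat's congruence for Eisenstein integers modulo a rational prime

·1≡fromℤ : ∀ n → Multiples._×_ 𝔻.semiring n 1D ≡ fromℤ (+ n)
·1≡fromℤ zero    = refl
·1≡fromℤ (suc n) = cong (1D ⊕_) (·1≡fromℤ n)

·1-quotient : ∀ γ n → Multiples._×_ (CommutativeRing.semiring (D/ γ)) n 1D ≡ fromℤ (+ n)
·1-quotient γ zero    = refl
·1-quotient γ (suc n) = cong (1D ⊕_) (·1-quotient γ n)

·1≈0 : ∀ {γ} n → γ ∣ fromℤ (+ n) →
  Multiples._×_ (CommutativeRing.semiring (D/ γ)) n 1D ≈[ γ ] 0D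
·1≈0 {γ} n d = subst (λ x → x ≈[ γ ] 0D) (sym (·1-quotient γ n)) (∣⇒≈0 d)

decompose : ∀ α → α ≡ fromℤ (re α) ⊕ fromℤ (im α) ⊛ ω
decompose (a +ω b) = cong₂ _+ω_ (lem₁ a b) (lem₂ b)
  where
  lem₁ : ∀ a b → a ≡ a ℤ.+ (b ℤ.* 0ℤ ℤ.- 0ℤ ℤ.* 1ℤ)
  lem₁ = ℤ.solve-∀
  lem₂ : ∀ b → b ≡ 0ℤ ℤ.+ (b ℤ.* 1ℤ ℤ.+ 0ℤ ℤ.* 0ℤ ℤ.- 0ℤ ℤ.* 1ℤ)
  lem₂ = ℤ.solve-∀

decompose-conj : ∀ α → conj α ≡ fromℤ (re α) ⊕ fromℤ (im α) ⊛ ω ^ 2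
decompose-conj (a +ω b) = cong₂ _+ω_ (lem₁ a b) (lem₂ b)
  where
  lem₁ : ∀ a b → a ℤ.- b ≡ a ℤ.+ (b ℤ.* ℤ.-1ℤ ℤ.- 0ℤ ℤ.* ℤ.-1ℤ)
  lem₁ = ℤ.solve-∀
  lem₂ : ∀ b → ℤ.- b ≡ 0ℤ ℤ.+ (b ℤ.* ℤ.-1ℤ ℤ.+ 0ℤ ℤ.* ℤ.-1ℤ ℤ.- 0ℤ ℤ.* ℤ.-1ℤ)
  lem₂ = ℤ.solve-∀

ω^[3j] : ∀ j → ω ^ (j ℕ.* 3) ≡ 1D
ω^[3j] j = trans (cong (ω ^_) (ℕ.*-comm j 3)) (trans (sym (^-assocʳ ω 3 j)) (1^ j))

conj-involutive : ∀ α → conj (conj α) ≡ α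
conj-involutive (a +ω b) = cong₂ _+ω_ (lem a b) (ℤ.neg-involutive b)
  where
  lem : ∀ a b → (a ℤ.- b) ℤ.- (ℤ.- b) ≡ a
  lem = ℤ.solve-∀

module Characteristic {p : ℕ} (prime-p : ℕ.Prime p) where
  private
    instance
      nonZero : ℕ.NonZero p
      nonZero = ℕ.prime⇒nonZero prime-p
    open Residues p
    open Mod (fromℤ (+ p)) using (+-cong; *-cong; ≈-trans; reflexive)

  fermat-ℤ : ∀ a → fromℤ a ^ p ≈[ fromℤ (+ p) ] fromℤ a
  fermat-ℤ a = subst (λ x → x ≈[ fromℤ (+ p) ] fromℤ a) (fromℤ-^ₚ p)
    (difference∣ (fromℤ-∣ (≈ₚ⇒∣ (PrimeResidues.fermat p prime-p a))))
    where
    open Exponentiation (CommutativeRing.commutativeSemiring (ℤ/ p)) using () renaming (_^_ to _^ℤ_)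
    fromℤ-^ₚ : ∀ n → fromℤ (a ^ℤ n) ≡ fromℤ a ^ n
    fromℤ-^ₚ zero    = refl
    fromℤ-^ₚ (suc n) = trans (fromℤ-* a (a ^ℤ n)) (cong (fromℤ a ⊛_) (fromℤ-^ₚ n))

  -- Integers are fixed by Fermat, so the p-th power acts on ω alone; it is the identity or
  -- conjugation according to `p` modulo 3.
  frobenius : ∀ α → α ^ p ≈[ fromℤ (+ p) ] fromℤ (re α) ⊕ fromℤ (im α) ⊛ ω ^ p
  frobenius α = ≈-trans (reflexive (cong (_^ p) (decompose α)))
    (≈-trans (subst₂ (λ x y → x ≈[ fromℤ (+ p) ] y)
                (^-quotient γ (a ⊕ b ⊛ ω) p) (cong₂ _⊕_ (^-quotient γ a p) (^-quotient γ (b ⊛ ω) p))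
                (Frobenius.^-distrib-+ (Frobenius.prime-additive (D/ γ) prime-p (·1≈0 p (∣-refl γ))) a (b ⊛ ω)))
      (+-cong (fermat-ℤ (re α))
        (≈-trans (reflexive (^-distrib-* b ω p)) (*-cong (fermat-ℤ (im α)) (reflexive refl)))))
    where
    γ a b : D
    γ = fromℤ (+ p)
    a = fromℤ (re α)
    b = fromℤ (im α)

  fermat-split : ∀ k → p ≡ suc (k ℕ.* 3) → ∀ α → α ^ p ≈[ fromℤ (+ p) ] α
  fermat-split k p≡ α = ≈-trans (frobenius α) (reflexive (trans
    (cong (λ x → fromℤ (re α) ⊕ fromℤ (im α) ⊛ x) ω^p) (sym (decompose α))))
    where
    ω^p : ω ^ p ≡ ω
    ω^p = trans (cong (ω ^_) p≡) (cong (ω ⊛_) (ω^[3j] k))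

  fermat-inert : ∀ j → p ≡ suc (suc (j ℕ.* 3)) → ∀ α → α ^ (p ℕ.* p) ≈[ fromℤ (+ p) ] α
  fermat-inert j p≡ α = ≈-trans (reflexive (sym (^-assocʳ α p p)))
    (≈-trans (^-cong-mod p (conjugates α)) (≈-trans (conjugates (conj α)) (reflexive (conj-involutive α))))
    where
    ω^p : ω ^ p ≡ ω ^ 2
    ω^p = trans (cong (ω ^_) p≡) (cong (λ x → ω ⊛ (ω ⊛ x)) (ω^[3j] j))
    conjugates : ∀ α → α ^ p ≈[ fromℤ (+ p) ] conj α
    conjugates α = ≈-trans (frobenius α) (reflexive (trans
      (cong (λ x → fromℤ (re α) ⊕ fromℤ (im α) ⊛ x) ω^p) (sym (decompose-conj α))))

  module _ {k : ℕ} (p≡ : p ≡ suc (k ℕ.* 3)) where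

    k-nonZero : ℕ.NonZero k
    k-nonZero = ℕ.≢-nonZero λ k≡0 → ℕ.¬prime[1] (subst ℕ.Prime (trans p≡ (cong (λ k → suc (k ℕ.* 3)) k≡0)) prime-p)

    -- `k + suc k` is the degree bound that `(1 - x)^k x^k` carries, the polynomial behind the
    -- Jacobi sum. It is strictly below `1 + 3 k` because `k` is positive.
    [1+2k]<p : k ℕ.+ suc k ℕ.< p
    [1+2k]<p = subst (k ℕ.+ suc k ℕ.<_) (sym p≡) (go k k-nonZero)
      where
      go : ∀ k → ℕ.NonZero k → k ℕ.+ suc k ℕ.< suc (k ℕ.* 3)
      go (suc j) _ = begin-strict
        suc j ℕ.+ suc (suc j)              ≡⟨ lem j ⟩
        3 ℕ.+ 2 ℕ.* j                      ≤⟨ ℕ.+-monoʳ-≤ 3 (ℕ.*-monoˡ-≤ j {2} {3} (s≤s (s≤s z≤n))) ⟩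
        3 ℕ.+ 3 ℕ.* j                      <⟨ ℕ.n<1+n _ ⟩
        suc (3 ℕ.+ 3 ℕ.* j)                ≡⟨ cong (λ n → suc (3 ℕ.+ n)) (ℕ.*-comm 3 j) ⟩
        suc (suc j ℕ.* 3)                  ∎
        where
        open ℕ.≤-Reasoning
        lem : ∀ j → suc j ℕ.+ suc (suc j) ≡ 3 ℕ.+ 2 ℕ.* j
        lem = ℕ.solve-∀

    -- Otherwise the power sum over x of x^k would be p - 1 instead of 0.
    nonresidue : ∀ {π} → π ∤ 1D → π ∣ fromℤ (+ p) →
      ¬ (∀ n → .{{ℕ.NonZero n}} → n ℕ.< p → fromℤ (+ n) ^ k ≈[ π ] 1D)
    nonresidue {π} π∤1 π∣p x^k≈1 = π∤1 (≈0⇒∣ (PowerSums.power-nonconstant (D/ π) prime-p (·1≈0 p π∣p)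
      k {{k-nonZero}} (ℕ.≤-<-trans (ℕ.m≤n+m (suc k) k) [1+2k]<p)
      (λ n n<p → subst (λ x → x ≈[ π ] 1D)
        (trans (cong (_^ k) (sym (·1-quotient π n))) (sym (^-quotient π _ k))) (x^k≈1 n n<p))))

-- Primary primes

module _ {π : D} (prime-π : Prime π) (primary : Primary π) where
  private
    π∤1 : π ∤ 1D
    π∤1 = RawSemiringDefs.Prime.p∤1 prime-π

  -- A divisor of 3 would divide `π - 2`, hence 2, hence 1.
  π∤3 : π ∤ fromℤ (+ 3)
  π∤3 π∣3 = π∤1 (∣-⊕ π∣3 (∣-⊛ˡ (⊝ 1D) π∣2))
    where
    lem : ∀ α → (⊝ 1D) ⊛ (α ⊖ fromℤ (+ 2)) ⊕ α ≡ fromℤ (+ 2)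
    lem = solve-∀ D-solver
    π∣2 : π ∣ fromℤ (+ 2)
    π∣2 = subst (π ∣_) (lem π) (∣-⊕ (∣-⊛ˡ (⊝ 1D) (∣-trans π∣3 primary)) (∣-refl π))

  -- 3 is the product of `1 - ω` and `1 - ω²`.
  π∤1⊖ω : π ∤ 1D ⊖ ω
  π∤1⊖ω d = π∤3 (∣-⊛ˡ (1D ⊖ ω ^ 2) d)

  3∣re-2 : + 3 ℤ.∣ re π ℤ.- + 2
  3∣re-2 = fromℤ∣⇒∣re primary

  3∣im : + 3 ℤ.∣ im π
  3∣im = subst (+ 3 ℤ.∣_) (ℤ.+-identityʳ (im π)) (fromℤ∣⇒∣im primary)

  re≡2+3c : Σ ℤ λ c → re π ≡ c ℤ.* + 3 ℤ.+ + 2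
  re≡2+3c = case 3∣re-2 of λ { (ℤ.divides c e) → c , trans (lem (re π)) (cong (ℤ._+ + 2) e) }
    where
    lem : ∀ x → x ≡ (x ℤ.- + 2) ℤ.+ + 2
    lem = ℤ.solve-∀

  norm≡1+3k : Σ ℕ λ k → ∣ norm π ∣ ≡ suc (k ℕ.* 3)
  norm≡1+3k = case re≡2+3c of λ { (c , re≡) → case 3∣im of λ { (ℤ.divides d im≡) →
    case expand π c d re≡ im≡ of λ { (e , norm≡) → go ∣ norm π ∣ e (trans (norm-nonNeg π) norm≡) } } }
    where
    lem : ∀ c d → (c ℤ.* + 3 ℤ.+ + 2) ℤ.* (c ℤ.* + 3 ℤ.+ + 2) ℤ.- (c ℤ.* + 3 ℤ.+ + 2) ℤ.* (d ℤ.* + 3) ℤ.+ (d ℤ.* + 3) ℤ.* (d ℤ.* + 3)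
      ≡ 1ℤ ℤ.+ (+ 3 ℤ.* (c ℤ.* c) ℤ.+ + 4 ℤ.* c ℤ.+ 1ℤ ℤ.- + 3 ℤ.* (c ℤ.* d) ℤ.- + 2 ℤ.* d ℤ.+ + 3 ℤ.* (d ℤ.* d)) ℤ.* + 3
    lem = ℤ.solve-∀

    expand : ∀ α c d → re α ≡ c ℤ.* + 3 ℤ.+ + 2 → im α ≡ d ℤ.* + 3 →
      Σ ℤ λ e → norm α ≡ 1ℤ ℤ.+ e ℤ.* + 3
    expand (a +ω b) c d refl refl =
      + 3 ℤ.* (c ℤ.* c) ℤ.+ + 4 ℤ.* c ℤ.+ 1ℤ ℤ.- + 3 ℤ.* (c ℤ.* d) ℤ.- + 2 ℤ.* d ℤ.+ + 3 ℤ.* (d ℤ.* d) , lem c d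

    go : ∀ n e → + n ≡ 1ℤ ℤ.+ e ℤ.* + 3 → Σ ℕ λ k → n ≡ suc (k ℕ.* 3)
    go n (+ k)      eq = k , ℤ.+-injective (trans eq (cong (λ x → 1ℤ ℤ.+ x) (sym (ℤ.pos-* k 3))))
    go n ℤ.-[1+ k ] ()

  re≡q⇒q≡2+3j : ∀ {q} → re π ≡ + q → Σ ℕ λ j → q ≡ suc (suc (j ℕ.* 3))
  re≡q⇒q≡2+3j {q} re≡q = go (proj₁ re≡2+3c) (trans (sym re≡q) (proj₂ re≡2+3c))
    where
    go : ∀ c → + q ≡ c ℤ.* + 3 ℤ.+ + 2 → Σ ℕ λ j → q ≡ suc (suc (j ℕ.* 3))
    go (+ j)      e = j , ℤ.+-injective (trans e (trans (cong (ℤ._+ + 2) (sym (ℤ.pos-* j 3))) (cong +_ (ℕ.+-comm (j ℕ.* 3) 2))))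
    go ℤ.-[1+ j ] ()

  re≡-p⇒p≡1+3k : ∀ {p} → .{{ℕ.NonZero p}} → re π ≡ ℤ.- + p → Σ ℕ λ k → p ≡ suc (k ℕ.* 3)
  re≡-p⇒p≡1+3k {suc p} re≡-p = go (proj₁ re≡2+3c) (trans (sym re≡-p) (proj₂ re≡2+3c))
    where
    go : ∀ c → ℤ.-[1+ p ] ≡ c ℤ.* + 3 ℤ.+ + 2 → Σ ℕ λ k → suc p ≡ suc (k ℕ.* 3)
    go (+ j)      e = case trans e (cong (ℤ._+ + 2) (sym (ℤ.pos-* j 3))) of λ ()
    go ℤ.-[1+ j ] e = j , cong suc (ℤ.-[1+-injective e)

  -- Being primary fixes the associate: an inert `π` is the positive rational prime itself and not
  -- merely a unit multiple of it.
  data Classification : Set where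
    split : ∀ {p} k → ℕ.Prime p → p ≡ suc (k ℕ.* 3) → norm π ≡ + p → Classification
    inert : ∀ {q} j → ℕ.Prime q → q ≡ suc (suc (j ℕ.* 3)) → π ≡ fromℤ (+ q) → Classification

  π∣norm : π ∣ fromℤ (+ ∣ norm π ∣)
  π∣norm = subst (λ n → π ∣ fromℤ n) (sym (norm-nonNeg π)) (∣fromℤ-norm π)

  prime-below : Σ ℕ λ p → ℕ.Prime p × π ∣ fromℤ (+ p)
  prime-below = go (factors f) (factorsPrime f) (subst (λ n → π ∣ fromℤ (+ n)) (isFactorisation f) π∣norm)
    where
    open PrimeFactorisation
    f : PrimeFactorisation ∣ norm π ∣
    f = factorise ∣ norm π ∣ {{subst ℕ.NonZero (sym (proj₂ norm≡1+3k)) _}}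

    go : ∀ ps → All ℕ.Prime ps → π ∣ fromℤ (+ product ps) → Σ ℕ λ p → ℕ.Prime p × π ∣ fromℤ (+ p)
    go []       []            d = contradiction d π∤1
    go (p ∷ ps) (pp ∷ all) d = [ (λ π∣p → p , pp , π∣p) , go ps all ]′
      (RawSemiringDefs.Prime.split-∣ prime-π
        (subst (π ∣_) (trans (cong fromℤ (ℤ.pos-* p (product ps))) (fromℤ-* (+ p) (+ product ps))) d))

  -- If `p` divided `π`, every multiple of `π` would have its second coordinate divisible by `p`.
  -- For rational `n` below `p` the power `n^k` is modulo `π` a cube root of unity, but `n^k - ω`
  -- and `n^k - ω²` have second coordinates `-1` and 1. So all these powers would be 1, against the
  -- existence of a nonresidue.
  no-inert-1-mod-3 : ∀ {p} k → ℕ.Prime p → p ≡ suc (k ℕ.* 3) → π ∣ fromℤ (+ p) → ¬ fromℤ (+ p) ∣ π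
  no-inert-1-mod-3 {p} k prime-p p≡ π∣p p∣π =
    Characteristic.nonresidue prime-p {k} p≡ π∤1 π∣p λ n n<p → power≡1 n n<p
    where
    split-∣ : ∀ α β → π ∣ α ⊛ β → (π ∣ α) ⊎ (π ∣ β)
    split-∣ α β = RawSemiringDefs.Prime.split-∣ prime-π

    p∤unit : ∀ {x} → ∣ x ∣ ≡ 1 → ¬ + p ℤ.∣ x
    p∤unit ∣x∣≡1 d = ℕ.¬prime[1] (subst ℕ.Prime (ℕ.∣1⇒≡1 (subst (p ℕ.∣_) ∣x∣≡1 (ℤ.∣⇒∣ᵤ d))) prime-p)

    p∣im : ∀ {α} → π ∣ α → + p ℤ.∣ im α
    p∣im d = fromℤ∣⇒∣im (∣-trans p∣π d)

    power≡1 : ∀ n → .{{ℕ.NonZero n}} → n ℕ.< p → fromℤ (+ n) ^ k ≈[ π ] 1D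
    power≡1 n n<p = [ difference∣ , (λ d → ⊥-elim ([ no-ω , no-ω² ]′ (split-∣ (x ⊖ ω) (x ⊖ ω ^ 2) d))) ]′
      (split-∣ (x ⊖ 1D) _ (subst (π ∣_) (lem x) cube))
      where
      x : D
      x = fromℤ (+ n) ^ k

      lem : ∀ β → β ⊛ (β ⊛ (β ⊛ 1D)) ⊖ 1D ≡ (β ⊖ 1D) ⊛ ((β ⊖ ω) ⊛ (β ⊖ ω ⊛ ω))
      lem = solve-∀ D-solver

      lem₂ : ∀ α β → α ⊛ β ⊖ α ≡ α ⊛ (β ⊖ 1D)
      lem₂ = solve-∀ D-solver

      im-x : im x ≡ 0ℤ
      im-x = cong im (sym (fromℤ-^ (+ n) k))

      no-ω : π ∤ x ⊖ ω
      no-ω d = p∤unit (cong (λ y → ∣ y ℤ.- 1ℤ ∣) im-x) (p∣im d)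

      no-ω² : π ∤ x ⊖ ω ^ 2
      no-ω² d = p∤unit (cong (λ y → ∣ y ℤ.- ℤ.-1ℤ ∣) im-x) (p∣im d)

      π∤n : π ∤ fromℤ (+ n)
      π∤n d = ℕ.<⇒≱ n<p (ℕ.∣⇒≤ (ℤ.∣⇒∣ᵤ (fromℤ∣⇒∣re (∣-trans p∣π d))))

      cube : π ∣ x ^ 3 ⊖ 1D
      cube = subst (λ y → π ∣ y ⊖ 1D) (sym (^-assocʳ (fromℤ (+ n)) k 3))
        ([ (λ d → contradiction d π∤n) , id ]′
          (split-∣ (fromℤ (+ n)) _ (subst (π ∣_)
            (trans (cong (λ m → fromℤ (+ n) ^ m ⊖ fromℤ (+ n)) p≡) (lem₂ (fromℤ (+ n)) (fromℤ (+ n) ^ (k ℕ.* 3))))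
            (∣-trans π∣p (Quotient.difference (Characteristic.fermat-ℤ prime-p (+ n)))))))

  ∣p*p : ∀ {p n} → ℕ.Prime p → n ℕ.∣ p ℕ.* p → n ≡ 1 ⊎ n ≡ p ⊎ n ≡ p ℕ.* p
  ∣p*p {p} {n} prime-p (ℕ.divides m p*p≡m*n) =
    [ left , right ]′ (ℕ.euclidsLemma m n prime-p (subst (p ℕ.∣_) p*p≡m*n (ℕ.m∣m*n p)))
    where
    instance _ = ℕ.prime⇒nonZero prime-p
    left : p ℕ.∣ m → n ≡ 1 ⊎ n ≡ p ⊎ n ≡ p ℕ.* p
    left (ℕ.divides l m≡l*p) = [ inj₁ , inj₂ ∘ inj₁ ]′ (ℕ.prime⇒irreducible prime-p (ℕ.divides l
      (ℕ.*-cancelˡ-≡ p (l ℕ.* n) p (trans p*p≡m*n (trans (cong (ℕ._* n) m≡l*p) (lem l p n))))))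
      where
      lem : ∀ l p n → l ℕ.* p ℕ.* n ≡ p ℕ.* (l ℕ.* n)
      lem = ℕ.solve-∀
    right : p ℕ.∣ n → n ≡ 1 ⊎ n ≡ p ⊎ n ≡ p ℕ.* p
    right (ℕ.divides l n≡l*p) = inj₂ ([ (λ l≡1 → inj₁ (trans n≡l*p (trans (cong (ℕ._* p) l≡1) (ℕ.*-identityˡ p))))
                                      , (λ l≡p → inj₂ (trans n≡l*p (cong (ℕ._* p) l≡p))) ]′
      (ℕ.prime⇒irreducible prime-p (ℕ.divides m
        (ℕ.*-cancelʳ-≡ p (m ℕ.* l) p (trans p*p≡m*n (trans (cong (m ℕ.*_) n≡l*p) (sym (ℕ.*-assoc m l p))))))))

  private
    module _ {p} (prime-p : ℕ.Prime p) (π∣p : π ∣ fromℤ (+ p)) (N≡p² : ∣ norm π ∣ ≡ p ℕ.* p) where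
      instance _ = ℕ.prime⇒nonZero prime-p

      κ : D
      κ = Divides._∣ʳ_.quotient π∣p

      κπ≡p : κ ⊛ π ≡ fromℤ (+ p)
      κπ≡p = Divides._∣ʳ_.equality π∣p

      -- Here `κ ⊛ π` is `p` and `conj π ⊛ π` is `p²`; cancelling `π` shows that `π` is `p` times
      -- `conj κ`, which will turn out to be a unit.
      conj-π : conj π ≡ fromℤ (+ p) ⊛ κ
      conj-π = ⊛-cancelʳ _ _ π (RawSemiringDefs.Prime.p≉0 prime-π) (begin
        conj π ⊛ π                     ≡⟨ 𝔻.*-comm (conj π) π ⟩
        π ⊛ conj π                     ≡⟨ ⊛-conj π ⟩
        fromℤ (norm π)                 ≡⟨ cong fromℤ (norm-nonNeg π) ⟨
        fromℤ (+ ∣ norm π ∣)           ≡⟨ cong (λ n → fromℤ (+ n)) N≡p² ⟩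
        fromℤ (+ (p ℕ.* p))            ≡⟨ cong fromℤ (ℤ.pos-* p p) ⟩
        fromℤ (+ p ℤ.* + p)            ≡⟨ fromℤ-* (+ p) (+ p) ⟩
        fromℤ (+ p) ⊛ fromℤ (+ p)      ≡⟨ cong (fromℤ (+ p) ⊛_) κπ≡p ⟨
        fromℤ (+ p) ⊛ (κ ⊛ π)          ≡⟨ 𝔻.*-assoc (fromℤ (+ p)) κ π ⟨
        (fromℤ (+ p) ⊛ κ) ⊛ π          ∎)
        where open ≡-Reasoning

      u : D
      u = conj κ

      π≡u*p : π ≡ (re u ℤ.* + p) +ω (im u ℤ.* + p)
      π≡u*p = begin
        π                            ≡⟨ conj-involutive π ⟨
        conj (conj π)                ≡⟨ cong conj conj-π ⟩
        conj (fromℤ (+ p) ⊛ κ)       ≡⟨ cong conj (𝔻.*-comm (fromℤ (+ p)) κ) ⟩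
        conj (κ ⊛ fromℤ (+ p))       ≡⟨ conj-⊛ κ (fromℤ (+ p)) ⟩
        u ⊛ conj (fromℤ (+ p))       ≡⟨ cong (λ x → u ⊛ (x +ω 0ℤ)) (ℤ.+-identityʳ (+ p)) ⟩
        u ⊛ fromℤ (+ p)              ≡⟨ ⊛-fromℤ u (+ p) ⟩
        (re u ℤ.* + p) +ω (im u ℤ.* + p) ∎
        where open ≡-Reasoning

      norm-u : norm u ≡ 1ℤ
      norm-u = trans (norm-conj κ) (trans (sym (norm-nonNeg κ)) (cong +_
        (ℕ.*-cancelʳ-≡ ∣ norm κ ∣ 1 (p ℕ.* p) {{ℕ.m*n≢0 p p}} (begin
          ∣ norm κ ∣ ℕ.* (p ℕ.* p)       ≡⟨ cong (∣ norm κ ∣ ℕ.*_) N≡p² ⟨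
          ∣ norm κ ∣ ℕ.* ∣ norm π ∣      ≡⟨ ∣norm∣-⊛ κ π ⟨
          ∣ norm (κ ⊛ π) ∣               ≡⟨ cong (∣_∣ ∘ norm) κπ≡p ⟩
          ∣ norm (fromℤ (+ p)) ∣         ≡⟨ ∣norm∣-fromℤ (+ p) ⟩
          p ℕ.* p                        ≡⟨ ℕ.*-identityˡ (p ℕ.* p) ⟨
          1 ℕ.* (p ℕ.* p)                ∎))))
        where open ≡-Reasoning

      3∤p : ¬ + 3 ℤ.∣ + p
      3∤p 3∣p = ℕ.<⇒≱ (s≤s (s≤s (s≤s z≤n))) (ℕ.∣⇒≤ (ℤ.∣⇒∣ᵤ (ℤ.∣m+n∣m⇒∣n {+ 3} {re π} {ℤ.- + 2} 3∣re-2
        (subst (+ 3 ℤ.∣_) (sym (cong re π≡u*p)) (ℤ.∣n⇒∣m*n (re u) 3∣p)))))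

      im-u : im u ≡ 0ℤ
      im-u = norm≡1∧3∣im⇒im≡0 u norm-u ([ (λ d → ℤ.∣ᵤ⇒∣ d) , (λ d → contradiction (ℤ.∣ᵤ⇒∣ d) 3∤p) ]′
        (ℕ.euclidsLemma ∣ im u ∣ p (toWitness {a? = ℕ.prime? 3} _)
          (subst (3 ℕ.∣_) (ℤ.abs-* (im u) (+ p)) (ℤ.∣⇒∣ᵤ (subst (+ 3 ℤ.∣_) (cong im π≡u*p) 3∣im)))))

      ∣re-u∣ : ∣ re u ∣ ≡ 1
      ∣re-u∣ = ∣re∣≡1 u norm-u im-u

      re-π : ∀ {x} → re u ≡ x → re π ≡ x ℤ.* + p
      re-π e = trans (cong re π≡u*p) (cong (ℤ._* + p) e)

      im-π : im π ≡ 0ℤ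
      im-π = trans (cong im π≡u*p) (cong (ℤ._* + p) im-u)

      -- The unit `u` is rational by the primary condition. For `u = 1` the prime is inert and
      -- congruent to 2 modulo 3; for `u = -1` it would be `-p` with `p` congruent to 1, which
      -- `no-inert-1-mod-3` excludes.
      classify-p² : ∀ x → re u ≡ x → ∣ x ∣ ≡ 1 → Classification
      classify-p² (+ 1)      re-u refl =
        inert (proj₁ (re≡q⇒q≡2+3j re≡p)) prime-p (proj₂ (re≡q⇒q≡2+3j re≡p)) (cong₂ _+ω_ re≡p im-π)
        where
        re≡p : re π ≡ + p
        re≡p = trans (re-π re-u) (ℤ.*-identityˡ (+ p))
      classify-p² ℤ.-[1+ 0 ] re-u refl =
        ⊥-elim (no-inert-1-mod-3 (proj₁ (re≡-p⇒p≡1+3k re≡-p)) prime-p (proj₂ (re≡-p⇒p≡1+3k re≡-p)) π∣p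
          (u Divides., trans (⊛-fromℤ u (+ p)) (sym π≡u*p)))
        where
        re≡-p : re π ≡ ℤ.- + p
        re≡-p = trans (re-π re-u) (ℤ.-1*i≡-i (+ p))

  classify : Classification
  classify = case prime-below of λ { (p , prime-p , π∣p) →
    [ (λ N≡1 → contradiction (subst (λ n → π ∣ fromℤ (+ n)) N≡1 π∣norm) π∤1)
    , [ (λ N≡p → split (proj₁ norm≡1+3k) prime-p (trans (sym N≡p) (proj₂ norm≡1+3k)) (trans (sym (norm-nonNeg π)) (cong +_ N≡p)))
      , (λ N≡p² → classify-p² prime-p π∣p N≡p² _ refl (∣re-u∣ prime-p π∣p N≡p²)) ]′ ]′
    (∣p*p prime-p (subst (∣ norm π ∣ ℕ.∣_)
      (∣norm∣-fromℤ (+ p)) (∣⇒∣norm∣ π∣p))) }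

  cubicModulus : Classification → CubicModulus π
  cubicModulus (split {p} k prime-p p≡ norm≡p) = record
    { prime  = prime-π
    ; k      = k
    ; norm≡  = trans (cong ∣_∣ norm≡p) p≡
    ; π∤1-ω  = π∤1⊖ω
    ; fermat = λ α → subst (λ n → α ^ n ≈[ π ] α) p≡
        (≈-∣ (subst (λ n → π ∣ fromℤ n) norm≡p (∣fromℤ-norm π)) (Characteristic.fermat-split prime-p k p≡ α)) }
  cubicModulus (inert {q} j prime-q q≡ π≡q) = record
    { prime  = prime-π
    ; k      = k
    ; norm≡  = trans (cong (∣_∣ ∘ norm) π≡q) (trans (∣norm∣-fromℤ (+ q)) q*q≡)
    ; π∤1-ω  = π∤1⊖ω
    ; fermat = λ α → subst₂ (λ n γ → α ^ n ≈[ γ ] α) q*q≡ (sym π≡q) (Characteristic.fermat-inert prime-q j q≡ α) }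
    where
    k : ℕ
    -- This is `(q² - 1)/3` for `q = 2 + 3 j`.
    k = 1 ℕ.+ 4 ℕ.* j ℕ.+ 3 ℕ.* (j ℕ.* j)
    lem : ∀ j → (2 ℕ.+ j ℕ.* 3) ℕ.* (2 ℕ.+ j ℕ.* 3) ≡ 1 ℕ.+ (1 ℕ.+ 4 ℕ.* j ℕ.+ 3 ℕ.* (j ℕ.* j)) ℕ.* 3
    lem = ℕ.solve-∀
    q*q≡ : q ℕ.* q ≡ suc (k ℕ.* 3)
    q*q≡ = trans (cong (λ n → n ℕ.* n) q≡) (lem j)

-- The Jacobi sum at a prime whose norm is a rational prime

module SplitPrime {π : D} (cm : CubicModulus π) (primary : Primary π)
  {p : ℕ} (prime-p : ℕ.Prime p) (norm≡p : norm π ≡ + p) where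
  open CubicModulus cm
  open CubicResidue cm

  private
    instance
      nonZero : ℕ.NonZero p
      nonZero = ℕ.prime⇒nonZero prime-p

    module R = Residues p
    module F = PrimeResidues p prime-p
    module S = ResidueSum D-commutativeRing p
    module G = GaussSum D-commutativeRing p prime-p
    module 𝔾 (γ : D) = GaussSum (D/ γ) p prime-p
    open R using (_≈ₚ_)

  p≡1+3k : p ≡ suc (k ℕ.* 3)
  p≡1+3k = trans (sym (cong ∣_∣ norm≡p)) norm≡

  π∣p : π ∣ fromℤ (+ p)
  π∣p = subst (λ n → π ∣ fromℤ n) norm≡p (∣fromℤ-norm π)

  ≈ₚ⇒≈π : ∀ {x y} → x ≈ₚ y → fromℤ x ≈[ π ] fromℤ y
  ≈ₚ⇒≈π e = difference∣ (∣-trans π∣p (fromℤ-∣ (R.≈ₚ⇒∣ e)))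

  π∣n⇒n≈0 : ∀ {n} → π ∣ fromℤ n → n ≈ₚ 0ℤ
  π∣n⇒n≈0 {n} d = reduce (F.euclid n n (F.∣⇒≈0 (ℤ.∣ᵤ⇒∣ (subst₂ ℕ._∣_
    (cong ∣_∣ norm≡p) (cong ∣_∣ (norm-fromℤ n)) (∣⇒∣norm∣ d)))))

  χℤ : ℤ → D
  χℤ n = χ π (fromℤ n)

  χℤ-cong : ∀ {x y} → x ≈ₚ y → χℤ x ≡ χℤ y
  χℤ-cong e = χ-cong (≈ₚ⇒≈π e)

  χℤ-* : ∀ x y → χℤ (x ℤ.* y) ≡ χℤ x ⊛ χℤ y
  χℤ-* x y = trans (cong (χ π) (fromℤ-* x y)) (χ-⊛ (fromℤ x) (fromℤ y))

  χℤ-0 : χℤ 0ℤ ≡ 0D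
  χℤ-0 = χ-zero (0D Divides., 𝔻.zeroˡ π)

  χℤ-cube : ∀ {x} → ¬ x ≈ₚ 0ℤ → χℤ x ⊛ (χℤ x ⊛ χℤ x) ≡ 1D
  χℤ-cube x≉0 = μ₃-cube (χ-μ₃ λ d → x≉0 (π∣n⇒n≈0 d))

  -- Scaling the summation variable by `n` multiplies the sum by `χℤ n` and leaves it unchanged. If
  -- the sum were not 0 it could be cancelled, and every character value on a nonzero residue would
  -- be 1, against the existence of a nonresidue.
  ∑χℤ≡0 : S.∑ χℤ ≡ 0D
  ∑χℤ≡0 = case S.∑ χℤ ≟ 0D of λ
    { (yes S≡0) → S≡0
    ; (no  S≢0) → ⊥-elim (Characteristic.nonresidue prime-p {k} p≡1+3k π∤1 π∣p λ n n<p →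
        subst (fromℤ (+ n) ^ k ≈[ π ]_) (χ≡1 S≢0 n n<p) (χ-≈ (fromℤ (+ n)))) }
    where
    n≉0 : ∀ n → .{{ℕ.NonZero n}} → n ℕ.< p → ¬ + n ≈ₚ 0ℤ
    n≉0 n n<p e = ℕ.<⇒≱ n<p (ℕ.∣⇒≤ (ℤ.∣⇒∣ᵤ (F.≈0⇒∣ e)))

    χ≡1 : S.∑ χℤ ≢ 0D → ∀ n → .{{ℕ.NonZero n}} → n ℕ.< p → χℤ (+ n) ≡ 1D
    χ≡1 S≢0 n n<p = ⊛-cancelʳ _ _ (S.∑ χℤ) S≢0 (begin
      χℤ (+ n) ⊛ S.∑ χℤ                   ≡⟨ S.∑-*ˡ (χℤ (+ n)) χℤ ⟩
      S.∑ (λ x → χℤ (+ n) ⊛ χℤ x)         ≡⟨ S.∑-cong (λ x → χℤ-* (+ n) x) ⟨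
      S.∑ (λ x → χℤ (+ n ℤ.* x))          ≡⟨ S.∑-scale {χℤ} χℤ-cong (+ n) (F.inv (+ n)) (F.*-inv (n≉0 n n<p)) ⟩
      S.∑ χℤ                              ≡⟨ 𝔻.*-identityˡ (S.∑ χℤ) ⟨
      1D ⊛ S.∑ χℤ                         ∎)
      where open ≡-Reasoning

  opaque
    unfolding ResidueSum.∑

    conj-∑ : ∀ f → conj (S.∑ f) ≡ S.∑ (λ x → conj (f x))
    conj-∑ f = go (λ i → f (R.rep i))
      where
      open Sums 𝔻.semiring using (sum)
      go : ∀ {n} (f : Fin n → D) → conj (sum f) ≡ sum (λ i → conj (f i))
      go {zero}  f = refl
      go {suc n} f = trans (conj-⊕ (f zero) _) (cong (conj (f zero) ⊕_) (go (f ∘ suc)))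

    ∑-quotient : ∀ γ f → ResidueSum.∑ (D/ γ) p f ≡ S.∑ f
    ∑-quotient γ f = refl

    ∑-polynomial : ∀ {γ f} {g : D → D} d → γ ∣ fromℤ (+ p) → d ℕ.< p → PowerSums.Deg< (D/ γ) d g →
      (∀ n → f (+ n) ≈[ γ ] g (fromℤ (+ n))) → S.∑ f ≈[ γ ] 0D
    ∑-polynomial {γ} {f} {g} d γ∣p d<p dg e = Mod.≈-trans γ
      (sum-cong-≋ {p} (λ i → subst (λ x → f (+ toℕ i) ≈[ γ ] g x) (sym (·1-quotient γ (toℕ i))) (e (toℕ i))))
      (PowerSums.sum-polynomial (D/ γ) prime-p (·1≈0 p γ∣p) d g d<p dg)
      where open Sums (CommutativeRing.semiring (D/ γ)) using (sum-cong-≋)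

  ∑χℤ²≡0 : S.∑ (λ x → χℤ x ⊛ χℤ x) ≡ 0D
  ∑χℤ²≡0 = trans (S.∑-cong (λ x → χ²≡conj (fromℤ x))) (trans (sym (conj-∑ χℤ)) (cong conj ∑χℤ≡0))

  isCubicCharacter : G.IsCubicCharacter χℤ
  isCubicCharacter = record
    { multiplicative = record { cong-φ = χℤ-cong ; homo = χℤ-* ; at-0 = χℤ-0 }
    ; cube = χℤ-cube ; ∑χ≈0 = ∑χℤ≡0 ; ∑χ²≈0 = ∑χℤ²≡0 }

  isCubicCharacter-mod : ∀ γ → 𝔾.IsCubicCharacter γ χℤ
  isCubicCharacter-mod γ = record
    { multiplicative = record
      { cong-φ = λ e → reflexive (χℤ-cong e) ; homo = λ x y → reflexive (χℤ-* x y) ; at-0 = reflexive χℤ-0 }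
    ; cube  = λ x≉0 → reflexive (χℤ-cube x≉0)
    ; ∑χ≈0  = reflexive (trans (∑-quotient γ χℤ) ∑χℤ≡0)
    ; ∑χ²≈0 = reflexive (trans (∑-quotient γ (λ x → χℤ x ⊛ χℤ x)) ∑χℤ²≡0) }
    where open Mod γ using (reflexive)

  J : D
  J = S.∑ (λ u → χℤ u ⊛ χℤ (1ℤ ℤ.- u))

  -- Modulo `π` the summand is `u^k (1 - u)^k`, of degree `2 k`, and `p - 1` is `3 k`.
  π∣J : π ∣ J
  π∣J = ≈0⇒∣ (∑-polynomial (k ℕ.+ suc k) π∣p (Characteristic.[1+2k]<p prime-p p≡1+3k)
    (PowerSums.Deg<-[1-x]^*x^ (D/ π) k k) λ n → ≈-trans
      (*-cong {χℤ (+ n)} {pow (+ n)} {χℤ (1ℤ ℤ.- + n)} {pow (1ℤ ℤ.- + n)} (χ≈pow (+ n)) (χ≈pow (1ℤ ℤ.- + n)))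
      (reflexive (𝔻.*-comm (pow (+ n)) (pow (1ℤ ℤ.- + n)))))
    where
    open Mod π using (≈-trans; ≈-sym; *-cong; reflexive)
    pow : ℤ → D
    pow n = RawSemiringDefs._^_ (Semiring.rawSemiring (CommutativeRing.semiring (D/ π))) (fromℤ n) k
    χ≈pow : ∀ n → χℤ n ≈[ π ] pow n
    χ≈pow n = ≈-trans (≈-sym (χ-≈ (fromℤ n))) (reflexive (sym (^-quotient π (fromℤ n) k)))

  -- Squaring is conjugation on the values of `χ`, so `conj J` is the Jacobi sum of the squared
  -- character.
  norm-J : norm J ≡ + p
  norm-J = cong re (begin
    fromℤ (norm J)       ≡⟨ ⊛-conj J ⟨
    J ⊛ conj J           ≡⟨ cong (J ⊛_) conj-J ⟩
    J ⊛ G.jacobi (G._² χℤ) (G._² χℤ)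
                         ≡⟨ GaussSumPowers.J*J²≈P D-commutativeRing p prime-p isCubicCharacter ⟩
    Multiples._×_ 𝔻.semiring p 1D
                         ≡⟨ ·1≡fromℤ p ⟩
    fromℤ (+ p)          ∎)
    where
    open ≡-Reasoning
    conj-J : conj J ≡ S.∑ (λ u → (χℤ u ⊛ χℤ u) ⊛ (χℤ (1ℤ ℤ.- u) ⊛ χℤ (1ℤ ℤ.- u)))
    conj-J = trans (conj-∑ (λ u → χℤ u ⊛ χℤ (1ℤ ℤ.- u))) (S.∑-cong (λ u → trans (conj-⊛ (χℤ u) (χℤ (1ℤ ℤ.- u)))
      (sym (cong₂ _⊛_ (χ²≡conj (fromℤ u)) (χ²≡conj (fromℤ (1ℤ ℤ.- u)))))))

  J≡-1[mod3] : J ⊛ (⊝ 1D) ≈[ fromℤ (+ 3) ] 1D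
  J≡-1[mod3] = subst (λ x → x ⊛ (⊝ 1D) ≈[ fromℤ (+ 3) ] 1D)
    (∑-quotient (fromℤ (+ 3)) (λ u → χℤ u ⊛ χℤ (1ℤ ℤ.- u)))
    (GaussSumPowers.J≈-1 (D/ fromℤ (+ 3)) p prime-p (isCubicCharacter-mod (fromℤ (+ 3)))
      (·1≈0 3 (∣-refl (fromℤ (+ 3)))) 3≉0)
    where
    3≉0 : ¬ + 3 ≈ₚ 0ℤ
    3≉0 e = ℕ.<⇒≱ (Characteristic.[1+2k]<p prime-p p≡1+3k)
      (ℕ.≤-trans (ℕ.∣⇒≤ (ℤ.∣⇒∣ᵤ (F.≈0⇒∣ e))) (go k k≢0))
      where
      go : ∀ k → ℕ.NonZero k → 3 ℕ.≤ k ℕ.+ suc k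
      go (suc k) _ = s≤s (subst (2 ℕ.≤_) (sym (ℕ.+-suc k (suc k))) (s≤s (ℕ.≤-trans (s≤s z≤n) (ℕ.m≤n+m (suc k) k))))

  -- The cofactor `κ` of `π` in `J` has norm 1 because both norms are `p`. Modulo 3 both `- π` and
  -- `- J` are 1, hence `κ` is 1 modulo 3 as well, and so it is 1.
  J≡π : J ≡ π
  J≡π = go π∣J
    where
    open Mod (fromℤ (+ 3))
    go : π ∣ J → J ≡ π
    go (κ Divides., κπ≡J) = trans (sym κπ≡J) (trans (cong (_⊛ π) κ≡1) (𝔻.*-identityˡ π))
      where
      norm-κ : norm κ ≡ 1ℤ
      norm-κ = trans (sym (norm-nonNeg κ)) (cong +_ (ℕ.*-cancelʳ-≡ ∣ norm κ ∣ 1 p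
        (trans (cong (∣ norm κ ∣ ℕ.*_) (sym (cong ∣_∣ norm≡p)))
          (trans (sym (∣norm∣-⊛ κ π)) (trans (cong (∣_∣ ∘ norm) κπ≡J)
            (trans (cong ∣_∣ norm-J) (sym (ℕ.*-identityˡ p))))))))

      κ≈1 : κ ≈[ fromℤ (+ 3) ] 1D
      κ≈1 = begin
        κ                              ≡⟨ 𝔻.*-identityʳ κ ⟨
        -- Modulo 3, 1 is `-2`, and 2 is what a primary `π` is congruent to.
        κ ⊛ 1D                         ≈⟨ *-congˡ {κ} {1D} {fromℤ (+ 2) ⊛ (⊝ 1D)} (difference∣ (1D Divides., refl)) ⟩
        κ ⊛ (fromℤ (+ 2) ⊛ (⊝ 1D))     ≈⟨ *-congˡ {κ} {fromℤ (+ 2) ⊛ (⊝ 1D)} {π ⊛ (⊝ 1D)}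
                                            (*-congʳ {⊝ 1D} {fromℤ (+ 2)} {π} (≈-sym (difference∣ primary))) ⟩
        κ ⊛ (π ⊛ (⊝ 1D))               ≡⟨ 𝔻.*-assoc κ π (⊝ 1D) ⟨
        (κ ⊛ π) ⊛ (⊝ 1D)               ≡⟨ cong (_⊛ (⊝ 1D)) κπ≡J ⟩
        J ⊛ (⊝ 1D)                     ≈⟨ J≡-1[mod3] ⟩
        1D                             ∎

      κ≡1 : κ ≡ 1D
      κ≡1 = unit≡1 κ norm-κ (Quotient.difference κ≈1)

  -- Additivity is asked for in every ring where `l` vanishes, because it is applied in the group
  -- ring over `D/l` and not in `D/l` itself.
  power-reciprocity : ∀ {l} m → (∀ (R : CommutativeRing 0ℓ 0ℓ) → let open CommutativeRing R in
      Multiples._×_ semiring l 1# ≈ 0# → Frobenius.Additive R (suc (m ℕ.* 3))) →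
    ¬ + suc (m ℕ.* 3) ≈ₚ 0ℤ →
    (π ⊛ fromℤ (+ p)) ^ m ⊛ χℤ (+ suc (m ℕ.* 3)) ≈[ fromℤ (+ l) ] 1D
  power-reciprocity {l} m additive n≉0 =
    subst (λ x → x ⊛ χℤ (+ suc (m ℕ.* 3)) ≈[ γ ] 1D) (^-quotient γ (π ⊛ fromℤ (+ p)) m)
      (J*P-power {π} {fromℤ (+ p)} m
        (reflexive (trans (∑-quotient γ (λ u → χℤ u ⊛ χℤ (1ℤ ℤ.- u))) J≡π))
        (reflexive (·1-quotient γ p))
        (additive (GroupRing.groupRing (D/ γ) p) (groupRing-char l (·1≈0 l (∣-refl γ)))) n≉0)
    where
    γ : D
    γ = fromℤ (+ l)
    open Mod γ using (reflexive)
    open GaussSumPowers (D/ γ) p prime-p (isCubicCharacter-mod γ)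

-- Reciprocity

-- The norm `1 + 3 m` is ℓ or ℓ²; the two divisibilities express this in a form that serves both
-- cases. Additivity ranges over all rings since the group ring in question depends on the other
-- prime.
record RationalPrimeBelow (π : D) (m : ℕ) : Set₁ where
  field
    ℓ        : ℕ
    prime-ℓ  : ℕ.Prime ℓ
    π∣ℓ      : π ∣ fromℤ (+ ℓ)
    ℓ∣N      : ℓ ℕ.∣ suc (m ℕ.* 3)
    N∣ℓ²     : suc (m ℕ.* 3) ℕ.∣ ℓ ℕ.* ℓ
    additive : ∀ (R : CommutativeRing 0ℓ 0ℓ) → let open CommutativeRing R in
      Multiples._×_ semiring ℓ 1# ≈ 0# → Frobenius.Additive R (suc (m ℕ.* 3))

rationalPrimeBelow : ∀ {π} (prime-π : Prime π) (primary : Primary π) (cl : Classification prime-π primary) →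
  RationalPrimeBelow π (CubicModulus.k (cubicModulus prime-π primary cl))
rationalPrimeBelow {π} prime-π primary (split {p} k prime-p p≡ norm≡p) = record
  { ℓ = p ; prime-ℓ = prime-p
  ; π∣ℓ = subst (λ n → π ∣ fromℤ n) norm≡p (∣fromℤ-norm π)
  ; ℓ∣N = ℕ.∣-reflexive p≡
  ; N∣ℓ² = subst (ℕ._∣ p ℕ.* p) p≡ (ℕ.m∣m*n p)
  ; additive = λ R p≈0 → subst (Frobenius.Additive R) p≡ (Frobenius.prime-additive R prime-p p≈0) }
rationalPrimeBelow {π} prime-π primary cl@(inert {q} j prime-q q≡ π≡q) = record
  { ℓ = q ; prime-ℓ = prime-q
  ; π∣ℓ = subst (π ∣_) π≡q (∣-refl π)
  ; ℓ∣N = subst (q ℕ.∣_) q*q≡N (ℕ.m∣m*n q)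
  ; N∣ℓ² = ℕ.∣-reflexive (sym q*q≡N)
  ; additive = λ R q≈0 → subst (Frobenius.Additive R) q*q≡N
      (Frobenius.additive-* R (Frobenius.prime-additive R prime-q q≈0) (Frobenius.prime-additive R prime-q q≈0)) }
  where
  q*q≡N : q ℕ.* q ≡ suc (CubicModulus.k (cubicModulus prime-π primary cl) ℕ.* 3)
  q*q≡N = trans (sym (trans (cong (∣_∣ ∘ norm) π≡q) (∣norm∣-fromℤ (+ q))))
    (CubicModulus.norm≡ (cubicModulus prime-π primary cl))

prime∣prime⇒≡ : ∀ {p q} → ℕ.Prime p → ℕ.Prime q → p ℕ.∣ q → p ≡ q
prime∣prime⇒≡ prime-p prime-q p∣q =
  [ (λ p≡1 → ⊥-elim (ℕ.¬prime[1] (subst ℕ.Prime p≡1 prime-p))) , id ]′ (ℕ.prime⇒irreducible prime-q p∣q)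

module Reciprocity
  {π₁ π₂ : D} (cm₁ : CubicModulus π₁) (below : RationalPrimeBelow π₁ (CubicModulus.k cm₁))
  (cm₂ : CubicModulus π₂) (primary₂ : Primary π₂)
  {p : ℕ} (prime-p : ℕ.Prime p) (norm≡p : norm π₂ ≡ + p) (ℓ≢p : RationalPrimeBelow.ℓ below ≢ p) where
  open RationalPrimeBelow below
  open CubicModulus cm₁ using (k; norm≡; π∤1-ω)
  private
    module π₁ = CubicResidue cm₁
    module π₂ = CubicResidue cm₂
    open SplitPrime cm₂ primary₂ prime-p norm≡p using (π∣p; π∣n⇒n≈0; power-reciprocity)
    instance
      nonZero : ℕ.NonZero p
      nonZero = ℕ.prime⇒nonZero prime-p

    N : ℕ
    N = suc (k ℕ.* 3)

  square-∣ : ∀ {n} → ℓ ℕ.∣ n ℕ.* n → ℓ ℕ.∣ n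
  square-∣ {n} d = reduce (ℕ.euclidsLemma n n prime-ℓ d)

  π₁∤p : π₁ ∤ fromℤ (+ p)
  π₁∤p d = ℓ≢p (prime∣prime⇒≡ prime-ℓ prime-p (square-∣ (ℕ.∣-trans ℓ∣N (subst₂ ℕ._∣_ norm≡
    (∣norm∣-fromℤ (+ p)) (∣⇒∣norm∣ d)))))

  N≉0 : ¬ Residues._≈ₚ_ p (+ N) 0ℤ
  N≉0 e = ℓ≢p (sym (prime∣prime⇒≡ prime-p prime-ℓ (reduce (ℕ.euclidsLemma ℓ ℓ prime-p
    (ℕ.∣-trans (ℤ.∣⇒∣ᵤ (PrimeResidues.≈0⇒∣ p prime-p e)) N∣ℓ²)))))

  π₁∤π₂ : π₁ ∤ π₂
  π₁∤π₂ d = π₁∤p (∣-trans d π∣p)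

  χ[p]-μ₃ : μ₃ (χ π₁ (fromℤ (+ p)))
  χ[p]-μ₃ = π₁.χ-μ₃ π₁∤p

  χ[π₂]-μ₃ : μ₃ (χ π₁ π₂)
  χ[π₂]-μ₃ = π₁.χ-μ₃ π₁∤π₂

  -- Since `π₁` divides ℓ, the congruence of `power-reciprocity` holds modulo `π₁`, where the k-th
  -- power becomes the character of `π₁`. Both sides are cube roots of unity, and these are distinct
  -- modulo `π₁`, so the congruence is an equality.
  χ-product : (χ π₁ π₂ ⊛ χ π₁ (fromℤ (+ p))) ⊛ χ π₂ (fromℤ (+ N)) ≡ 1D
  χ-product = μ₃-unique π∤1-ω
    (μ₃-⊛ (μ₃-⊛ χ[π₂]-μ₃ χ[p]-μ₃) (π₂.χ-μ₃ (λ d → N≉0 (π∣n⇒n≈0 d)))) μ1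
    (≈-trans (*-congʳ {χ π₂ (fromℤ (+ N))} {χ π₁ π₂ ⊛ χ π₁ (fromℤ (+ p))} {(π₂ ⊛ fromℤ (+ p)) ^ k}
        (≈-trans (reflexive (sym (π₁.χ-⊛ π₂ (fromℤ (+ p))))) (≈-sym (π₁.χ-≈ (π₂ ⊛ fromℤ (+ p))))))
      (≈-∣ π∣ℓ (power-reciprocity {ℓ} k additive N≉0)))
    where open Mod π₁ using (≈-trans; ≈-sym; reflexive; *-congʳ)

-- For a rational prime q ≡ 2 (mod 3), (q² - 1)/3 is a multiple of q - 1.
inert-χ≡1 : ∀ {π} (cm : CubicModulus π) {q} j → ℕ.Prime q → q ≡ suc (suc (j ℕ.* 3)) → π ≡ fromℤ (+ q) →
  ∀ n → π ∤ fromℤ n → χ π (fromℤ n) ≡ 1D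
inert-χ≡1 {π} cm {q} j prime-q q≡ π≡q n π∤n =
  χ-determined π∤n μ1 (subst (λ m → fromℤ n ^ m ≈[ π ] 1D) (sym k≡)
    (≈-trans (reflexive (sym (^-assocʳ (fromℤ n) (suc (j ℕ.* 3)) (suc j))))
      (≈-trans (^-cong-mod (suc j) n^[q-1]) (reflexive (1^ (suc j))))))
  where
  open CubicModulus cm using (k; norm≡)
  open CubicResidue cm
  open Mod π using (≈-trans; reflexive)

  n^[q-1] : fromℤ n ^ suc (j ℕ.* 3) ≈[ π ] 1D
  n^[q-1] = cancel-power (suc (j ℕ.* 3)) π∤n
    (subst₂ (λ m γ → fromℤ n ^ m ≈[ γ ] fromℤ n) q≡ (sym π≡q) (Characteristic.fermat-ℤ prime-q n))

  -- With `q = 2 + 3 j` the two factors are `q - 1` and `(q + 1)/3`.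
  lem : ∀ j → (2 ℕ.+ j ℕ.* 3) ℕ.* (2 ℕ.+ j ℕ.* 3) ≡ 1 ℕ.+ ((1 ℕ.+ j ℕ.* 3) ℕ.* (1 ℕ.+ j)) ℕ.* 3
  lem = ℕ.solve-∀

  k≡ : k ≡ suc (j ℕ.* 3) ℕ.* suc j
  k≡ = ℕ.*-cancelʳ-≡ k _ 3 (ℕ.suc-injective (begin
    suc (k ℕ.* 3)                          ≡⟨ norm≡ ⟨
    ∣ norm π ∣                             ≡⟨ cong (∣_∣ ∘ norm) π≡q ⟩
    ∣ norm (fromℤ (+ q)) ∣                 ≡⟨ ∣norm∣-fromℤ (+ q) ⟩
    q ℕ.* q                                ≡⟨ cong (λ q → q ℕ.* q) q≡ ⟩
    suc (suc (j ℕ.* 3)) ℕ.* suc (suc (j ℕ.* 3)) ≡⟨ lem j ⟩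
    suc ((suc (j ℕ.* 3) ℕ.* suc j) ℕ.* 3)  ∎))
    where open ≡-Reasoning

1+3k≢2+3j : ∀ (k j : ℕ) → suc (k ℕ.* 3) ≢ suc (suc (j ℕ.* 3))
1+3k≢2+3j zero    j       ()
1+3k≢2+3j (suc k) zero    ()
1+3k≢2+3j (suc k) (suc j) e = 1+3k≢2+3j k j (ℕ.+-cancelˡ-≡ 3 _ _ e)

module _ {π₁ π₂ : D} (prime₁ : Prime π₁) (prime₂ : Prime π₂) (primary₁ : Primary π₁) (primary₂ : Primary π₂) where

  -- Both instances of `χ-product` involve the same two values `b` and `c` at rational primes, so
  -- `a` and `a′` are inverse to the same product.
  reciprocity-split : ∀ {p₁ p₂} k₁ k₂ (prime-p₁ : ℕ.Prime p₁) (p₁≡ : p₁ ≡ suc (k₁ ℕ.* 3)) (norm₁ : norm π₁ ≡ + p₁)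
    (prime-p₂ : ℕ.Prime p₂) (p₂≡ : p₂ ≡ suc (k₂ ℕ.* 3)) (norm₂ : norm π₂ ≡ + p₂) →
    norm π₁ ≢ norm π₂ → χ π₁ π₂ ≡ χ π₂ π₁
  reciprocity-split {p₁} {p₂} k₁ k₂ prime-p₁ p₁≡ norm₁ prime-p₂ p₂≡ norm₂ N₁≢N₂ = begin
    a                      ≡⟨ 𝔻.*-identityʳ a ⟨
    a ⊛ 1D                 ≡⟨ cong (a ⊛_) a′cb≡1 ⟨
    a ⊛ ((a′ ⊛ c) ⊛ b)     ≡⟨ rearrange ⟩
    a′ ⊛ ((a ⊛ b) ⊛ c)     ≡⟨ cong (a′ ⊛_) abc≡1 ⟩
    a′ ⊛ 1D                ≡⟨ 𝔻.*-identityʳ a′ ⟩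
    a′                     ∎
    where
    open ≡-Reasoning
    open CommutativeSemigroupProperties 𝔻.*-commutativeSemigroup
    cl₁ = split k₁ prime-p₁ p₁≡ norm₁
    cl₂ = split k₂ prime-p₂ p₂≡ norm₂
    cm₁ = cubicModulus prime₁ primary₁ cl₁
    cm₂ = cubicModulus prime₂ primary₂ cl₂

    p₁≢p₂ : p₁ ≢ p₂
    p₁≢p₂ e = N₁≢N₂ (trans norm₁ (trans (cong +_ e) (sym norm₂)))

    a b c a′ : D
    a  = χ π₁ π₂
    b  = χ π₁ (fromℤ (+ p₂))
    c  = χ π₂ (fromℤ (+ p₁))
    a′ = χ π₂ π₁

    abc≡1 : (a ⊛ b) ⊛ c ≡ 1D
    abc≡1 = subst (λ n → (a ⊛ b) ⊛ χ π₂ (fromℤ (+ n)) ≡ 1D) (sym p₁≡)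
      (Reciprocity.χ-product cm₁ (rationalPrimeBelow prime₁ primary₁ cl₁) cm₂ primary₂ prime-p₂ norm₂ p₁≢p₂)

    a′cb≡1 : (a′ ⊛ c) ⊛ b ≡ 1D
    a′cb≡1 = subst (λ n → (a′ ⊛ c) ⊛ χ π₁ (fromℤ (+ n)) ≡ 1D) (sym p₂≡)
      (Reciprocity.χ-product cm₂ (rationalPrimeBelow prime₂ primary₂ cl₂) cm₁ primary₁ prime-p₁ norm₁ (p₁≢p₂ ∘ sym))

    rearrange : a ⊛ ((a′ ⊛ c) ⊛ b) ≡ a′ ⊛ ((a ⊛ b) ⊛ c)
    rearrange = trans (cong (a ⊛_) (𝔻.*-assoc a′ c b)) (trans (x∙yz≈y∙xz a a′ (c ⊛ b))
      (cong (a′ ⊛_) (trans (cong (a ⊛_) (𝔻.*-comm c b)) (sym (𝔻.*-assoc a b c)))))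

  -- The norm of `π₁` is `π₁ ⊛ π₁`, so its character value is `v ⊛ v`; together with `v³ = 1` the
  -- product formula leaves `a = v`. The rational primes `q` and `p` differ because they are 2 and 1
  -- modulo 3.
  reciprocity-mixed : ∀ {q p} j k (prime-q : ℕ.Prime q) (q≡ : q ≡ suc (suc (j ℕ.* 3))) (π₁≡q : π₁ ≡ fromℤ (+ q))
    (prime-p : ℕ.Prime p) (p≡ : p ≡ suc (k ℕ.* 3)) (norm₂ : norm π₂ ≡ + p) → χ π₁ π₂ ≡ χ π₂ π₁
  reciprocity-mixed {q} {p} j k prime-q q≡ π₁≡q prime-p p≡ norm₂ = begin
    a                     ≡⟨ 𝔻.*-identityʳ a ⟨
    a ⊛ 1D                ≡⟨ cong (a ⊛_) (μ₃-cube (CubicResidue.χ-μ₃ cm₂ π₂∤π₁)) ⟨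
    a ⊛ (v ⊛ (v ⊛ v))     ≡⟨ x∙yz≈y∙xz a v (v ⊛ v) ⟩
    v ⊛ (a ⊛ (v ⊛ v))     ≡⟨ cong (v ⊛_) av²≡1 ⟩
    v ⊛ 1D                ≡⟨ 𝔻.*-identityʳ v ⟩
    v                     ∎
    where
    open ≡-Reasoning
    open CommutativeSemigroupProperties 𝔻.*-commutativeSemigroup using (x∙yz≈y∙xz)
    cl₁ = inert j prime-q q≡ π₁≡q
    cl₂ = split k prime-p p≡ norm₂
    cm₁ = cubicModulus prime₁ primary₁ cl₁
    cm₂ = cubicModulus prime₂ primary₂ cl₂

    q≢p : q ≢ p
    q≢p e = 1+3k≢2+3j k j (trans (sym p≡) (trans (sym e) q≡))

    module Rec = Reciprocity cm₁ (rationalPrimeBelow prime₁ primary₁ cl₁) cm₂ primary₂ prime-p norm₂ q≢p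

    a v : D
    a = χ π₁ π₂
    v = χ π₂ π₁

    N≡ : fromℤ (+ suc (CubicModulus.k cm₁ ℕ.* 3)) ≡ π₁ ⊛ π₁
    N≡ = trans (cong (λ n → fromℤ (+ n)) (sym (CubicModulus.norm≡ cm₁)))
      (trans (cong fromℤ (trans (norm-nonNeg π₁) (trans (cong norm π₁≡q) (norm-fromℤ (+ q)))))
        (trans (fromℤ-* (+ q) (+ q)) (sym (cong₂ _⊛_ π₁≡q π₁≡q))))

    π₂∤π₁ : π₂ ∤ π₁
    π₂∤π₁ d = q≢p (sym (prime∣prime⇒≡ prime-p prime-q (reduce (ℕ.euclidsLemma q q prime-p
      (subst₂ ℕ._∣_ (cong ∣_∣ norm₂) (trans (cong (∣_∣ ∘ norm) π₁≡q) (∣norm∣-fromℤ (+ q)))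
        (∣⇒∣norm∣ d))))))

    av²≡1 : a ⊛ (v ⊛ v) ≡ 1D
    av²≡1 = trans (cong₂ _⊛_
        (sym (trans (cong (a ⊛_) (inert-χ≡1 cm₁ j prime-q q≡ π₁≡q (+ p) Rec.π₁∤p)) (𝔻.*-identityʳ a)))
        (trans (sym (CubicResidue.χ-⊛ cm₂ π₁ π₁)) (cong (χ π₂) (sym N≡))))
      Rec.χ-product

  reciprocity-inert : ∀ {q₁ q₂} j₁ j₂ (prime-q₁ : ℕ.Prime q₁) (q₁≡ : q₁ ≡ suc (suc (j₁ ℕ.* 3))) (π₁≡q₁ : π₁ ≡ fromℤ (+ q₁))
    (prime-q₂ : ℕ.Prime q₂) (q₂≡ : q₂ ≡ suc (suc (j₂ ℕ.* 3))) (π₂≡q₂ : π₂ ≡ fromℤ (+ q₂)) →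
    norm π₁ ≢ norm π₂ → χ π₁ π₂ ≡ χ π₂ π₁
  reciprocity-inert {q₁} {q₂} j₁ j₂ prime-q₁ q₁≡ π₁≡q₁ prime-q₂ q₂≡ π₂≡q₂ N₁≢N₂ = trans
    (trans (cong (χ π₁) π₂≡q₂) (inert-χ≡1 cm₁ j₁ prime-q₁ q₁≡ π₁≡q₁ (+ q₂)
      (λ d → q₁≢q₂ (prime∣prime⇒≡ prime-q₁ prime-q₂ (ℤ.∣⇒∣ᵤ (fromℤ∣⇒∣re (subst (_∣ fromℤ (+ q₂)) π₁≡q₁ d)))))))
    (sym (trans (cong (χ π₂) π₁≡q₁) (inert-χ≡1 cm₂ j₂ prime-q₂ q₂≡ π₂≡q₂ (+ q₁)
      (λ d → q₁≢q₂ (sym (prime∣prime⇒≡ prime-q₂ prime-q₁ (ℤ.∣⇒∣ᵤ (fromℤ∣⇒∣re (subst (_∣ fromℤ (+ q₁)) π₂≡q₂ d)))))))))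
    where
    cm₁ = cubicModulus prime₁ primary₁ (inert j₁ prime-q₁ q₁≡ π₁≡q₁)
    cm₂ = cubicModulus prime₂ primary₂ (inert j₂ prime-q₂ q₂≡ π₂≡q₂)
    q₁≢q₂ : q₁ ≢ q₂
    q₁≢q₂ e = N₁≢N₂ (cong norm (trans π₁≡q₁ (trans (cong (λ q → fromℤ (+ q)) e) (sym π₂≡q₂))))

theorem3p13 : (π₁ π₂ : D) → Prime π₁ → Prime π₂ →
    Primary π₁ → Primary π₂ →
    norm π₁ ≢ + 3 → norm π₂ ≢ + 3 → norm π₁ ≢ norm π₂ →
    χ π₁ π₂ ≡ χ π₂ π₁
theorem3p13 π₁ π₂ prime₁ prime₂ primary₁ primary₂ _ _ N₁≢N₂ =
  go (classify prime₁ primary₁) (classify prime₂ primary₂)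
  where
  go : Classification prime₁ primary₁ → Classification prime₂ primary₂ → χ π₁ π₂ ≡ χ π₂ π₁
  go (split k₁ pr₁ e₁ n₁) (split k₂ pr₂ e₂ n₂) =
    reciprocity-split prime₁ prime₂ primary₁ primary₂ k₁ k₂ pr₁ e₁ n₁ pr₂ e₂ n₂ N₁≢N₂
  go (inert j₁ pr₁ e₁ n₁) (split k₂ pr₂ e₂ n₂) =
    reciprocity-mixed prime₁ prime₂ primary₁ primary₂ j₁ k₂ pr₁ e₁ n₁ pr₂ e₂ n₂
  go (split k₁ pr₁ e₁ n₁) (inert j₂ pr₂ e₂ n₂) =
    sym (reciprocity-mixed prime₂ prime₁ primary₂ primary₁ j₂ k₁ pr₂ e₂ n₂ pr₁ e₁ n₁)
  go (inert j₁ pr₁ e₁ n₁) (inert j₂ pr₂ e₂ n₂) =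
    reciprocity-inert prime₁ prime₂ primary₁ primary₂ j₁ j₂ pr₁ e₁ n₁ pr₂ e₂ n₂ N₁≢N₂
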